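{- For every positive integer $n$, $$\sum_{i=0}^{n-1} \sum_{j=0}^{n-1} q^{j^2+i+j} \begin{bmatrix} i+j \\ i \end{bmatrix}_q^2 \equiv \left(\frac{n}{3}\right) q^{\frac{n^2-1}{3}} \pmod{\Phi_n(q)^2}.$$
   Context: The Gaussian $q$-binomial coefficient is $\begin{bmatrix} n \\ k \end{bmatrix}_q=\frac{(q;q)_n}{(q;q)_k(q;q)_{n-k}}$ for $0\le k\le n$ and $0$ otherwise, where $(a;q)_m=(1-a)(1-aq)\cdots(1-aq^{m-1})$ for $m\ge1$ and $(a;q)_0=1$. For an integer $m$, $\left(\frac{m}{3}\right)$ is the Legendre symbol modulo 3: $1$ if $m\equiv1\pmod 3$, $-1$ if $m\equiv 2\pmod 3$, $0$ if $3\mid m$ (so the right-hand side is $0$ when $3\mid n$, and otherwise $(n^2-1)/3$ is an integer). $\Phi_n(q)=\prod_{1\le k\le n,\ \gcd(n,k)=1}(q-e^{2\pi i k/n})$ is the $n$th cyclotomic polynomial, and the congruence is divisibility of the difference by $\Phi_n(q)^2$ in $\mathbb{Z}[q]$. -}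

module Defs where

open import Data.Nat as ℕ using (ℕ; zero; suc; _∸_; _%_; _/_; _≤ᵇ_; _<ᵇ_)
open import Data.Nat.Divisibility using (_∣?_)
open import Data.Integer as ℤ using (ℤ; +_; -[1+_])
open import Data.List using (List; []; _∷_; map; foldr; reverse; length; replicate; _++_; upTo; concatMap; filter)
open import Data.List.Relation.Unary.All using (All)
open import Data.Product using (Σ; _×_; _,_; proj₁; proj₂)
open import Data.Bool using (Bool; true; false; if_then_else_)
open import Relation.Binary.PropositionalEquality using (_≡_)

-- Polynomials in ℤ[q], as coefficient lists, constant term first.
-- Lists differing by trailing zeros denote the same polynomial.
Poly : Set
Poly = List ℤ

infixl 6 _⊕_ _⊖_
infixl 7 _⊛_

_⊕_ : Poly → Poly → Poly
[] ⊕ r = r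
(a ∷ p) ⊕ [] = a ∷ p
(a ∷ p) ⊕ (b ∷ r) = (a ℤ.+ b) ∷ (p ⊕ r)

scale : ℤ → Poly → Poly
scale c p = map (c ℤ.*_) p

negP : Poly → Poly
negP p = map ℤ.-_ p

_⊖_ : Poly → Poly → Poly
p ⊖ r = p ⊕ negP r

_⊛_ : Poly → Poly → Poly
[] ⊛ r = []
(a ∷ p) ⊛ r = scale a r ⊕ ((+ 0) ∷ (p ⊛ r))

oneP : Poly
oneP = (+ 1) ∷ []

mono : ℕ → Poly
mono k = replicate k (+ 0) ++ ((+ 1) ∷ [])

prodP : List Poly → Poly
prodP = foldr _⊛_ oneP

sumP : List Poly → Poly
sumP = foldr _⊕_ []

IsZero : Poly → Set
IsZero p = All (_≡ + 0) p

private
  cons0 : ℤ → Poly → Poly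
  cons0 (+ zero) [] = []
  cons0 a p = a ∷ p

trim : Poly → Poly
trim = foldr cons0 []

-- Exact division in ℤ[q] by a polynomial whose leading coefficient u is a
-- unit (u = ±1, so u⁻¹ = u): ordinary long division, returning the quotient.
-- (All divisions used below are exact divisions by such polynomials.)
private
  subMul : List ℤ → ℤ → List ℤ → List ℤ
  subMul (x ∷ xs) c (y ∷ ys) = (x ℤ.- c ℤ.* y) ∷ subMul xs c ys
  subMul xs c [] = xs
  subMul [] c (y ∷ ys) = []

  -- highest-degree-first lists
  longDiv : ℕ → ℤ → List ℤ → List ℤ → List ℤ
  longDiv zero u ds r = []
  longDiv (suc f) u ds [] = []
  longDiv (suc f) u ds (x ∷ r) =
    if length r <ᵇ length ds then []
    else (u ℤ.* x) ∷ longDiv f u ds (subMul r (u ℤ.* x) ds)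

_÷_ : Poly → Poly → Poly
p ÷ d with reverse (trim d)
... | [] = []
... | u ∷ ds = let pr = reverse (trim p) in reverse (longDiv (length pr) u ds pr)

qpoch : ℕ → Poly
qpoch m = prodP (map (λ k → oneP ⊖ mono (suc k)) (upTo m))

qbinom : ℕ → ℕ → Poly
qbinom n k = if k ≤ᵇ n then qpoch n ÷ (qpoch k ⊛ qpoch (n ∸ k)) else []

-- Cyclotomic polynomials, defined through q^m - 1 = ∏_{d ∣ m} Φ_d(q), i.e.
-- Φ_m = (q^m - 1) / ∏_{d ∣ m, d < m} Φ_d.
private
  newPhi : ℕ → List (ℕ × Poly) → Poly
  newPhi m prev =
    (mono m ⊖ oneP) ÷ prodP (map proj₂ (filter (λ dp → proj₁ dp ∣? m) prev))

  phiList : ℕ → List (ℕ × Poly)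
  phiList zero = []
  phiList (suc n) = phiList n ++ ((suc n , newPhi (suc n) (phiList n)) ∷ [])

Φ : ℕ → Poly
Φ zero = oneP   -- unused convention
Φ (suc n) = newPhi (suc n) (phiList n)

_≡_[modP_] : Poly → Poly → Poly → Set
p ≡ r [modP m ] = Σ Poly (λ g → IsZero ((p ⊖ r) ⊖ m ⊛ g))

legendre3 : ℕ → ℤ
legendre3 m with m % 3
... | 1 = + 1
... | 2 = -[1+ 0 ]
... | _ = + 0

lhsSum : ℕ → Poly
lhsSum n = sumP (concatMap (λ i → map (λ j →
             mono (j ℕ.* j ℕ.+ i ℕ.+ j) ⊛ (qbinom (i ℕ.+ j) i ⊛ qbinom (i ℕ.+ j) i))
             (upTo n)) (upTo n))

rhsTerm : ℕ → Poly
rhsTerm n = scale (legendre3 n) (mono ((n ℕ.* n ∸ 1) / 3))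

{-# OPTIONS --safe #-}

-- The terms with i + j ≥ n contain the square of a multiple of Φ_n, and by the q-Vandermonde
-- identity Σ_{i+j=m} q^{j²} [m,i]² = [2m,m] the others add up to Σ_{k<n} q^k [2k,k]. Put p = 1/q
-- modulo Φ_n². Since (p^n - 1)² vanishes, the product ∏_{j≤k} (1 - a q^{k+j}), as a function of a, has
-- zero second difference along 1, p^n, p^{2n}; dividing by (q;q)_k, which is regular for k < n, gives
--   q^k [2k,k] = 2 t(n-1,k) - t(2n-1,k),   t(L,k) = (-1)^k p^{k(k-1)/2} [L-k,k]_p.
-- The sums s(L) = Σ_k t(L,k) satisfy s(L+3) = -p^{L+1} s(L) (Ekhad and Zeilberger), so they are
-- zero or signed powers of p, and the difference of the two sides of the theorem becomes
-- ± q^e (1 - z)² with e = (n² - 1)/3 and z = ± p^h, where z ≡ 1 modulo Φ_n because 2h is a multiple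
-- of n.
module Submission where

open import Defs
open import Algebra.Bundles using (CommutativeRing)
import Algebra.Properties.Semiring.Exp
import Algebra.Solver.Ring
open import Algebra.Solver.Ring.AlmostCommutativeRing using (fromCommutativeRing; _-Raw-AlmostCommutative⟶_)
open import Algebra.Structures using (IsCommutativeRing)
open import Data.Bool using (T; true; false; if_then_else_)
open import Data.Integer as ℤ using (ℤ; +_; -[1+_])
import Data.Integer.Properties as ℤ
import Data.Integer.Tactic.RingSolver as ℤ-Solver
open import Data.List using (List; []; _∷_; _++_; map; filter; foldl; reverse; length; upTo; applyUpTo; concatMap)
open import Data.List.Properties using
  (unfold-reverse; length-reverse; reverse-++; reverse-involutive; filter-++; filter-accept; filter-reject; map-++; upTo-∷ʳ)
open import Data.List.Relation.Unary.All using ([]; _∷_)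
open import Data.Maybe as Maybe using (Maybe)
open import Data.Nat as ℕ using (ℕ; zero; suc; _∸_; _%_; _/_; _≤_; _<_; _<ᵇ_; _≤ᵇ_; z≤n; s≤s)
import Data.Nat.Divisibility as ℕ
open import Data.Nat.DivMod using ([m+kn]%n≡m%n; m*n/n≡m)
open import Data.Nat.GCD using (gcd; gcd[m,n]∣m; gcd[m,n]∣n; gcd-GCD; module Bézout)
import Data.Nat.Properties as ℕ
open import Data.Nat.Tactic.RingSolver using (solve-∀)
open import Data.Product using (Σ; _×_; _,_; proj₁; proj₂)
open import Data.Sum using (_⊎_; inj₁; inj₂)
open import Level using (0ℓ; _⊔_)
open import Relation.Binary.Consequences using (dec⇒weaklyDec)
open import Relation.Binary.Definitions using (tri<; tri≈; tri>)
open import Relation.Binary.PropositionalEquality as ≡ using (_≡_; _≢_)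
open import Relation.Binary.Structures using (IsEquivalence)
open import Relation.Nullary using (¬_; yes; no; contradiction)

-- Division by (q;q)_k is the delicate point. For 0 < d < n the element 1 - q^d need not be a unit
-- of ℤ[q]/(Φ_n) (modulo Φ_4 the element 1 - q^2 is 2), so only its regularity is used. Over ℤ a
-- Bézout identity for Φ_n and q^d - 1 has a nonzero integer on its left side; this integer can be
-- cancelled because Φ_n has constant coefficient 1 or -1. Since Φ_n is given as a quotient computed
-- by long division, without its roots, its factorisation property, its unit coefficients and its
-- coprimality all come out of one strong induction on the index. The q-identities are proved in an
-- arbitrary commutative ring and applied both modulo Φ_n and modulo Φ_n^2. A congruence modulo Φ_n
-- is lifted only by squaring: the discarded squares of binomial coefficients, (p^n - 1)^2, (1 -
-- z)^2 and the error of the inverse p are, up to sign, squares of multiples of Φ_n.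

-- A ring solver with integer coefficients for an arbitrary commutative ring

module IntegerSolver {c ℓ} (R : CommutativeRing c ℓ) where
  open CommutativeRing R
  open import Algebra.Properties.Ring ring
  open import Algebra.Properties.AbelianGroup +-abelianGroup using (⁻¹-∙-comm)
  open import Algebra.Properties.Semiring.Mult.TCOptimised semiring renaming (_×_ to _·_)
  open import Relation.Binary.Reasoning.Setoid setoid

  fromℤ : ℤ → Carrier
  fromℤ (+ n) = n · 1#
  fromℤ -[1+ n ] = - (suc n · 1#)

  private
    cancelOne : ∀ x y → x - y ≈ (1# + x) - (1# + y)
    cancelOne x y = sym (begin
      (1# + x) - (1# + y)       ≈⟨ +-congˡ (⁻¹-∙-comm 1# y) ⟨
      (1# + x) + (- 1# - y)     ≈⟨ +-congʳ (+-comm 1# x) ⟩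
      (x + 1#) + (- 1# - y)     ≈⟨ +-assoc x 1# _ ⟩
      x + (1# + (- 1# - y))     ≈⟨ +-congˡ (+-assoc 1# (- 1#) (- y)) ⟨
      x + ((1# - 1#) - y)       ≈⟨ +-congˡ (+-congʳ (-‿inverseʳ 1#)) ⟩
      x + (0# - y)              ≈⟨ +-congˡ (+-identityˡ _) ⟩
      x - y                     ∎)

    fromℤ-⊖ : ∀ m n → fromℤ (m ℤ.⊖ n) ≈ m · 1# - n · 1#
    fromℤ-⊖ zero zero = sym (-‿inverseʳ 0#)
    fromℤ-⊖ zero (suc n) = sym (+-identityˡ _)
    fromℤ-⊖ (suc m) zero = sym (trans (+-congˡ -0#≈0#) (+-identityʳ _))
    fromℤ-⊖ (suc m) (suc n) = begin
      fromℤ (suc m ℤ.⊖ suc n)      ≡⟨ ≡.cong fromℤ (ℤ.[1+m]⊖[1+n]≡m⊖n m n) ⟩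
      fromℤ (m ℤ.⊖ n)              ≈⟨ fromℤ-⊖ m n ⟩
      m · 1# - n · 1#              ≈⟨ cancelOne _ _ ⟩
      (1# + m · 1#) - (1# + n · 1#) ≈⟨ +-cong (1+× m 1#) (-‿cong (1+× n 1#)) ⟨
      suc m · 1# - suc n · 1#      ∎

    neg-homo : ∀ i → fromℤ (ℤ.- i) ≈ - fromℤ i
    neg-homo (+ zero) = sym -0#≈0#
    neg-homo (+ suc n) = refl
    neg-homo -[1+ n ] = sym (-‿involutive _)

    +-homo : ∀ i j → fromℤ (i ℤ.+ j) ≈ fromℤ i + fromℤ j
    +-homo (+ m) (+ n) = ×-homo-+ 1# m n
    +-homo (+ m) -[1+ n ] = fromℤ-⊖ m (suc n)
    +-homo -[1+ m ] (+ n) = trans (fromℤ-⊖ n (suc m)) (+-comm _ _)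
    +-homo -[1+ m ] -[1+ n ] = begin
      - (suc (suc (m ℕ.+ n)) · 1#)       ≡⟨ ≡.cong (λ k → - (suc k · 1#)) (+-suc m n) ⟨
      - ((suc m ℕ.+ suc n) · 1#)         ≈⟨ -‿cong (×-homo-+ 1# (suc m) (suc n)) ⟩
      - (suc m · 1# + suc n · 1#)        ≈⟨ ⁻¹-∙-comm _ _ ⟨
      - (suc m · 1#) - suc n · 1#        ∎
      where open import Data.Nat.Properties using (+-suc)

    +*-homo : ∀ m j → fromℤ (+ m ℤ.* j) ≈ fromℤ (+ m) * fromℤ j
    +*-homo m (+ n) = trans (reflexive (≡.cong fromℤ (≡.sym (ℤ.pos-* m n)))) (×1-homo-* m n)
    +*-homo m -[1+ n ] = begin
      fromℤ (+ m ℤ.* -[1+ n ])           ≡⟨ ≡.cong fromℤ (ℤ.neg-distribʳ-* (+ m) (+ suc n)) ⟨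
      fromℤ (ℤ.- (+ m ℤ.* + suc n))      ≡⟨ ≡.cong (λ i → fromℤ (ℤ.- i)) (ℤ.pos-* m (suc n)) ⟨
      fromℤ (ℤ.- (+ (m ℕ.* suc n)))      ≈⟨ neg-homo (+ (m ℕ.* suc n)) ⟩
      - fromℤ (+ (m ℕ.* suc n))          ≈⟨ -‿cong (×1-homo-* m (suc n)) ⟩
      - (fromℤ (+ m) * fromℤ (+ suc n))  ≈⟨ -‿distribʳ-* _ _ ⟩
      fromℤ (+ m) * - fromℤ (+ suc n)    ∎

    *-homo : ∀ i j → fromℤ (i ℤ.* j) ≈ fromℤ i * fromℤ j
    *-homo (+ m) j = +*-homo m j
    *-homo -[1+ m ] j = begin
      fromℤ (-[1+ m ] ℤ.* j)             ≡⟨ ≡.cong fromℤ (ℤ.neg-distribˡ-* (+ suc m) j) ⟨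
      fromℤ (ℤ.- (+ suc m ℤ.* j))        ≈⟨ neg-homo (+ suc m ℤ.* j) ⟩
      - fromℤ (+ suc m ℤ.* j)            ≈⟨ -‿cong (+*-homo (suc m) j) ⟩
      - (fromℤ (+ suc m) * fromℤ j)      ≈⟨ -‿distribˡ-* _ _ ⟩
      - fromℤ (+ suc m) * fromℤ j        ∎

    homo : ℤ.+-*-rawRing -Raw-AlmostCommutative⟶ fromCommutativeRing R
    homo = record
      { ⟦_⟧ = fromℤ ; +-homo = +-homo ; *-homo = *-homo ; -‿homo = neg-homo
      ; 0-homo = refl ; 1-homo = refl }

    -- Coefficients are compared as integers, since equality in an arbitrary ring is not decidable.
    -- The test is sound in every characteristic but may miss equalities in a positive one.
    decide : ∀ i j → Maybe (fromℤ i ≈ fromℤ j)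
    decide i j = Maybe.map (λ eq → reflexive (≡.cong fromℤ eq)) (dec⇒weaklyDec ℤ._≟_ i j)

  open Algebra.Solver.Ring ℤ.+-*-rawRing (fromCommutativeRing R) homo decide public
    using (solve; _:=_; _:+_; _:*_; _:-_; :-_; con; _:^_)

-- Sums and products

module FiniteSums {c ℓ} (R : CommutativeRing c ℓ) where
  open CommutativeRing R
  open IntegerSolver R
  open import Algebra.Properties.Semiring.Exp semiring
  open import Relation.Binary.Reasoning.Setoid setoid

  ^-≡ : ∀ x {m n} → m ≡ n → x ^ m ≈ x ^ n
  ^-≡ x eq = reflexive (≡.cong (x ^_) eq)

  1^n : ∀ n → 1# ^ n ≈ 1#
  1^n zero = refl
  1^n (suc n) = trans (*-identityˡ _) (1^n n)

  Sum : ℕ → (ℕ → Carrier) → Carrier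
  Sum zero f = 0#
  Sum (suc n) f = f 0 + Sum n (λ k → f (suc k))

  Sum-cong : ∀ n {f g} → (∀ k → k < n → f k ≈ g k) → Sum n f ≈ Sum n g
  Sum-cong zero eq = refl
  Sum-cong (suc n) eq = +-cong (eq 0 (s≤s z≤n)) (Sum-cong n (λ k k<n → eq (suc k) (s≤s k<n)))

  Sum-zero : ∀ n {f} → (∀ k → k < n → f k ≈ 0#) → Sum n f ≈ 0#
  Sum-zero zero eq = refl
  Sum-zero (suc n) eq =
    trans (+-cong (eq 0 (s≤s z≤n)) (Sum-zero n (λ k k<n → eq (suc k) (s≤s k<n)))) (+-identityʳ 0#)

  Sum-linear : ∀ n x y f g → Sum n (λ k → x * f k + y * g k) ≈ x * Sum n f + y * Sum n g
  Sum-linear zero x y f g = solve 2 (λ x y → con (+ 0) := x :* con (+ 0) :+ y :* con (+ 0)) refl x y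
  Sum-linear (suc n) x y f g =
    trans (+-congˡ (Sum-linear n x y (λ k → f (suc k)) (λ k → g (suc k))))
      (solve 6 (λ x y a b c d → (x :* a :+ y :* b) :+ (x :* c :+ y :* d) := x :* (a :+ c) :+ y :* (b :+ d))
        refl x y (f 0) (g 0) _ _)

  Sum-truncate : ∀ {r n} → r ≤ n → ∀ {f} → (∀ k → r ≤ k → k < n → f k ≈ 0#) → Sum n f ≈ Sum r f
  Sum-truncate {n = n} z≤n eq = Sum-zero n (λ k → eq k z≤n)
  Sum-truncate (s≤s r≤n) eq = +-congˡ (Sum-truncate r≤n (λ k r≤k k<n → eq (suc k) (s≤s r≤k) (s≤s k<n)))

  antidiagonal : ℕ → (ℕ → ℕ → Carrier) → Carrier
  antidiagonal zero g = g 0 0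
  antidiagonal (suc c) g = g 0 (suc c) + antidiagonal c (λ i j → g (suc i) j)

  antidiagonal-cong : ∀ c {f g} → (∀ i j → i ℕ.+ j ≡ c → f i j ≈ g i j) → antidiagonal c f ≈ antidiagonal c g
  antidiagonal-cong zero eq = eq 0 0 ≡.refl
  antidiagonal-cong (suc c) eq =
    +-cong (eq 0 (suc c) ≡.refl) (antidiagonal-cong c (λ i j i+j≡c → eq (suc i) j (≡.cong suc i+j≡c)))

  antidiagonal-zero : ∀ c {f} → (∀ i j → f i j ≈ 0#) → antidiagonal c f ≈ 0#
  antidiagonal-zero zero eq = eq 0 0
  antidiagonal-zero (suc c) eq =
    trans (+-cong (eq 0 (suc c)) (antidiagonal-zero c (λ i → eq (suc i)))) (+-identityʳ 0#)

  antidiagonal-linear : ∀ c y f g →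
    antidiagonal c (λ i j → f i j + y * g i j) ≈ antidiagonal c f + y * antidiagonal c g
  antidiagonal-linear zero y f g = refl
  antidiagonal-linear (suc c) y f g =
    trans (+-congˡ (antidiagonal-linear c y (λ i → f (suc i)) (λ i → g (suc i))))
      (solve 5 (λ y a b c d → (a :+ y :* b) :+ (c :+ y :* d) := (a :+ c) :+ y :* (b :+ d))
        refl y (f 0 (suc c)) (g 0 (suc c)) _ _)

  antidiagonal-scale : ∀ c y f → antidiagonal c (λ i j → y * f i j) ≈ y * antidiagonal c f
  antidiagonal-scale zero y f = refl
  antidiagonal-scale (suc c) y f = trans (+-congˡ (antidiagonal-scale c y (λ i → f (suc i)))) (sym (distribˡ y _ _))

  -- Removing the row i = 0 and shifting leaves one row fewer, but rows of the same length. Hence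
  -- the number r of rows and their length n are separate, with the vanishing region governed by r.
  square-by-antidiagonals : ∀ r {n} → r ≤ n → ∀ g →
    (∀ i j → i < r → j < n → r ≤ i ℕ.+ j → g i j ≈ 0#) →
    Sum r (λ i → Sum n (g i)) ≈ Sum r (λ m → antidiagonal m g)
  square-by-antidiagonals zero r≤n g vanish = refl
  square-by-antidiagonals (suc r) {n} r<n g vanish = begin
    Sum n (g 0) + Sum r (λ i → Sum n (g (suc i)))
      ≈⟨ +-cong (Sum-truncate r<n (λ k r≤k k<n → vanish 0 k (s≤s z≤n) k<n r≤k))
                (square-by-antidiagonals r (ℕ.<⇒≤ r<n) (λ i → g (suc i))
                  (λ i j i<r j<n r≤ → vanish (suc i) j (s≤s i<r) j<n (s≤s r≤))) ⟩
    (g 0 0 + Sum r (λ m → g 0 (suc m))) + Sum r (λ m → antidiagonal m (λ i → g (suc i)))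
      ≈⟨ +-assoc _ _ _ ⟩
    g 0 0 + (Sum r (λ m → g 0 (suc m)) + Sum r (λ m → antidiagonal m (λ i → g (suc i))))
      ≈⟨ +-congˡ (+-cong (*-identityˡ _) (*-identityˡ _)) ⟨
    g 0 0 + (1# * Sum r (λ m → g 0 (suc m)) + 1# * Sum r (λ m → antidiagonal m (λ i → g (suc i))))
      ≈⟨ +-congˡ (Sum-linear r 1# 1# (λ m → g 0 (suc m)) (λ m → antidiagonal m (λ i → g (suc i)))) ⟨
    g 0 0 + Sum r (λ m → 1# * g 0 (suc m) + 1# * antidiagonal m (λ i → g (suc i)))
      ≈⟨ +-congˡ (Sum-cong r (λ m _ → +-cong (*-identityˡ _) (*-identityˡ _))) ⟩
    g 0 0 + Sum r (λ m → antidiagonal (suc m) g) ∎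

  Prod : ℕ → (ℕ → Carrier) → Carrier
  Prod zero f = 1#
  Prod (suc k) f = Prod k f * f k

  Prod-first : ∀ k f → Prod (suc k) f ≈ f 0 * Prod k (λ j → f (suc j))
  Prod-first zero f = *-comm _ _
  Prod-first (suc k) f = trans (*-congʳ (Prod-first k f)) (*-assoc _ _ _)

  Prod-cong : ∀ k {f g} → (∀ j → j < k → f j ≈ g j) → Prod k f ≈ Prod k g
  Prod-cong zero eq = refl
  Prod-cong (suc k) eq = *-cong (Prod-cong k (λ j j<k → eq j (ℕ.m<n⇒m<1+n j<k))) (eq k (ℕ.n<1+n k))

  Prod-zero : ∀ k {f j} → j < k → f j ≈ 0# → Prod k f ≈ 0#
  Prod-zero (suc k) {f} {j} (s≤s j≤k) fj≈0 with ℕ.m≤n⇒m<n∨m≡n j≤k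
  ... | inj₁ j<k = trans (*-congʳ (Prod-zero k j<k fj≈0)) (zeroˡ _)
  ... | inj₂ ≡.refl = trans (*-congˡ fj≈0) (zeroʳ _)

  Prod-regular : ∀ k {f} → (∀ j → j < k → ∀ x → f j * x ≈ 0# → x ≈ 0#) → ∀ x → x * Prod k f ≈ 0# → x ≈ 0#
  Prod-regular zero regular x x1≈0 = trans (sym (*-identityʳ x)) x1≈0
  Prod-regular (suc k) {f} regular x eq =
    Prod-regular k (λ j j<k → regular j (ℕ.m<n⇒m<1+n j<k)) x
      (regular k (ℕ.n<1+n k) _ (trans (trans (*-comm _ _) (*-assoc x _ (f k))) eq))

  -- The coefficient of ε in Prod k (λ j → 1 - (1 + ε) c j), where ε² = 0.
  derivative : ℕ → (ℕ → Carrier) → Carrier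
  derivative zero c = 0#
  derivative (suc k) c = derivative k c * (1# - c k) - Prod k (λ j → 1# - c j) * c k

  -- A first-order Taylor expansion: in each step the only term outside the required form is a
  -- multiple of `ε * ε`.
  Prod-expand : ∀ {ε} → ε * ε ≈ 0# → ∀ k c →
    Prod k (λ j → 1# - (1# + ε) * c j) ≈ Prod k (λ j → 1# - c j) + ε * derivative k c
  Prod-expand {ε} ε²≈0 zero c = sym (trans (+-congˡ (zeroʳ ε)) (+-identityʳ 1#))
  Prod-expand {ε} ε²≈0 (suc k) c = begin
    Prod k (λ j → 1# - (1# + ε) * c j) * (1# - (1# + ε) * c k)
      ≈⟨ *-congʳ (Prod-expand ε²≈0 k c) ⟩
    (N + ε * D) * (1# - (1# + ε) * c k)
      ≈⟨ solve 4 (λ ε N D x → (N :+ ε :* D) :* (con (+ 1) :- (con (+ 1) :+ ε) :* x)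
           := (N :* (con (+ 1) :- x) :+ ε :* (D :* (con (+ 1) :- x) :- N :* x)) :- (ε :* ε) :* (D :* x))
           refl ε N D (c k) ⟩
    (N * (1# - c k) + ε * (D * (1# - c k) - N * c k)) - (ε * ε) * (D * c k)
      ≈⟨ +-congˡ (-‿cong (trans (*-congʳ ε²≈0) (zeroˡ _))) ⟩
    (N * (1# - c k) + ε * (D * (1# - c k) - N * c k)) - 0#
      ≈⟨ solve 1 (λ x → x :- con (+ 0) := x) refl _ ⟩
    N * (1# - c k) + ε * (D * (1# - c k) - N * c k) ∎
    where
    N D : Carrier
    N = Prod k (λ j → 1# - c j)
    D = derivative k c

  -- With y = 1 + ε and ε^2 = 0 one has y^2 = 1 + 2ε. The products at 1, y and y^2 are therefore the
  -- values N, N + εD and N + 2εD of an affine function.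
  Prod-second-difference : ∀ {y} → (y - 1#) * (y - 1#) ≈ 0# → ∀ k c →
    Prod k (λ j → 1# - c j) ≈
      (Prod k (λ j → 1# - y * c j) + Prod k (λ j → 1# - y * c j)) - Prod k (λ j → 1# - (y * y) * c j)
  Prod-second-difference {y} sq k c = begin
    N
      ≈⟨ solve 3 (λ e N D → N := ((N :+ e :* D) :+ (N :+ e :* D)) :- (N :+ (e :+ e) :* D)) refl ε N D ⟩
    ((N + ε * D) + (N + ε * D)) - (N + (ε + ε) * D)
      ≈⟨ +-cong (+-cong first first) (-‿cong second) ⟨
    _ ∎
    where
    ε N D : Carrier
    ε = y - 1#
    N = Prod k (λ j → 1# - c j)
    D = derivative k c
    first : Prod k (λ j → 1# - y * c j) ≈ N + ε * D
    first = trans (Prod-cong k (λ j _ → +-congˡ (-‿cong (*-congʳ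
              (solve 1 (λ y → y := con (+ 1) :+ (y :- con (+ 1))) refl y))))) (Prod-expand sq k c)
    y²≈1+2ε : y * y ≈ 1# + (ε + ε)
    y²≈1+2ε = begin
      y * y ≈⟨ solve 1 (λ y → y :* y := (con (+ 1) :+ ((y :- con (+ 1)) :+ (y :- con (+ 1))))
                 :+ (y :- con (+ 1)) :* (y :- con (+ 1))) refl y ⟩
      (1# + (ε + ε)) + ε * ε ≈⟨ +-congˡ sq ⟩
      (1# + (ε + ε)) + 0#    ≈⟨ +-identityʳ _ ⟩
      1# + (ε + ε) ∎
    second : Prod k (λ j → 1# - (y * y) * c j) ≈ N + (ε + ε) * D
    second = trans (Prod-cong k (λ j _ → +-congˡ (-‿cong (*-congʳ y²≈1+2ε))))
      (Prod-expand (trans (solve 1 (λ e → (e :+ e) :* (e :+ e) := con (+ 4) :* (e :* e)) refl ε)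
        (trans (*-congˡ sq) (zeroʳ _))) k c)

-- q-binomial coefficients

-- This is k(k - 1)/2, one index behind the usual triangular numbers.
triangular : ℕ → ℕ
triangular zero = 0
triangular (suc k) = triangular k ℕ.+ k

-- triangular k + 1 - k, which is (k - 1)(k - 2) / 2.
previousTriangular : ℕ → ℕ
previousTriangular zero = 1
previousTriangular (suc k) = triangular k

-- The pentagonal number m(3m - 1)/2; `pentagonal′` is its companion m(3m + 1)/2. The increments are
-- written exactly as `alternating-step` produces them.
pentagonal : ℕ → ℕ
pentagonal zero = 0
pentagonal (suc m) = suc (m ℕ.* 3) ℕ.+ pentagonal m

pentagonal′ : ℕ → ℕ
pentagonal′ zero = 0
pentagonal′ (suc m) = suc (suc (m ℕ.* 3)) ℕ.+ pentagonal′ m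

module QBinomials {c ℓ} (R : CommutativeRing c ℓ) (q : CommutativeRing.Carrier R) where
  open CommutativeRing R
  open FiniteSums R
  open IntegerSolver R
  open import Algebra.Properties.Semiring.Exp semiring
  open import Relation.Binary.Reasoning.Setoid setoid

  -- Defined by a Pascal rule, since a quotient of q-factorials has no meaning in a general
  -- commutative ring; `binom-factorials` recovers the quotient formula without dividing.
  binom : ℕ → ℕ → Carrier
  binom n zero = 1#
  binom zero (suc k) = 0#
  binom (suc n) (suc k) = binom n k + q ^ suc k * binom n (suc k)

  binom-above : ∀ {n k} → n < k → binom n k ≈ 0#
  binom-above {zero} (s≤s z≤n) = refl
  binom-above {suc n} (s≤s n<k) =
    trans (+-cong (binom-above n<k) (trans (*-congˡ (binom-above (ℕ.m<n⇒m<1+n n<k))) (zeroʳ _))) (+-identityʳ 0#)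

  times-binom-above : ∀ {n k} x → n < k → x * binom n k ≈ 0#
  times-binom-above x n<k = trans (*-congˡ (binom-above n<k)) (zeroʳ x)

  -- The dual Pascal rule, by induction on n: both coefficients on the left are expanded by the
  -- induction hypothesis and regrouped by the defining rule.
  pascal₂ : ∀ n k → binom (suc n) (suc k) ≈ binom n (suc k) + q ^ (n ∸ k) * binom n k
  pascal₂ zero zero = solve 1 (λ q → con (+ 1) :+ q :* con (+ 0) := con (+ 0) :+ con (+ 1) :* con (+ 1)) refl (q ^ 1)
  pascal₂ zero (suc k) = solve 1 (λ q → con (+ 0) :+ q :* con (+ 0) := con (+ 0) :+ con (+ 1) :* con (+ 0))
    refl (q ^ suc (suc k))
  pascal₂ (suc n) zero = begin
    1# + q ^ 1 * binom (suc n) 1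
      ≈⟨ +-congˡ (*-congˡ (pascal₂ n 0)) ⟩
    1# + q ^ 1 * (binom n 1 + q ^ n * 1#)
      ≈⟨ solve 3 (λ q x y → con (+ 1) :+ (q :* con (+ 1)) :* (x :+ y :* con (+ 1)) :=
        (con (+ 1) :+ (q :* con (+ 1)) :* x) :+ (q :* y) :* con (+ 1))
           refl q (binom n 1) (q ^ n) ⟩
    (1# + q ^ 1 * binom n 1) + q ^ suc n * 1# ∎
  pascal₂ (suc n) (suc k) = begin
    binom (suc n) (suc k) + q * q ^ suc k * binom (suc n) (suc (suc k))
      ≈⟨ +-cong (pascal₂ n k) (*-congˡ (pascal₂ n (suc k))) ⟩
    (b₁ + q ^ (n ∸ k) * b₀) + q * q ^ suc k * (b₂ + q ^ (n ∸ suc k) * b₁)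
      ≈⟨ solve 7 (λ b₀ b₁ b₂ q x y z → (b₁ :+ x :* b₀) :+ q :* y :* (b₂ :+ z :* b₁) := (b₁ :+ q :* y :* b₂) :+
        (x :* b₀ :+ (q :* y) :* z :* b₁))
           refl b₀ b₁ b₂ q (q ^ (n ∸ k)) (q ^ suc k) (q ^ (n ∸ suc k)) ⟩
    (b₁ + q * q ^ suc k * b₂) + (q ^ (n ∸ k) * b₀ + q ^ suc (suc k) * q ^ (n ∸ suc k) * b₁)
      ≈⟨ +-congˡ (+-congˡ exchange) ⟩
    (b₁ + q * q ^ suc k * b₂) + (q ^ (n ∸ k) * b₀ + q ^ (n ∸ k) * q ^ suc k * b₁)
      ≈⟨ solve 6 (λ b₀ b₁ b₂ q x y → (b₁ :+ q :* y :* b₂) :+ (x :* b₀ :+ x :* y :* b₁) := (b₁ :+ q :* y :* b₂)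
        :+ x :* (b₀ :+ y :* b₁))
           refl b₀ b₁ b₂ q (q ^ (n ∸ k)) (q ^ suc k) ⟩
    (b₁ + q * q ^ suc k * b₂) + q ^ (n ∸ k) * (b₀ + q ^ suc k * b₁) ∎
    where
    b₀ b₁ b₂ : Carrier
    b₀ = binom n k
    b₁ = binom n (suc k)
    b₂ = binom n (suc (suc k))
    -- Both exponents are n + 1 when k < n. Otherwise the subtraction truncates, but then `b₁` is
    -- zero.
    exchange : q ^ suc (suc k) * q ^ (n ∸ suc k) * b₁ ≈ q ^ (n ∸ k) * q ^ suc k * b₁
    exchange with k ℕ.<? n
    ... | no k≮n = trans (times-binom-above _ (s≤s (ℕ.≮⇒≥ k≮n))) (sym (times-binom-above _ (s≤s (ℕ.≮⇒≥ k≮n))))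
    ... | yes k<n = *-congʳ (begin
      q ^ suc (suc k) * q ^ (n ∸ suc k)   ≈⟨ ^-homo-* q (suc (suc k)) (n ∸ suc k) ⟨
      q ^ (suc (suc k) ℕ.+ (n ∸ suc k))   ≈⟨ ^-≡ q (≡.cong suc (≡.trans (ℕ.m+[n∸m]≡n k<n)
                                               (≡.sym (ℕ.m∸n+n≡m (ℕ.<⇒≤ k<n))))) ⟩
      q ^ suc (n ∸ k ℕ.+ k)               ≈⟨ ^-≡ q (ℕ.+-suc (n ∸ k) k) ⟨
      q ^ (n ∸ k ℕ.+ suc k)               ≈⟨ ^-homo-* q (n ∸ k) (suc k) ⟩
      q ^ (n ∸ k) * q ^ suc k             ∎)

  -- Symmetry interchanges the two Pascal rules: the defining rule on the left becomes `pascal₂` on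
  -- the right.
  binom-symmetric : ∀ m k → binom (m ℕ.+ k) k ≈ binom (m ℕ.+ k) m
  binom-symmetric zero zero = refl
  binom-symmetric zero (suc k) = trans (+-cong (binom-symmetric 0 k) (times-binom-above _ (ℕ.n<1+n k)))
    (+-identityʳ 1#)
  binom-symmetric (suc m) zero = sym (begin
    binom (m ℕ.+ 0) m + q ^ suc m * binom (m ℕ.+ 0) (suc m)
      ≈⟨ +-cong (sym (binom-symmetric m 0)) (times-binom-above _ (s≤s (ℕ.≤-reflexive (ℕ.+-identityʳ m)))) ⟩
    1# + 0#  ≈⟨ +-identityʳ 1# ⟩
    1# ∎)
  binom-symmetric (suc m) (suc k) = begin
    binom (m ℕ.+ suc k) k + q ^ suc k * binom (m ℕ.+ suc k) (suc k)
      ≈⟨ +-cong (trans (reflexive (≡.cong (λ n → binom n k) (ℕ.+-suc m k)))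
                  (trans (binom-symmetric (suc m) k) (reflexive
                    (≡.cong (λ n → binom n (suc m)) (≡.sym (ℕ.+-suc m k))))))
                (*-cong (^-≡ q (≡.sym (ℕ.m+n∸m≡n m (suc k)))) (binom-symmetric m (suc k))) ⟩
    binom (m ℕ.+ suc k) (suc m) + q ^ (m ℕ.+ suc k ∸ m) * binom (m ℕ.+ suc k) m
      ≈⟨ pascal₂ (m ℕ.+ suc k) m ⟨
    binom (suc m ℕ.+ suc k) (suc m) ∎

  poch : ℕ → Carrier
  poch m = Prod m (λ j → 1# - q ^ suc j)

  falling : ℕ → ℕ → Carrier
  falling n k = Prod k (λ j → 1# - q ^ (n ∸ j))

  -- No bound on k is required: for k > n the coefficient vanishes, and so does the product, whose
  -- factor at j = n is 1 - q^0.
  binom-poch : ∀ n k → binom n k * poch k ≈ falling n k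
  binom-poch n zero = *-identityʳ 1#
  binom-poch zero (suc k) = sym (begin
    falling 0 k * (1# - q ^ (0 ∸ k))  ≈⟨ Prod-zero (suc k) {λ j → 1# - q ^ (0 ∸ j)} (s≤s z≤n) (-‿inverseʳ 1#) ⟩
    0#                                ≈⟨ zeroˡ _ ⟨
    0# * poch (suc k) ∎)
  binom-poch (suc n) (suc k) = begin
    (binom n k + x * binom n (suc k)) * (poch k * (1# - x))
      ≈⟨ solve 4 (λ a b x p → (a :+ x :* b) :* (p :* (con (+ 1) :- x)) := (con (+ 1) :- x) :* (a :* p) :+ x :*
        (b :* (p :* (con (+ 1) :- x))))
           refl (binom n k) (binom n (suc k)) x (poch k) ⟩
    (1# - x) * (binom n k * poch k) + x * (binom n (suc k) * poch (suc k))
      ≈⟨ +-cong (*-congˡ (binom-poch n k)) (*-congˡ (binom-poch n (suc k))) ⟩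
    (1# - x) * falling n k + x * (falling n k * (1# - q ^ (n ∸ k)))
      ≈⟨ solve 3 (λ x f y → (con (+ 1) :- x) :* f :+ x :* (f :* (con (+ 1) :- y)) := f :- (x :* y) :* f) refl x
        (falling n k) (q ^ (n ∸ k)) ⟩
    falling n k - (x * q ^ (n ∸ k)) * falling n k
      ≈⟨ +-congˡ (-‿cong exchange) ⟩
    falling n k - q ^ suc n * falling n k
      ≈⟨ solve 2 (λ f y → f :- y :* f := (con (+ 1) :- y) :* f) refl (falling n k) (q ^ suc n) ⟩
    (1# - q ^ suc n) * falling n k
      ≈⟨ Prod-first k (λ j → 1# - q ^ (suc n ∸ j)) ⟨
    falling (suc n) (suc k) ∎
    where
    x : Carrier
    x = q ^ suc k
    exchange : (x * q ^ (n ∸ k)) * falling n k ≈ q ^ suc n * falling n k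
    exchange with k ℕ.≤? n
    ... | yes k≤n = *-congʳ (trans (sym (^-homo-* q (suc k) (n ∸ k))) (^-≡ q (≡.cong suc (ℕ.m+[n∸m]≡n k≤n))))
    ... | no k≰n = trans (trans (*-congˡ vanish) (zeroʳ _)) (sym (trans (*-congˡ vanish) (zeroʳ _)))
      where
      vanish : falling n k ≈ 0#
      vanish = Prod-zero k (ℕ.≰⇒> k≰n) (trans (+-congˡ (-‿cong (^-≡ q (ℕ.n∸n≡0 n)))) (-‿inverseʳ 1#))

  falling-ascending : ∀ m k → falling (m ℕ.+ k) k ≈ Prod k (λ j → 1# - q ^ (m ℕ.+ suc j))
  falling-ascending m zero = refl
  falling-ascending m (suc k) = begin
    falling (m ℕ.+ suc k) (suc k)
      ≈⟨ Prod-first k (λ j → 1# - q ^ (m ℕ.+ suc k ∸ j)) ⟩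
    (1# - q ^ (m ℕ.+ suc k)) * Prod k (λ j → 1# - q ^ (m ℕ.+ suc k ∸ suc j))
      ≈⟨ *-congˡ (Prod-cong k (λ j _ → reflexive (≡.cong (λ n → 1# - q ^ (n ∸ suc j)) (ℕ.+-suc m k)))) ⟩
    (1# - q ^ (m ℕ.+ suc k)) * falling (m ℕ.+ k) k
      ≈⟨ *-congˡ (falling-ascending m k) ⟩
    (1# - q ^ (m ℕ.+ suc k)) * Prod k (λ j → 1# - q ^ (m ℕ.+ suc j))
      ≈⟨ *-comm _ _ ⟩
    Prod (suc k) (λ j → 1# - q ^ (m ℕ.+ suc j)) ∎

  binom-poch-ascending : ∀ m k → binom (m ℕ.+ k) k * poch k ≈ Prod k (λ j → 1# - q ^ (m ℕ.+ suc j))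
  binom-poch-ascending m k = trans (binom-poch (m ℕ.+ k) k) (falling-ascending m k)

  poch-+ : ∀ m k → poch m * Prod k (λ j → 1# - q ^ (m ℕ.+ suc j)) ≈ poch (m ℕ.+ k)
  poch-+ m zero = trans (*-identityʳ _) (reflexive (≡.cong poch (≡.sym (ℕ.+-identityʳ m))))
  poch-+ m (suc k) = begin
    poch m * (Prod k (λ j → 1# - q ^ (m ℕ.+ suc j)) * (1# - q ^ (m ℕ.+ suc k)))
      ≈⟨ *-assoc _ _ _ ⟨
    (poch m * Prod k (λ j → 1# - q ^ (m ℕ.+ suc j))) * (1# - q ^ (m ℕ.+ suc k))
      ≈⟨ *-cong (poch-+ m k) (+-congˡ (-‿cong (^-≡ q (ℕ.+-suc m k)))) ⟩
    poch (m ℕ.+ k) * (1# - q ^ suc (m ℕ.+ k))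
      ≈⟨ reflexive (≡.cong poch (≡.sym (ℕ.+-suc m k))) ⟩
    poch (m ℕ.+ suc k) ∎

  binom-factorials : ∀ m k → (poch m * poch k) * binom (m ℕ.+ k) m ≈ poch (m ℕ.+ k)
  binom-factorials m k = begin
    (poch m * poch k) * binom (m ℕ.+ k) m   ≈⟨ *-congˡ (binom-symmetric m k) ⟨
    (poch m * poch k) * binom (m ℕ.+ k) k   ≈⟨ solve 3 (λ x y z → (x :* y) :* z := x :* (z :* y)) refl _ _ _ ⟩
    poch m * (binom (m ℕ.+ k) k * poch k)   ≈⟨ *-congˡ (binom-poch-ascending m k) ⟩
    poch m * _                              ≈⟨ poch-+ m k ⟩
    poch (m ℕ.+ k) ∎

  -- Induction on a. The Pascal rule for the coefficient of `suc a` splits the sum for `suc c` into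
  -- the sums for c and for `suc c` over a, the latter with the factor q^(c+1); the same rule for a
  -- + b + 1 puts the two values together.
  vandermonde : ∀ a b c → antidiagonal c (λ i j → q ^ ((a ∸ i) ℕ.* j) * (binom a i * binom b j)) ≈ binom (a ℕ.+ b) c
  vandermonde a b zero = trans (*-congʳ (^-≡ q (ℕ.*-zeroʳ a)))
    (solve 0 (con (+ 1) :* (con (+ 1) :* con (+ 1)) := con (+ 1)) refl)
  vandermonde zero b (suc c) = begin
    1# * (1# * binom b (suc c)) + antidiagonal c (λ i j → q ^ ((0 ∸ suc i) ℕ.* j) * (0# * binom b j))
      ≈⟨ +-congˡ (antidiagonal-zero c (λ i j → trans (*-congˡ (zeroˡ _)) (zeroʳ _))) ⟩
    1# * (1# * binom b (suc c)) + 0#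
      ≈⟨ solve 1 (λ x → con (+ 1) :* (con (+ 1) :* x) :+ con (+ 0) := x) refl (binom b (suc c)) ⟩
    binom b (suc c) ∎
  vandermonde (suc a) b (suc c) = begin
    q ^ (suc a ℕ.* suc c) * (1# * y) + antidiagonal c
      (λ i j → q ^ ((a ∸ i) ℕ.* j) * ((binom a i + q ^ suc i * binom a (suc i)) * binom b j))
      ≈⟨ +-cong (*-congʳ (^-homo-* q (suc c) (a ℕ.* suc c))) (antidiagonal-cong c split) ⟩
    (q ^ suc c * z) * (1# * y) + antidiagonal c (λ i j → f i j + q ^ suc c * g (suc i) j)
      ≈⟨ +-congˡ (antidiagonal-linear c (q ^ suc c) f (λ i → g (suc i))) ⟩
    (q ^ suc c * z) * (1# * y) + (antidiagonal c f + q ^ suc c * antidiagonal c (λ i → g (suc i)))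
      ≈⟨ solve 5 (λ x z y u v → (x :* z) :* (con (+ 1) :* y) :+ (u :+ x :* v) := u :+ x :*
        (z :* (con (+ 1) :* y) :+ v)) refl (q ^ suc c) z y _ _ ⟩
    antidiagonal c f + q ^ suc c * antidiagonal (suc c) g
      ≈⟨ +-cong (vandermonde a b c) (*-congˡ (vandermonde a b (suc c))) ⟩
    binom (suc a ℕ.+ b) (suc c) ∎
    where
    f g : ℕ → ℕ → Carrier
    f i j = q ^ ((a ∸ i) ℕ.* j) * (binom a i * binom b j)
    g i j = q ^ ((a ∸ i) ℕ.* j) * (binom a i * binom b j)
    y z : Carrier
    y = binom b (suc c)
    z = q ^ (a ℕ.* suc c)
    split : ∀ i j → i ℕ.+ j ≡ c →
      q ^ ((a ∸ i) ℕ.* j) * ((binom a i + q ^ suc i * binom a (suc i)) * binom b j) ≈ f i j + q ^ suc c * g (suc i) j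
    split i j ≡.refl = begin
      u * ((binom a i + q ^ suc i * binom a (suc i)) * binom b j)
        ≈⟨ solve 5 (λ u v x y z → u :* ((x :+ v :* y) :* z) := u :* (x :* z) :+ (u :* v) :* y :* z) refl u
          (q ^ suc i) (binom a i) (binom a (suc i)) (binom b j) ⟩
      f i j + (u * q ^ suc i) * binom a (suc i) * binom b j
        ≈⟨ +-congˡ (*-congʳ exchange) ⟩
      f i j + (q ^ suc (i ℕ.+ j) * q ^ ((a ∸ suc i) ℕ.* j)) * binom a (suc i) * binom b j
        ≈⟨ +-congˡ (solve 4 (λ x y z w → (x :* y) :* z :* w := x :* (y :* (z :* w))) refl _ _ _ _) ⟩
      f i j + q ^ suc (i ℕ.+ j) * g (suc i) j ∎
      where
      u : Carrier
      u = q ^ ((a ∸ i) ℕ.* j)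
      arithmetic : ∀ x i j → suc x ℕ.* j ℕ.+ suc i ≡ suc (i ℕ.+ j) ℕ.+ x ℕ.* j
      arithmetic = solve-∀
      exchange : (u * q ^ suc i) * binom a (suc i) ≈ (q ^ suc (i ℕ.+ j) * q ^ ((a ∸ suc i) ℕ.* j)) * binom a (suc i)
      exchange with i ℕ.<? a
      ... | no i≮a = trans (times-binom-above _ (s≤s (ℕ.≮⇒≥ i≮a))) (sym (times-binom-above _ (s≤s (ℕ.≮⇒≥ i≮a))))
      ... | yes i<a = *-congʳ (begin
        u * q ^ suc i                                 ≈⟨ ^-homo-* q ((a ∸ i) ℕ.* j) (suc i) ⟨
        q ^ ((a ∸ i) ℕ.* j ℕ.+ suc i)                 ≡⟨ ≡.cong (λ x → q ^ (x ℕ.* j ℕ.+ suc i)) (ℕ.+-∸-assoc 1 i<a) ⟩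
        q ^ (suc (a ∸ suc i) ℕ.* j ℕ.+ suc i)         ≈⟨ ^-≡ q (arithmetic (a ∸ suc i) i j) ⟩
        q ^ (suc (i ℕ.+ j) ℕ.+ (a ∸ suc i) ℕ.* j)     ≈⟨ ^-homo-* q (suc (i ℕ.+ j)) ((a ∸ suc i) ℕ.* j) ⟩
        q ^ suc (i ℕ.+ j) * q ^ ((a ∸ suc i) ℕ.* j)   ∎)

  -- The case a = b = c = m: on the antidiagonal m - i = j, so the exponent becomes j^2, and
  -- symmetry turns the product into a square.
  central-vandermonde : ∀ m → antidiagonal m (λ i j → q ^ (j ℕ.* j) * (binom (i ℕ.+ j) i * binom (i ℕ.+ j) i))
    ≈ binom (m ℕ.+ m) m
  central-vandermonde m = trans (antidiagonal-cong m pointwise) (vandermonde m m m)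
    where
    pointwise : ∀ i j → i ℕ.+ j ≡ m →
      q ^ (j ℕ.* j) * (binom (i ℕ.+ j) i * binom (i ℕ.+ j) i) ≈ q ^ ((m ∸ i) ℕ.* j) * (binom m i * binom m j)
    pointwise i j ≡.refl =
      *-cong (^-≡ q (≡.cong (ℕ._* j) (≡.sym (ℕ.m+n∸m≡n i j)))) (*-congˡ (sym (binom-symmetric i j)))

-- The alternating sums of Ekhad and Zeilberger

module AlternatingSums {c ℓ} (R : CommutativeRing c ℓ) (q : CommutativeRing.Carrier R) where
  open CommutativeRing R
  open FiniteSums R
  open QBinomials R q
  open IntegerSolver R
  open import Algebra.Properties.Semiring.Exp semiring
  open import Relation.Binary.Reasoning.Setoid setoid

  sign : ℕ → Carrier
  sign k = (- 1#) ^ k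

  sign² : ∀ k → sign k * sign k ≈ 1#
  sign² zero = *-identityˡ 1#
  sign² (suc k) = trans (solve 1 (λ s → (:- con (+ 1) :* s) :* (:- con (+ 1) :* s) := s :* s) refl (sign k)) (sign² k)

  term : ℕ → ℕ → Carrier
  term L k = (sign k * q ^ triangular k) * binom (L ∸ k) k

  -- A companion of `term`: `recurrence` leads from `term` to it and `recurrence′` leads back, so
  -- that it can be eliminated in `invariant`.
  term′ : ℕ → ℕ → Carrier
  term′ L k = (sign k * q ^ previousTriangular k) * binom (L ∸ k) k

  alternating : ℕ → Carrier
  alternating L = Sum (suc L) (term L)

  beyond : ∀ {L k} → L < k → L ∸ k < k
  beyond {L} {k} L<k = ℕ.≤-<-trans (ℕ.m∸n≤m L k) L<k

  -- A term with L < 2k vanishes because L - k < k. This stops the sum of index 2K - 1 at k < K,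
  -- which is the range of the central coefficients.
  alternating-truncate : ∀ K {L} → K ≤ suc L → L < K ℕ.+ K → alternating L ≈ Sum K (term L)
  alternating-truncate K {L} K≤1+L L<2K = Sum-truncate K≤1+L (λ k K≤k _ →
    times-binom-above _ (ℕ.+-cancelʳ-< k (L ∸ k) k (vanish k K≤k)))
    where
    vanish : ∀ k → K ≤ k → L ∸ k ℕ.+ k < k ℕ.+ k
    vanish k K≤k with k ℕ.≤? L
    ... | yes k≤L = ≡.subst (_< k ℕ.+ k) (≡.sym (ℕ.m∸n+n≡m k≤L)) (ℕ.<-≤-trans L<2K (ℕ.+-mono-≤ K≤k K≤k))
    ... | no k≰L = ℕ.+-monoˡ-< k (beyond (ℕ.≰⇒> k≰L))

  alternating-extend : ∀ K {L} → suc L ≤ K → Sum K (term L) ≈ alternating L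
  alternating-extend K L<K = Sum-truncate L<K (λ k L<k _ → times-binom-above _ (beyond L<k))

  Sum-from-zero : ∀ K x y f g h → f 0 ≈ x * g 0 → (∀ k → f (suc k) ≈ x * g (suc k) + y * h k) →
    Sum (suc K) f ≈ x * Sum (suc K) g + y * Sum K h
  Sum-from-zero K x y f g h first rest = begin
    f 0 + Sum K (λ k → f (suc k))
      ≈⟨ +-cong first (trans (Sum-cong K (λ k _ → rest k)) (Sum-linear K x y (λ k → g (suc k)) h)) ⟩
    x * g 0 + (x * Sum K (λ k → g (suc k)) + y * Sum K h)
      ≈⟨ solve 5 (λ x y a b d → x :* a :+ (x :* b :+ y :* d) := x :* (a :+ b) :+ y :* d) refl x y (g 0) _ _ ⟩
    x * Sum (suc K) g + y * Sum K h ∎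

  -- The dual Pascal rule, term by term. Its extra power of q combines with the triangular exponent,
  -- because k(k - 1)/2 + k + (L + 1 - 2k) = L + (k - 1)(k - 2)/2.
  recurrence : ∀ K L → Sum (suc K) (term (3 ℕ.+ L)) ≈ 1# * Sum (suc K) (term (2 ℕ.+ L)) + - (q ^ L) * Sum K
    (term′ (1 ℕ.+ L))
  recurrence K L = Sum-from-zero K 1# (- (q ^ L)) (term (3 ℕ.+ L)) (term (2 ℕ.+ L)) (term′ (1 ℕ.+ L))
    (sym (*-identityˡ _)) rest
    where
    exponents : ∀ k → k ≤ suc L ∸ k → triangular k ℕ.+ k ℕ.+ (suc L ∸ k ∸ k) ≡ L ℕ.+ previousTriangular k
    exponents zero _ = ≡.sym (ℕ.+-comm L 1)
    exponents (suc k) k≤ = ≡.trans (arithmetic (triangular k) k x) (≡.cong (ℕ._+ triangular k) (≡.sym L≡))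
      where
      x = L ∸ k ∸ suc k
      L≡ : L ≡ x ℕ.+ suc k ℕ.+ k
      L≡ = ≡.sym (≡.trans (≡.cong (ℕ._+ k) (ℕ.m∸n+n≡m k≤))
        (ℕ.m∸n+n≡m {L} {k} (ℕ.<⇒≤ (ℕ.m∸n≢0⇒n<m λ eq → ℕ.n≮0 (≡.subst (suc k ≤_) eq k≤)))))
      arithmetic : ∀ t k x → t ℕ.+ k ℕ.+ suc k ℕ.+ x ≡ x ℕ.+ suc k ℕ.+ k ℕ.+ t
      arithmetic = solve-∀
    rest : ∀ k → term (3 ℕ.+ L) (suc k) ≈ 1# * term (2 ℕ.+ L) (suc k) + - (q ^ L) * term′ (1 ℕ.+ L) k
    rest k with k ℕ.≤? suc L
    ... | no k≰ = trans (times-binom-above _ (ℕ.≤-<-trans (ℕ.≤-reflexive (ℕ.m≤n⇒m∸n≡0 (ℕ.≰⇒> k≰))) (s≤s z≤n)))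
      (sym (trans (+-cong (trans (*-identityˡ _)
        (times-binom-above _ (ℕ.≤-<-trans (ℕ.m∸n≤m (suc L) k) (ℕ.m<n⇒m<1+n (ℕ.≰⇒> k≰)))))
                   (trans (*-congˡ (times-binom-above _ (beyond (ℕ.≰⇒> k≰)))) (zeroʳ _))) (+-identityʳ 0#)))
    ... | yes k≤ = begin
      (sign (suc k) * q ^ (triangular k ℕ.+ k)) * binom (2 ℕ.+ L ∸ k) (suc k)
        ≡⟨ ≡.cong (λ n → (sign (suc k) * q ^ (triangular k ℕ.+ k)) * binom n (suc k)) (ℕ.+-∸-assoc 1 k≤) ⟩
      (sign (suc k) * t) * binom (suc n) (suc k)
        ≈⟨ *-congˡ (pascal₂ n k) ⟩
      (sign (suc k) * t) * (binom n (suc k) + q ^ (n ∸ k) * binom n k)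
        ≈⟨ solve 5 (λ s t b₁ y b₀ → (:- con (+ 1) :* s) :* t :* (b₁ :+ y :* b₀) := con (+ 1) :*
          ((:- con (+ 1) :* s) :* t :* b₁) :+ :- (s :* ((t :* y) :* b₀)))
             refl (sign k) t (binom n (suc k)) (q ^ (n ∸ k)) (binom n k) ⟩
      1# * term (2 ℕ.+ L) (suc k) + - (sign k * ((t * q ^ (n ∸ k)) * binom n k))
        ≈⟨ +-congˡ (-‿cong (*-congˡ exchange)) ⟩
      1# * term (2 ℕ.+ L) (suc k) + - (sign k * ((q ^ L * q ^ previousTriangular k) * binom n k))
        ≈⟨ +-congˡ (solve 4 (λ s x y b → :- (s :* ((x :* y) :* b)) := (:- x) :* ((s :* y) :* b)) refl (sign k)
          (q ^ L) (q ^ previousTriangular k) (binom n k)) ⟩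
      1# * term (2 ℕ.+ L) (suc k) + - (q ^ L) * term′ (1 ℕ.+ L) k ∎
      where
      n = suc L ∸ k
      t = q ^ (triangular k ℕ.+ k)
      exchange : (t * q ^ (n ∸ k)) * binom n k ≈ (q ^ L * q ^ previousTriangular k) * binom n k
      exchange with k ℕ.≤? n
      ... | no k≰n = trans (times-binom-above _ (ℕ.≰⇒> k≰n)) (sym (times-binom-above _ (ℕ.≰⇒> k≰n)))
      ... | yes k≤n = *-congʳ (begin
        t * q ^ (n ∸ k)                         ≈⟨ ^-homo-* q (triangular k ℕ.+ k) (n ∸ k) ⟨
        q ^ (triangular k ℕ.+ k ℕ.+ (n ∸ k))    ≈⟨ ^-≡ q (exponents k k≤n) ⟩
        q ^ (L ℕ.+ previousTriangular k)        ≈⟨ ^-homo-* q L (previousTriangular k) ⟩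
        q ^ L * q ^ previousTriangular k        ∎)

  -- Here the defining Pascal rule is used instead of the dual one. The value
  -- `previousTriangular 0 = 1` supplies the factor q of the term k = 0.
  recurrence′ : ∀ K L → Sum (suc K) (term′ (2 ℕ.+ L)) ≈ q * Sum (suc K) (term (1 ℕ.+ L)) + - 1# * Sum K (term L)
  recurrence′ K L = Sum-from-zero K q (- 1#) (term′ (2 ℕ.+ L)) (term (1 ℕ.+ L)) (term L)
    (solve 1 (λ q → (con (+ 1) :* (q :* con (+ 1))) :* con (+ 1) := q :*
    ((con (+ 1) :* con (+ 1)) :* con (+ 1))) refl q) rest
    where
    rest : ∀ k → term′ (2 ℕ.+ L) (suc k) ≈ q * term (1 ℕ.+ L) (suc k) + - 1# * term L k
    rest k with k ℕ.≤? L
    ... | no k≰ = trans (times-binom-above _ (ℕ.≤-<-trans (ℕ.≤-reflexive (ℕ.m≤n⇒m∸n≡0 (ℕ.≰⇒> k≰))) (s≤s z≤n)))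
      (sym (trans (+-cong (trans (*-congˡ (times-binom-above _
        (ℕ.≤-<-trans (ℕ.m∸n≤m L k) (ℕ.m<n⇒m<1+n (ℕ.≰⇒> k≰))))) (zeroʳ _))
                   (trans (*-congˡ (times-binom-above _ (beyond (ℕ.≰⇒> k≰)))) (zeroʳ _))) (+-identityʳ 0#)))
    ... | yes k≤ = begin
      (sign (suc k) * q ^ triangular k) * binom (1 ℕ.+ L ∸ k) (suc k)
        ≡⟨ ≡.cong (λ n → (sign (suc k) * q ^ triangular k) * binom n (suc k)) (ℕ.+-∸-assoc 1 k≤) ⟩
      (sign (suc k) * t) * (binom n k + q * y * binom n (suc k))
        ≈⟨ solve 6 (λ s t b₁ q y b₀ → (:- con (+ 1) :* s) :* t :* (b₀ :+ q :* y :* b₁) := q :*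
          ((:- con (+ 1) :* s) :* (t :* y) :* b₁) :+ :- con (+ 1) :* (s :* t :* b₀))
             refl (sign k) t (binom n (suc k)) q y (binom n k) ⟩
      q * ((sign (suc k) * (t * y)) * binom n (suc k)) + - 1# * term L k
        ≈⟨ +-congʳ (*-congˡ (*-congʳ (*-congˡ (^-homo-* q (triangular k) k)))) ⟨
      q * term (1 ℕ.+ L) (suc k) + - 1# * term L k ∎
      where
      n = L ∸ k
      t = q ^ triangular k
      y = q ^ k

  -- Eliminating the sums of `term′` gives s(L+4) = s(L+3) - q^(L+1) (q s(L+1) - s(L)). Rearranged,
  -- it says that s(L+3) + q^(L+1) s(L) is the same for L and L + 1, so one value decides all.
  invariant : ∀ L → alternating (4 ℕ.+ L) + q ^ (2 ℕ.+ L) * alternating (1 ℕ.+ L) ≈ alternating (3 ℕ.+ L) + q ^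
    (1 ℕ.+ L) * alternating L
  invariant L = begin
    alternating (4 ℕ.+ L) + q * x * alternating (1 ℕ.+ L)
      ≈⟨ +-cong (trans (sym (alternating-extend (2 ℕ.+ K) (s≤s (s≤s (s≤s (s≤s (s≤s (ℕ.m≤n+m L 2))))))))
                  (trans (recurrence (suc K) (1 ℕ.+ L)) (+-cong
                    (*-congˡ (alternating-extend (2 ℕ.+ K) (s≤s (s≤s (s≤s (s≤s (ℕ.m≤n+m L 3)))))))
                    (*-congˡ (trans (recurrence′ K L) (+-cong
                      (*-congˡ (alternating-extend (suc K) (s≤s (s≤s (ℕ.m≤n+m L 4)))))
                      (*-congˡ (alternating-extend K (s≤s (ℕ.m≤n+m L 4))))))))))
                refl ⟩
    (1# * alternating (3 ℕ.+ L) + - x * (q * alternating (1 ℕ.+ L) + - 1# * alternating L)) + q * x *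
      alternating (1 ℕ.+ L)
      ≈⟨ solve 5 (λ a b d x q → (con (+ 1) :* a :+ (:- x) :* (q :* b :+ :- con (+ 1) :* d)) :+ q :* x :* b := a
        :+ x :* d) refl
           (alternating (3 ℕ.+ L)) (alternating (1 ℕ.+ L)) (alternating L) x q ⟩
    alternating (3 ℕ.+ L) + x * alternating L ∎
    where
    -- Each recurrence lowers one summation bound by one; starting this high, every sum still
    -- contains all of its nonzero terms.
    K = 5 ℕ.+ L
    x = q ^ (1 ℕ.+ L)

  invariant-vanishes : ∀ L → alternating (3 ℕ.+ L) + q ^ (1 ℕ.+ L) * alternating L ≈ 0#
  -- The value s(3) + q s(0) is (1 - (1 + q)) + q, spelled out as the recursion of `binom` computes
  -- it.
  invariant-vanishes zero = solve 1 (λ q →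
    let o = con (+ 0) ; i = con (+ 1) ; m = :- i ; e = q :* i
        b10 = o ; b11 = i :+ e :* o ; b21 = i :+ e :* b11 ; b12 = o :+ (q :* (q :* i)) :* o in
    ((i :* i) :* i :+ (((m :* i) :* i) :* b21 :+ (((m :* (m :* i)) :* e) :* b12
      :+ (((m :* (m :* (m :* i))) :* (q :* (q :* e))) :* o :+ o)))) :+ e :* ((i :* i) :* i :+ o) := o) refl q
  invariant-vanishes (suc L) = trans (invariant L) (invariant-vanishes L)

  step : ∀ L → alternating (3 ℕ.+ L) ≈ - 1# * (q ^ (1 ℕ.+ L) * alternating L)
  step L = begin
    alternating (3 ℕ.+ L)
      ≈⟨ solve 2 (λ a b → a := (a :+ b) :+ :- con (+ 1) :* b) refl _ (q ^ (1 ℕ.+ L) * alternating L) ⟩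
    (alternating (3 ℕ.+ L) + q ^ (1 ℕ.+ L) * alternating L) + - 1# * (q ^ (1 ℕ.+ L) * alternating L)
      ≈⟨ +-congʳ (invariant-vanishes L) ⟩
    0# + - 1# * (q ^ (1 ℕ.+ L) * alternating L)
      ≈⟨ +-identityˡ _ ⟩
    - 1# * (q ^ (1 ℕ.+ L) * alternating L) ∎

  alternating-step : ∀ L m e → alternating L ≈ sign m * q ^ e → alternating (3 ℕ.+ L) ≈ sign (suc m) * q ^
    (suc L ℕ.+ e)
  alternating-step L m e eq = begin
    alternating (3 ℕ.+ L)                       ≈⟨ step L ⟩
    - 1# * (q ^ (1 ℕ.+ L) * alternating L)      ≈⟨ *-congˡ (*-congˡ eq) ⟩
    - 1# * (q ^ (1 ℕ.+ L) * (sign m * q ^ e))  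
      ≈⟨ solve 3 (λ x s y → :- con (+ 1) :* (x :* (s :* y)) := (:- con (+ 1) :* s) :* (x :* y)) refl _ (sign m)
      (q ^ e) ⟩
    sign (suc m) * (q ^ (1 ℕ.+ L) * q ^ e)      ≈⟨ *-congˡ (^-homo-* q (suc L) e) ⟨
    sign (suc m) * q ^ (suc L ℕ.+ e)            ∎

  alternating-0 : ∀ m → alternating (m ℕ.* 3) ≈ sign m * q ^ pentagonal m
  alternating-0 zero = solve 0 ((con (+ 1) :* con (+ 1)) :* con (+ 1) :+ con (+ 0) := con (+ 1) :* con (+ 1)) refl
  alternating-0 (suc m) = alternating-step (m ℕ.* 3) m (pentagonal m) (alternating-0 m)

  alternating-1 : ∀ m → alternating (1 ℕ.+ m ℕ.* 3) ≈ sign m * q ^ pentagonal′ m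
  alternating-1 zero = solve 1 (λ x → (con (+ 1) :* con (+ 1)) :* con (+ 1) :+
    (((:- con (+ 1) :* con (+ 1)) :* con (+ 1)) :* con (+ 0) :+ con (+ 0)) := con (+ 1) :* con (+ 1)) refl q
  alternating-1 (suc m) = alternating-step (1 ℕ.+ m ℕ.* 3) m (pentagonal′ m) (alternating-1 m)

  alternating-2 : ∀ m → alternating (2 ℕ.+ m ℕ.* 3) ≈ 0#
  alternating-2 zero = solve 1 (λ q → let o = con (+ 0) ; i = con (+ 1) ; m = :- i ; e = q :* i in
    (i :* i) :* i :+ (((m :* i) :* i) :* (i :+ e :* o) :+ (((m :* (m :* i)) :* e) :* o :+ o)) := o) refl q
  alternating-2 (suc m) = trans (step (2 ℕ.+ m ℕ.* 3))
    (trans (*-congˡ (trans (*-congˡ (alternating-2 m)) (zeroʳ _))) (zeroʳ _))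

-- Central q-binomial coefficients modulo a square

module InverseBases {c ℓ} (R : CommutativeRing c ℓ) (p q : CommutativeRing.Carrier R)
    (pq≈1 : CommutativeRing._≈_ R (CommutativeRing._*_ R p q) (CommutativeRing.1# R)) where
  open CommutativeRing R
  open FiniteSums R
  open IntegerSolver R
  module P = QBinomials R p
  module Q = QBinomials R q
  open AlternatingSums R p
  open import Algebra.Properties.Semiring.Exp semiring
  open import Algebra.Properties.CommutativeSemiring.Exp commutativeSemiring using (^-distrib-*)
  open import Relation.Binary.Reasoning.Setoid setoid

  p^n*q^n≈1 : ∀ n → p ^ n * q ^ n ≈ 1#
  p^n*q^n≈1 n = trans (sym (^-distrib-* p q n)) (trans (^-congˡ n pq≈1) (1^n n))

  cancel-powers : ∀ {a} b d → a ≡ b ℕ.+ d → p ^ a * q ^ b ≈ p ^ d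
  cancel-powers b d ≡.refl = begin
    p ^ (b ℕ.+ d) * q ^ b     ≈⟨ *-congʳ (^-homo-* p b d) ⟩
    (p ^ b * p ^ d) * q ^ b   ≈⟨ solve 3 (λ x y z → (x :* y) :* z := (x :* z) :* y) refl _ _ _ ⟩
    (p ^ b * q ^ b) * p ^ d   ≈⟨ *-congʳ (p^n*q^n≈1 b) ⟩
    1# * p ^ d                ≈⟨ *-identityˡ _ ⟩
    p ^ d                     ∎

  -- Factor by factor, 1 - q^j = -q^j (1 - p^j); the exponents 1, ..., k add up to
  -- `triangular (suc k)`.
  invert-poch : ∀ k → Q.poch k ≈ (sign k * q ^ triangular (suc k)) * P.poch k
  invert-poch zero = solve 0 (con (+ 1) := (con (+ 1) :* con (+ 1)) :* con (+ 1)) refl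
  invert-poch (suc k) = begin
    Q.poch k * (1# - q ^ suc k)
      ≈⟨ *-cong (invert-poch k) factor ⟩
    ((sign k * q ^ triangular (suc k)) * P.poch k) * ((- 1# * q ^ suc k) * (1# - p ^ suc k))
      ≈⟨ solve 5 (λ s t x y z → ((s :* t) :* x) :* ((:- con (+ 1) :* y) :* z) :=
        ((:- con (+ 1) :* s) :* (t :* y)) :* (x :* z)) refl (sign k) _ _ _ _ ⟩
    ((sign (suc k)) * (q ^ triangular (suc k) * q ^ suc k)) * P.poch (suc k)
      ≈⟨ *-congʳ (*-congˡ (^-homo-* q (triangular (suc k)) (suc k))) ⟨
    (sign (suc k) * q ^ triangular (suc (suc k))) * P.poch (suc k) ∎
    where
    factor : 1# - q ^ suc k ≈ (- 1# * q ^ suc k) * (1# - p ^ suc k)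
    factor = begin
      1# - q ^ suc k                       ≈⟨ +-congʳ (p^n*q^n≈1 (suc k)) ⟨
      p ^ suc k * q ^ suc k - q ^ suc k    ≈⟨ solve 2
        (λ x y → x :* y :- y := (:- con (+ 1) :* y) :* (con (+ 1) :- x)) refl _ _ ⟩
      (- 1# * q ^ suc k) * (1# - p ^ suc k) ∎

  -- For j ≤ m - k one has p^(m+1) q^(k+j+1) = p^(m-k-j). If j runs beyond m - k, both products
  -- contain the factor j = m - k, which is 1 - 1.
  reflected-falling : ∀ m k → k ≤ m → P.falling (m ∸ k) k ≈ Prod k (λ j → 1# - p ^ suc m * q ^ (k ℕ.+ suc j))
  reflected-falling m k k≤m with k ℕ.≤? suc m ∸ k
  ... | yes k≤ = Prod-cong k (λ j j<k → +-congˡ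
    (-‿cong (sym (cancel-powers (k ℕ.+ suc j) (m ∸ k ∸ j) (exponent j j<k)))))
    where
    exponent : ∀ j → j < k → suc m ≡ k ℕ.+ suc j ℕ.+ (m ∸ k ∸ j)
    exponent j j<k = ≡.sym (≡.trans (arithmetic k j (m ∸ k ∸ j))
      (≡.cong suc (≡.trans (≡.cong (k ℕ.+_) (ℕ.m+[n∸m]≡n j≤)) (ℕ.m+[n∸m]≡n k≤m))))
      where
      j≤ : j ≤ m ∸ k
      j≤ = ℕ.≤-pred (ℕ.<-≤-trans j<k (≡.subst (k ≤_) (ℕ.+-∸-assoc 1 k≤m) k≤))
      arithmetic : ∀ k j x → k ℕ.+ suc j ℕ.+ x ≡ suc (k ℕ.+ (j ℕ.+ x))
      arithmetic = solve-∀
  ... | no k≰ = trans (Prod-zero k d<k (trans (+-congˡ (-‿cong (^-≡ p (ℕ.n∸n≡0 (m ∸ k))))) (-‿inverseʳ 1#)))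
      (sym (Prod-zero k d<k (trans (+-congˡ (-‿cong (cancel-powers (k ℕ.+ suc (m ∸ k)) 0 exponent)))
        (-‿inverseʳ 1#))))
    where
    d<k : m ∸ k < k
    d<k = ≡.subst (_≤ k) (ℕ.+-∸-assoc 1 k≤m) (ℕ.<⇒≤ (ℕ.≰⇒> k≰))
    exponent : suc m ≡ k ℕ.+ suc (m ∸ k) ℕ.+ 0
    exponent = ≡.sym (≡.trans (ℕ.+-identityʳ _) (≡.trans (ℕ.+-suc k (m ∸ k)) (≡.cong suc (ℕ.m+[n∸m]≡n k≤m))))

  -- After multiplication by (q;q)_k the term depends on m only through a = p^(m+1). Signs and
  -- triangular powers cancel against those of `invert-poch`, leaving q^k. At a = 1 the right-hand
  -- side is q^k [2k,k] (q;q)_k.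
  term-poch : ∀ m k → k ≤ m → term m k * Q.poch k ≈ q ^ k * Prod k (λ j → 1# - p ^ suc m * q ^ (k ℕ.+ suc j))
  term-poch m k k≤m = begin
    ((sign k * p ^ triangular k) * P.binom (m ∸ k) k) * Q.poch k
      ≈⟨ *-congˡ (trans (invert-poch k) (*-congʳ (*-congˡ (^-homo-* q (triangular k) k)))) ⟩
    ((sign k * p ^ triangular k) * P.binom (m ∸ k) k) * ((sign k * (q ^ triangular k * q ^ k)) * P.poch k)
      ≈⟨ solve 6 (λ s t u v b x → ((s :* t) :* b) :* ((s :* (u :* v)) :* x) := ((s :* s) :* (t :* u)) :*
        (v :* (b :* x))) refl (sign k) _ _ _ _ _ ⟩
    ((sign k * sign k) * (p ^ triangular k * q ^ triangular k)) * (q ^ k * (P.binom (m ∸ k) k * P.poch k))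
      ≈⟨ *-cong (*-cong (sign² k) (p^n*q^n≈1 (triangular k)))
        (*-congˡ (trans (P.binom-poch (m ∸ k) k) (reflected-falling m k k≤m))) ⟩
    (1# * 1#) * (q ^ k * Prod k (λ j → 1# - p ^ suc m * q ^ (k ℕ.+ suc j)))
      ≈⟨ solve 1 (λ x → (con (+ 1) :* con (+ 1)) :* x := x) refl _ ⟩
    q ^ k * Prod k (λ j → 1# - p ^ suc m * q ^ (k ℕ.+ suc j)) ∎

  module _ (n : ℕ) (square-zero : (p ^ suc n - 1#) * (p ^ suc n - 1#) ≈ 0#)
      (poch-regular : ∀ k → k < suc n → ∀ x → x * Q.poch k ≈ 0# → x ≈ 0#) where

    -- The index m stands for a = p^(m+1). With y = p^(n+1) the indices n and 2n + 1 stand for y and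
    -- y^2, and the central coefficient stands for a = 1, so `Prod-second-difference` applies.
    central-term : ∀ k → k < suc n → q ^ k * Q.binom (k ℕ.+ k) k ≈ (1# + 1#) * term n k + - 1# * term (n ℕ.+ suc n) k
    central-term k k<1+n = begin
      q ^ k * Q.binom (k ℕ.+ k) k
        ≈⟨ solve 2 (λ x y → x := (x :- y) :+ y) refl _ _ ⟩
      (q ^ k * Q.binom (k ℕ.+ k) k - target) + target
        ≈⟨ +-congʳ (poch-regular k k<1+n _ difference) ⟩
      0# + target
        ≈⟨ +-identityˡ _ ⟩
      target ∎
      where
      target : Carrier
      target = (1# + 1#) * term n k + - 1# * term (n ℕ.+ suc n) k
      y : Carrier
      y = p ^ suc n
      k≤n : k ≤ n
      k≤n = ℕ.≤-pred k<1+n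
      factors : Carrier → Carrier
      factors z = Prod k (λ j → 1# - z * q ^ (k ℕ.+ suc j))
      difference : (q ^ k * Q.binom (k ℕ.+ k) k - target) * Q.poch k ≈ 0#
      difference = begin
        (q ^ k * Q.binom (k ℕ.+ k) k - ((1# + 1#) * term n k + - 1# * term (n ℕ.+ suc n) k)) * Q.poch k
          ≈⟨ solve 5 (λ x b s t w → (x :* b :- ((con (+ 1) :+ con (+ 1)) :* s :+ :- con (+ 1) :* t)) :* w
               := x :* (b :* w) :- ((con (+ 1) :+ con (+ 1)) :* (s :* w) :- t :* w)) refl _ _ _ _ _ ⟩
        q ^ k * (Q.binom (k ℕ.+ k) k * Q.poch k) -
          ((1# + 1#) * (term n k * Q.poch k) - term (n ℕ.+ suc n) k * Q.poch k)
          ≈⟨ +-cong (*-congˡ (trans (Q.binom-poch-ascending k k)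
            (Prod-second-difference square-zero k (λ j → q ^ (k ℕ.+ suc j)))))
               (-‿cong (+-cong (*-congˡ (term-poch n k k≤n))
                 (-‿cong (trans (term-poch (n ℕ.+ suc n) k (ℕ.m≤n⇒m≤n+o (suc n) k≤n))
                 (*-congˡ (Prod-cong k (λ j _ → +-congˡ (-‿cong (*-congʳ (^-homo-* p (suc n) (suc n)))))))))))  ⟩
        q ^ k * ((factors y + factors y) - factors (y * y)) -
          ((1# + 1#) * (q ^ k * factors y) - q ^ k * factors (y * y))
          ≈⟨ solve 3 (λ x u v → x :* ((u :+ u) :- v) :- ((con (+ 1) :+ con (+ 1)) :* (x :* u) :- x :* v) := con
            (+ 0)) refl _ _ _ ⟩
        0# ∎

    central-sum : Sum (suc n) (λ k → q ^ k * Q.binom (k ℕ.+ k) k) ≈ (1# + 1#) * alternating n + - 1# *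
      alternating (n ℕ.+ suc n)
    central-sum = begin
      Sum (suc n) (λ k → q ^ k * Q.binom (k ℕ.+ k) k)
        ≈⟨ Sum-cong (suc n) central-term ⟩
      Sum (suc n) (λ k → (1# + 1#) * term n k + - 1# * term (n ℕ.+ suc n) k)
        ≈⟨ Sum-linear (suc n) (1# + 1#) (- 1#) (term n) (term (n ℕ.+ suc n)) ⟩
      (1# + 1#) * alternating n + - 1# * Sum (suc n) (term (n ℕ.+ suc n))
        ≈⟨ +-congˡ (*-congˡ (alternating-truncate (suc n) (ℕ.m≤n+m (suc n) (suc n)) ℕ.≤-refl)) ⟨
      (1# + 1#) * alternating n + - 1# * alternating (n ℕ.+ suc n) ∎

  -- Since pq = 1, the hypotheses on exponents give p^a = p^h q^e and p^b = p^(2h) q^e. For z = s₁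
  -- p^h the left-hand side is q^e (2z - z^2) = q^e - q^e (1 - z)^2.
  complete-square : ∀ {s₁ s₂} a b e {h} → (1# - s₁ * p ^ h) * (1# - s₁ * p ^ h) ≈ 0# → s₁ * s₁ ≈ s₂ →
    h ≡ e ℕ.+ a → h ℕ.+ h ≡ e ℕ.+ b → (1# + 1#) * (s₁ * p ^ a) + - 1# * (s₂ * p ^ b) ≈ q ^ e
  complete-square {s₁} {s₂} a b e {h} square s₁²≈s₂ h≡ 2h≡ = begin
    (1# + 1#) * (s₁ * p ^ a) + - 1# * (s₂ * p ^ b)
      ≈⟨ +-cong (*-congˡ (*-congˡ (sym (cancel-powers e a h≡))))
           (*-congˡ (*-cong (sym s₁²≈s₂) (trans (sym (cancel-powers e b 2h≡)) (*-congʳ (^-homo-* p h h))))) ⟩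
    (1# + 1#) * (s₁ * (z * q ^ e)) + - 1# * ((s₁ * s₁) * ((z * z) * q ^ e))
      ≈⟨ solve 3 (λ s z x → (con (+ 1) :+ con (+ 1)) :* (s :* (z :* x)) :+ :- con (+ 1) :*
        ((s :* s) :* ((z :* z) :* x))
           := x :- x :* ((con (+ 1) :- s :* z) :* (con (+ 1) :- s :* z))) refl s₁ z (q ^ e) ⟩
    q ^ e - q ^ e * ((1# - s₁ * z) * (1# - s₁ * z))
      ≈⟨ +-congˡ (-‿cong (trans (*-congˡ square) (zeroʳ _))) ⟩
    q ^ e - 0#
      ≈⟨ solve 1 (λ x → x :- con (+ 0) := x) refl _ ⟩
    q ^ e ∎
    where z = p ^ h

-- Evaluation

data Parity : ℕ → Set where
  even : ∀ k → Parity (k ℕ.+ k)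
  odd : ∀ k → Parity (suc (k ℕ.+ k))

parity : ∀ n → Parity n
parity zero = even 0
parity (suc n) with parity n
... | even k = odd k
... | odd k = ≡.subst Parity (≡.cong suc (ℕ.+-suc k k)) (even (suc k))

double-injective : ∀ a b → a ℕ.+ a ≡ b ℕ.+ b → a ≡ b
double-injective zero zero eq = ≡.refl
double-injective (suc a) (suc b) eq = ≡.cong suc (double-injective a b
  (ℕ.suc-injective (≡.trans (≡.sym (ℕ.+-suc a a)) (≡.trans (ℕ.suc-injective eq) (ℕ.+-suc b b)))))

odd≢even : ∀ a b → ¬ suc (a ℕ.+ a) ≡ b ℕ.+ b
odd≢even zero (suc b) eq = contradiction (≡.trans (ℕ.suc-injective eq) (ℕ.+-suc b b)) λ ()
odd≢even (suc a) (suc b) eq = odd≢even a b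
  (ℕ.suc-injective (≡.trans (≡.cong suc (≡.sym (ℕ.+-suc a a))) (≡.trans (ℕ.suc-injective eq) (ℕ.+-suc b b))))

-- Doubled, and with N moved to the left, the formula m(3m - 1)/2 needs neither division nor
-- subtraction.
pentagonal-double : ∀ N → pentagonal N ℕ.+ pentagonal N ℕ.+ N ≡ N ℕ.* N ℕ.* 3
pentagonal-double zero = ≡.refl
pentagonal-double (suc N) = ≡.trans (split N (pentagonal N))
  (≡.trans (≡.cong (ℕ._+ (N ℕ.* 6 ℕ.+ 3)) (pentagonal-double N)) (collect N))
  where
  split : ∀ N p → (suc (N ℕ.* 3) ℕ.+ p) ℕ.+ (suc (N ℕ.* 3) ℕ.+ p) ℕ.+ suc N ≡ (p ℕ.+ p ℕ.+ N) ℕ.+ (N ℕ.* 6 ℕ.+ 3)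
  split = solve-∀
  collect : ∀ N → N ℕ.* N ℕ.* 3 ℕ.+ (N ℕ.* 6 ℕ.+ 3) ≡ suc N ℕ.* suc N ℕ.* 3
  collect = solve-∀

pentagonal′-double : ∀ N → pentagonal′ N ℕ.+ pentagonal′ N ≡ N ℕ.* N ℕ.* 3 ℕ.+ N
pentagonal′-double zero = ≡.refl
pentagonal′-double (suc N) = ≡.trans (split N (pentagonal′ N))
  (≡.trans (≡.cong (ℕ._+ (N ℕ.* 6 ℕ.+ 4)) (pentagonal′-double N)) (collect N))
  where
  split : ∀ N p → (suc (suc (N ℕ.* 3)) ℕ.+ p) ℕ.+ (suc (suc (N ℕ.* 3)) ℕ.+ p) ≡ (p ℕ.+ p) ℕ.+ (N ℕ.* 6 ℕ.+ 4)
  split = solve-∀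
  collect : ∀ N → N ℕ.* N ℕ.* 3 ℕ.+ N ℕ.+ (N ℕ.* 6 ℕ.+ 4) ≡ suc N ℕ.* suc N ℕ.* 3 ℕ.+ suc N
  collect = solve-∀

-- The number (n^2 - 1)/3 for n = 3N + 1.
exponent₁ : ℕ → ℕ
exponent₁ N = N ℕ.* (N ℕ.* 3 ℕ.+ 2)

-- The number (n^2 - 1)/3 for n = 3N + 2.
exponent₂ : ℕ → ℕ
exponent₂ N = suc (N ℕ.* 3) ℕ.* suc N

-- With n = 3N + 1 this makes 2h the multiple 3N n of n. `exponent₁+pentagonal′` has the same
-- right-hand side and so provides the second exponent condition of `complete-square`.
2*exponent₁ : ∀ N → let h = exponent₁ N ℕ.+ pentagonal N in h ℕ.+ h ≡ N ℕ.* 3 ℕ.* suc (N ℕ.* 3)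
2*exponent₁ N = ℕ.+-cancelʳ-≡ N _ _ (≡.trans (split (exponent₁ N) (pentagonal N) N)
  (≡.trans (≡.cong (ℕ._+ (exponent₁ N ℕ.+ exponent₁ N)) (pentagonal-double N)) (collect N)))
  where
  split : ∀ e p N → (e ℕ.+ p) ℕ.+ (e ℕ.+ p) ℕ.+ N ≡ (p ℕ.+ p ℕ.+ N) ℕ.+ (e ℕ.+ e)
  split = solve-∀
  collect : ∀ N → N ℕ.* N ℕ.* 3 ℕ.+ (N ℕ.* (N ℕ.* 3 ℕ.+ 2) ℕ.+ N ℕ.* (N ℕ.* 3 ℕ.+ 2)) ≡ N ℕ.* 3 ℕ.* suc
    (N ℕ.* 3) ℕ.+ N
  collect = solve-∀

exponent₁+pentagonal′ : ∀ N → exponent₁ N ℕ.+ pentagonal′ (N ℕ.+ N) ≡ N ℕ.* 3 ℕ.* suc (N ℕ.* 3)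
exponent₁+pentagonal′ N = double-injective _ _ (≡.trans (split (exponent₁ N) (pentagonal′ (N ℕ.+ N)))
  (≡.trans (≡.cong (ℕ._+ (exponent₁ N ℕ.+ exponent₁ N)) (pentagonal′-double (N ℕ.+ N))) (collect N)))
  where
  split : ∀ e p → (e ℕ.+ p) ℕ.+ (e ℕ.+ p) ≡ (p ℕ.+ p) ℕ.+ (e ℕ.+ e)
  split = solve-∀
  collect : ∀ N → (N ℕ.+ N) ℕ.* (N ℕ.+ N) ℕ.* 3 ℕ.+ (N ℕ.+ N) ℕ.+
    (N ℕ.* (N ℕ.* 3 ℕ.+ 2) ℕ.+ N ℕ.* (N ℕ.* 3 ℕ.+ 2)) ≡ N ℕ.* 3 ℕ.* suc (N ℕ.* 3) ℕ.+ N ℕ.* 3 ℕ.* suc (N ℕ.* 3)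
  collect = solve-∀

2*exponent₂ : ∀ N → let h = exponent₂ N ℕ.+ pentagonal′ N in h ℕ.+ h ≡ suc (N ℕ.* 3) ℕ.* suc (suc (N ℕ.* 3))
2*exponent₂ N = ≡.trans (split (exponent₂ N) (pentagonal′ N))
  (≡.trans (≡.cong (ℕ._+ (exponent₂ N ℕ.+ exponent₂ N)) (pentagonal′-double N)) (collect N))
  where
  split : ∀ e p → (e ℕ.+ p) ℕ.+ (e ℕ.+ p) ≡ (p ℕ.+ p) ℕ.+ (e ℕ.+ e)
  split = solve-∀
  collect : ∀ N → N ℕ.* N ℕ.* 3 ℕ.+ N ℕ.+ (suc (N ℕ.* 3) ℕ.* suc N ℕ.+ suc (N ℕ.* 3) ℕ.* suc N) ≡ suc (N ℕ.* 3)
    ℕ.* suc (suc (N ℕ.* 3))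
  collect = solve-∀

exponent₂+pentagonal : ∀ N → exponent₂ N ℕ.+ pentagonal (suc (N ℕ.+ N)) ≡ suc (N ℕ.* 3) ℕ.* suc (suc (N ℕ.* 3))
exponent₂+pentagonal N = double-injective _ _
  (ℕ.+-cancelʳ-≡ (suc (N ℕ.+ N)) _ _ (≡.trans (split (exponent₂ N) (pentagonal (suc (N ℕ.+ N))) (suc (N ℕ.+ N)))
  (≡.trans (≡.cong (ℕ._+ (exponent₂ N ℕ.+ exponent₂ N)) (pentagonal-double (suc (N ℕ.+ N)))) (collect N))))
  where
  split : ∀ e p x → (e ℕ.+ p) ℕ.+ (e ℕ.+ p) ℕ.+ x ≡ (p ℕ.+ p ℕ.+ x) ℕ.+ (e ℕ.+ e)
  split = solve-∀
  collect : ∀ N → suc (N ℕ.+ N) ℕ.* suc (N ℕ.+ N) ℕ.* 3 ℕ.+ (suc (N ℕ.* 3) ℕ.* suc N ℕ.+ suc (N ℕ.* 3) ℕ.* suc N)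
    ≡ suc (N ℕ.* 3) ℕ.* suc (suc (N ℕ.* 3)) ℕ.+ suc (N ℕ.* 3) ℕ.* suc (suc (N ℕ.* 3)) ℕ.+ suc (N ℕ.+ N)
  collect = solve-∀

module Evaluation {c ℓ} (R : CommutativeRing c ℓ) (p q : CommutativeRing.Carrier R)
    (pq≈1 : CommutativeRing._≈_ R (CommutativeRing._*_ R p q) (CommutativeRing.1# R)) where
  open CommutativeRing R
  open FiniteSums R
  open IntegerSolver R
  open QBinomials R q
  open AlternatingSums R p
  open InverseBases R p q pq≈1
  open import Algebra.Properties.Semiring.Exp semiring
  open import Relation.Binary.Reasoning.Setoid setoid

  sign-+ : ∀ a b → sign a * sign b ≈ sign (a ℕ.+ b)
  sign-+ a b = sym (^-homo-* (- 1#) a b)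

  sign-double : ∀ k → sign (k ℕ.+ k) ≈ 1#
  sign-double k = trans (^-homo-* (- 1#) k k) (sign² k)

  double-sum : ∀ n → (∀ i j → i < n → j < n → n ≤ i ℕ.+ j → binom (i ℕ.+ j) i * binom (i ℕ.+ j) i ≈ 0#) →
    Sum n (λ i → Sum n (λ j → q ^ (j ℕ.* j ℕ.+ i ℕ.+ j) * (binom (i ℕ.+ j) i * binom (i ℕ.+ j) i))) ≈
    Sum n (λ k → q ^ k * binom (k ℕ.+ k) k)
  double-sum n vanish = trans
    (square-by-antidiagonals n ℕ.≤-refl _ (λ i j i<n j<n n≤ → trans (*-congˡ (vanish i j i<n j<n n≤)) (zeroʳ _)))
    (Sum-cong n (λ m _ → trans (antidiagonal-cong m (factor m))
      (trans (antidiagonal-scale m (q ^ m) _) (*-congˡ (central-vandermonde m)))))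
    where
    factor : ∀ m i j → i ℕ.+ j ≡ m → q ^ (j ℕ.* j ℕ.+ i ℕ.+ j) * (binom (i ℕ.+ j) i * binom (i ℕ.+ j) i) ≈
      q ^ m * (q ^ (j ℕ.* j) * (binom (i ℕ.+ j) i * binom (i ℕ.+ j) i))
    factor m i j ≡.refl = trans (*-congʳ (trans (^-≡ q (arithmetic (j ℕ.* j) i j))
      (^-homo-* q (i ℕ.+ j) (j ℕ.* j)))) (*-assoc _ _ _)
      where
      arithmetic : ∀ x i j → x ℕ.+ i ℕ.+ j ≡ i ℕ.+ j ℕ.+ x
      arithmetic = solve-∀

  -- For n = 3M + 3 the indices n - 1 and 2n - 1 are both 2 modulo 3, where the alternating sums
  -- vanish.
  value₀ : ∀ M → (1# + 1#) * alternating (2 ℕ.+ M ℕ.* 3) + - 1# * alternating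
    (2 ℕ.+ M ℕ.* 3 ℕ.+ suc (2 ℕ.+ M ℕ.* 3)) ≈ 0#
  value₀ M = trans
    (+-cong (*-congˡ (alternating-2 M)) (*-congˡ
      (trans (reflexive (≡.cong alternating (arithmetic M))) (alternating-2 (suc (M ℕ.+ M))))))
    (solve 0 ((con (+ 1) :+ con (+ 1)) :* con (+ 0) :+ :- con (+ 1) :* con (+ 0) := con (+ 0)) refl)
    where
    arithmetic : ∀ M → 2 ℕ.+ M ℕ.* 3 ℕ.+ suc (2 ℕ.+ M ℕ.* 3) ≡ 2 ℕ.+ suc (M ℕ.+ M) ℕ.* 3
    arithmetic = solve-∀

  value₁ : ∀ N → let z = sign N * p ^ (exponent₁ N ℕ.+ pentagonal N) in (1# - z) * (1# - z) ≈ 0# →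
    (1# + 1#) * alternating (N ℕ.* 3) + - 1# * alternating (N ℕ.* 3 ℕ.+ suc (N ℕ.* 3)) ≈ q ^ exponent₁ N
  value₁ N square = trans
    (+-cong (*-congˡ (alternating-0 N)) (*-congˡ
      (trans (reflexive (≡.cong alternating (arithmetic N))) (alternating-1 (N ℕ.+ N)))))
    (complete-square (pentagonal N) (pentagonal′ (N ℕ.+ N)) (exponent₁ N) square (sign-+ N N) ≡.refl
      (≡.trans (2*exponent₁ N) (≡.sym (exponent₁+pentagonal′ N))))
    where
    arithmetic : ∀ N → N ℕ.* 3 ℕ.+ suc (N ℕ.* 3) ≡ 1 ℕ.+ (N ℕ.+ N) ℕ.* 3
    arithmetic = solve-∀

  value₂ : ∀ N → let z = sign (suc N) * p ^ (exponent₂ N ℕ.+ pentagonal′ N) in (1# - z) * (1# - z) ≈ 0# →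
    (1# + 1#) * alternating (1 ℕ.+ N ℕ.* 3) + - 1# * alternating (1 ℕ.+ N ℕ.* 3 ℕ.+ suc (1 ℕ.+ N ℕ.* 3)) ≈ - q
      ^ exponent₂ N
  value₂ N square = begin
    (1# + 1#) * alternating (1 ℕ.+ N ℕ.* 3) + - 1# * alternating (1 ℕ.+ N ℕ.* 3 ℕ.+ suc (1 ℕ.+ N ℕ.* 3))
      ≈⟨ +-cong (*-congˡ (alternating-1 N)) (*-congˡ
        (trans (reflexive (≡.cong alternating (arithmetic N))) (alternating-0 (suc (N ℕ.+ N))))) ⟩
    (1# + 1#) * (sign N * p ^ pentagonal′ N) + - 1# * (sign (suc (N ℕ.+ N)) * p ^ pentagonal (suc (N ℕ.+ N)))
      -- Pulling out -1 raises the index of both signs by one, so that the second sign becomes the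
      -- square of the first.
      ≈⟨ solve 4 (λ s x t y → (con (+ 1) :+ con (+ 1)) :* (s :* x) :+ :- con (+ 1) :* (t :* y)
           := :- ((con (+ 1) :+ con (+ 1)) :* ((:- con (+ 1) :* s) :* x) :+ :- con (+ 1) :*
             ((:- con (+ 1) :* t) :* y))) refl (sign N) _ (sign (suc (N ℕ.+ N))) _ ⟩
    - ((1# + 1#) * (sign (suc N) * p ^ pentagonal′ N) + - 1# *
      (sign (suc (suc (N ℕ.+ N))) * p ^ pentagonal (suc (N ℕ.+ N))))
      ≈⟨ -‿cong (complete-square (pentagonal′ N) (pentagonal (suc (N ℕ.+ N))) (exponent₂ N) square
        (trans (sign-+ (suc N) (suc N)) (reflexive (≡.cong (λ k → sign (suc k)) (ℕ.+-suc N N))))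
           ≡.refl (≡.trans (2*exponent₂ N) (≡.sym (exponent₂+pentagonal N)))) ⟩
    - q ^ exponent₂ N ∎
    where
    arithmetic : ∀ N → 1 ℕ.+ N ℕ.* 3 ℕ.+ suc (1 ℕ.+ N ℕ.* 3) ≡ suc (N ℕ.+ N) ℕ.* 3
    arithmetic = solve-∀

  p^n≈1 : ∀ n → q ^ n ≈ 1# → p ^ n ≈ 1#
  p^n≈1 n q^n≈1 = trans (sym (*-identityʳ _)) (trans (*-congˡ (sym q^n≈1)) (p^n*q^n≈1 n))

  module _ (n : ℕ) (q^n≈1 : q ^ n ≈ 1#) (regular : ∀ r → r ℕ.+ r ≡ n → ∀ x → (1# - q ^ r) * x ≈ 0# → x ≈ 0#) where

    -- From (1 - q^r)(1 + q^r) = 1 - q^n = 0 and the regularity of 1 - q^r follows q^r = -1, and p^r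
    -- is its inverse.
    half-period : ∀ r → r ℕ.+ r ≡ n → p ^ r ≈ - 1#
    half-period r 2r≡n = begin
      p ^ r                          ≈⟨ solve 2 (λ x y → x := (:- (x :* y)) :+ x :* (con (+ 1) :+ y)) refl
        (p ^ r) (q ^ r) ⟩
      - (p ^ r * q ^ r) + p ^ r * (1# + q ^ r) ≈⟨ +-cong (-‿cong (p^n*q^n≈1 r)) (trans (*-congˡ 1+q^r≈0) (zeroʳ _)) ⟩
      - 1# + 0#                      ≈⟨ +-identityʳ _ ⟩
      - 1#                           ∎
      where
      1+q^r≈0 : 1# + q ^ r ≈ 0#
      1+q^r≈0 = regular r 2r≡n _ (begin
        (1# - q ^ r) * (1# + q ^ r)  ≈⟨ solve 1 (λ x → (con (+ 1) :- x) :* (con (+ 1) :+ x) := con (+ 1) :- x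
          :* x) refl (q ^ r) ⟩
        1# - q ^ r * q ^ r           ≈⟨ +-congˡ (-‿cong (trans (sym (^-homo-* q r r)) (trans (^-≡ q 2r≡n) q^n≈1))) ⟩
        1# - 1#                      ≈⟨ -‿inverseʳ 1# ⟩
        0#                           ∎)

    -- Formally p^h is the t-th power of p^(n/2) = -1, and a + t is even. For even t, h is a
    -- multiple of n and the sign is 1; for odd t and even n, `half-period` makes sense of the
    -- formal argument; t and n cannot both be odd because t n = 2h.
    half-integral-power : ∀ a t s h → a ℕ.+ t ≡ s ℕ.+ s → h ℕ.+ h ≡ t ℕ.* n → sign a * p ^ h ≈ 1#
    half-integral-power a t s h a+t≡2s 2h≡tn = by-parity (parity t) (parity n) ≡.refl ≡.refl
      where
      sign-a*sign-t≈1 : sign a * sign t ≈ 1#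
      sign-a*sign-t≈1 = trans (sign-+ a t) (trans (reflexive (≡.cong sign a+t≡2s)) (sign-double s))
      by-parity : ∀ {t′ n′} → Parity t′ → Parity n′ → t′ ≡ t → n′ ≡ n → sign a * p ^ h ≈ 1#
      by-parity (even u) _ ≡.refl _ = begin
        sign a * p ^ h      ≈⟨ *-cong (sym (trans (*-congˡ (sign-double u)) (*-identityʳ _))) (^-≡ p h≡un) ⟩
        (sign a * sign (u ℕ.+ u)) * p ^ (n ℕ.* u)
          ≈⟨ *-cong sign-a*sign-t≈1 (trans (sym (^-assocʳ p n u)) (trans (^-congˡ u (p^n≈1 n q^n≈1)) (1^n u))) ⟩
        1# * 1#             ≈⟨ *-identityʳ 1# ⟩
        1# ∎
        where
        h≡un : h ≡ n ℕ.* u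
        h≡un = double-injective _ _ (≡.trans 2h≡tn (≡.trans (ℕ.*-comm (u ℕ.+ u) n) (ℕ.*-distribˡ-+ n u u)))
      by-parity (odd u) (even r) ≡.refl 2r≡n = begin
        sign a * p ^ h             ≈⟨ *-congˡ (^-≡ p h≡rt) ⟩
        sign a * p ^ (r ℕ.* t)     ≈⟨ *-congˡ (trans (sym (^-assocʳ p r t)) (^-congˡ t (half-period r 2r≡n))) ⟩
        sign a * sign t            ≈⟨ sign-a*sign-t≈1 ⟩
        1# ∎
        where
        h≡rt : h ≡ r ℕ.* t
        h≡rt = double-injective _ _ (≡.trans 2h≡tn
          (≡.trans (≡.cong (t ℕ.*_) (≡.sym 2r≡n)) (≡.trans (ℕ.*-comm t (r ℕ.+ r)) (ℕ.*-distribʳ-+ t r r))))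
      by-parity (odd u) (odd v) ≡.refl ≡.refl = contradiction (≡.trans (arithmetic u v) (≡.sym 2h≡tn))
        (odd≢even (u ℕ.+ v ℕ.+ (u ℕ.* v ℕ.+ u ℕ.* v)) h)
        where
        arithmetic : ∀ u v → suc ((u ℕ.+ v ℕ.+ (u ℕ.* v ℕ.+ u ℕ.* v)) ℕ.+ (u ℕ.+ v ℕ.+ (u ℕ.* v ℕ.+ u ℕ.* v)))
          ≡ suc (u ℕ.+ u) ℕ.* suc (v ℕ.+ v)
        arithmetic = solve-∀

-- Quotient rings, and congruences modulo an element and its square

module Quotient {c ℓ} (R : CommutativeRing c ℓ) (m : CommutativeRing.Carrier R) where
  open CommutativeRing R
  open IntegerSolver R

  infix 4 _≋_

  record _≋_ (x y : Carrier) : Set (c ⊔ ℓ) where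
    constructor congruent
    field
      multiplier : Carrier
      difference : x - y ≈ m * multiplier

  ≈⇒≋ : ∀ {x y} → x ≈ y → x ≋ y
  ≈⇒≋ {x} {y} x≈y = congruent 0# (trans (+-congʳ x≈y) (trans (-‿inverseʳ y) (sym (zeroʳ m))))

  -- The carrier and the operations stay those of R and only equality becomes coarser, so the same
  -- elements can be viewed modulo m and modulo m^2.
  quotientRing : CommutativeRing c (c ⊔ ℓ)
  quotientRing = record { isCommutativeRing = isCommutativeRing′ }
    where
    isCommutativeRing′ : IsCommutativeRing _≋_ _+_ _*_ -_ 0# 1#
    isCommutativeRing′ = record
      { isRing = record
        { +-isAbelianGroup = record
          { isGroup = record
            { isMonoid = record
              { isSemigroup = record
                { isMagma = record
                  { isEquivalence = record
                    { refl = ≈⇒≋ refl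
                    ; sym = λ {x} {y} (congruent g eq) → congruent (- g)
                        (trans (solve 2 (λ x y → y :- x := :- (x :- y)) refl x y)
                          (trans (-‿cong eq) (solve 2 (λ m g → :- (m :* g) := m :* (:- g)) refl m g)))
                    ; trans = λ {x} {y} {z} (congruent g eq) (congruent h eq′) → congruent (g + h)
                        (trans (solve 3 (λ x y z → x :- z := (x :- y) :+ (y :- z)) refl x y z)
                          (trans (+-cong eq eq′) (sym (distribˡ m g h)))) }
                  ; ∙-cong = λ {x} {y} {u} {v} (congruent g eq) (congruent h eq′) → congruent (g + h)
                      (trans (solve 4 (λ x y u v → (x :+ u) :- (y :+ v) := (x :- y) :+ (u :- v)) refl x y u v)
                        (trans (+-cong eq eq′) (sym (distribˡ m g h)))) }
                ; assoc = λ x y z → ≈⇒≋ (+-assoc x y z) }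
              ; identity = (λ x → ≈⇒≋ (+-identityˡ x)) , (λ x → ≈⇒≋ (+-identityʳ x)) }
            ; inverse = (λ x → ≈⇒≋ (-‿inverseˡ x)) , (λ x → ≈⇒≋ (-‿inverseʳ x))
            ; ⁻¹-cong = λ {x} {y} (congruent g eq) → congruent (- g)
                (trans (solve 2 (λ x y → (:- x) :- (:- y) := :- (x :- y)) refl x y)
                  (trans (-‿cong eq) (solve 2 (λ m g → :- (m :* g) := m :* (:- g)) refl m g))) }
          ; comm = λ x y → ≈⇒≋ (+-comm x y) }
        ; *-cong = λ {x} {y} {u} {v} (congruent g eq) (congruent h eq′) → congruent (g * u + y * h)
            (trans (solve 4 (λ x y u v → x :* u :- y :* v := (x :- y) :* u :+ y :* (u :- v)) refl x y u v)
              (trans (+-cong (*-congʳ eq) (*-congˡ eq′))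
                (solve 5 (λ m g h u y → (m :* g) :* u :+ y :* (m :* h) := m :* (g :* u :+ y :* h)) refl m g h u y)))
        ; *-assoc = λ x y z → ≈⇒≋ (*-assoc x y z)
        ; *-identity = (λ x → ≈⇒≋ (*-identityˡ x)) , (λ x → ≈⇒≋ (*-identityʳ x))
        ; distrib = (λ x y z → ≈⇒≋ (distribˡ x y z)) , (λ x y z → ≈⇒≋ (distribʳ x y z)) }
      ; *-comm = λ x y → ≈⇒≋ (*-comm x y) }

  open import Algebra.Properties.Semiring.Exp semiring using (_^_)
  open import Algebra.Properties.Semiring.Exp (CommutativeRing.semiring quotientRing) using () renaming (_^_ to _^′_)

  -- Both powers use the same multiplication, but they are recursive functions instantiated at
  -- different rings, so they agree definitionally only at numerals.
  ^-transfer : ∀ x k → x ^′ k ≡ x ^ k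
  ^-transfer x zero = ≡.refl
  ^-transfer x (suc k) = ≡.cong (x *_) (^-transfer x k)

  binom-transfer : ∀ q n k → QBinomials.binom quotientRing q n k ≡ QBinomials.binom R q n k
  binom-transfer q n zero = ≡.refl
  binom-transfer q zero (suc k) = ≡.refl
  binom-transfer q (suc n) (suc k) = ≡.cong₂ _+_ (binom-transfer q n k)
    (≡.cong₂ _*_ (^-transfer q (suc k)) (binom-transfer q n (suc k)))

  Sum-transfer : ∀ n {f g} → (∀ k → f k ≡ g k) → FiniteSums.Sum quotientRing n f ≡ FiniteSums.Sum R n g
  Sum-transfer zero f≡g = ≡.refl
  Sum-transfer (suc n) f≡g = ≡.cong₂ _+_ (f≡g 0) (Sum-transfer n (λ k → f≡g (suc k)))

module _ {c ℓ} (R : CommutativeRing c ℓ) (m : CommutativeRing.Carrier R) where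
  open CommutativeRing R
  open IntegerSolver R
  open import Algebra.Properties.Semiring.Exp semiring
  open import Relation.Binary.Reasoning.Setoid setoid
  private
    module M = Quotient R m
    module M² = Quotient R (m * m)

  square-congruence : ∀ {x y} → x M.≋ y → (x - y) * (x - y) M².≋ 0#
  square-congruence {x} {y} (M.congruent g eq) = M².congruent (g * g) (begin
    (x - y) * (x - y) - 0#     ≈⟨ solve 1 (λ x → x :- con (+ 0) := x) refl _ ⟩
    (x - y) * (x - y)          ≈⟨ *-cong eq eq ⟩
    (m * g) * (m * g)          ≈⟨ solve 2 (λ m g → (m :* g) :* (m :* g) := (m :* m) :* (g :* g)) refl m g ⟩
    (m * m) * (g * g)          ∎)

  weaken-congruence : ∀ {x y} → x M².≋ y → x M.≋ y
  weaken-congruence (M².congruent g eq) = M.congruent (m * g) (trans eq (*-assoc m m g))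

  -- A Newton step: replacing x by 2x - q x^2 turns the error qx - 1 into minus its square.
  inverse-mod-square : ∀ {q x} → q * x M.≋ 1# → ((x + x) - x * (q * x)) * q M².≋ 1#
  inverse-mod-square {q} {x} (M.congruent g eq) = M².congruent (- (g * g)) (begin
    ((x + x) - x * (q * x)) * q - 1#
      ≈⟨ solve 2 (λ q x → ((x :+ x) :- x :* (q :* x)) :* q :- con (+ 1) := :-
        ((q :* x :- con (+ 1)) :* (q :* x :- con (+ 1)))) refl q x ⟩
    - ((q * x - 1#) * (q * x - 1#))
      ≈⟨ -‿cong (*-cong eq eq) ⟩
    - ((m * g) * (m * g))
      ≈⟨ solve 2 (λ m g → :- ((m :* g) :* (m :* g)) := (m :* m) :* (:- (g :* g))) refl m g ⟩
    (m * m) * - (g * g) ∎)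

Regular : ∀ {c ℓ} (R : CommutativeRing c ℓ) (m x : CommutativeRing.Carrier R) → Set (c ⊔ ℓ)
Regular R m x = ∀ y → (x * y) ≋ 0# → y ≋ 0#
  where
  open CommutativeRing R using (_*_; 0#)
  open Quotient R m

oneMinusPower : ∀ {c ℓ} (R : CommutativeRing c ℓ) (q : CommutativeRing.Carrier R) → ℕ → CommutativeRing.Carrier R
oneMinusPower R q k = 1# - q ^ k
  where
  open CommutativeRing R
  open Algebra.Properties.Semiring.Exp semiring

-- The double sum modulo m^2, when q^(n+1) is 1 modulo m

module Congruence {c ℓ} (R : CommutativeRing c ℓ) (m q : CommutativeRing.Carrier R) (n : ℕ)
    (q^n≋1 : Quotient._≋_ R m (Algebra.Properties.Semiring.Exp._^_ (CommutativeRing.semiring R) q (suc n))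
      (CommutativeRing.1# R))
    (regular : ∀ d → d < n → Regular R m (oneMinusPower R q (suc d)))
    (regular² : ∀ d → d < n → Regular R (CommutativeRing._*_ R m m) (oneMinusPower R q (suc d))) where
  open CommutativeRing R using (Carrier; _+_; _*_; -_; _-_; 0#; 1#)
  private
    module R = CommutativeRing R
    module S = FiniteSums R
    module M = Quotient R m
    module M² = Quotient R (m * m)
    R₁ = M.quotientRing
    R₂ = M².quotientRing
    module R₁ = CommutativeRing R₁
    module R₂ = CommutativeRing R₂
    module S₁ = FiniteSums R₁
    module S₂ = FiniteSums R₂
    module B = QBinomials R q
    module B₁ = QBinomials R₁ q
    module B₂ = QBinomials R₂ q
    open IntegerSolver R
    open Algebra.Properties.Semiring.Exp R.semiring using (_^_)
    open Algebra.Properties.Semiring.Exp R₁.semiring using () renaming (_^_ to _^₁_)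
    open Algebra.Properties.Semiring.Exp R₂.semiring using () renaming (_^_ to _^₂_)

  open M using (_≋_)
  open M² using () renaming (_≋_ to _≋²_)

  regular₁ : ∀ d → d < n → ∀ x → (1# - q ^₁ suc d) * x ≋ 0# → x ≋ 0#
  regular₁ d d<n x eq = regular d d<n x (≡.subst (λ y → (1# - y) * x ≋ 0#) (M.^-transfer q (suc d)) eq)

  regular₂ : ∀ d → d < n → ∀ x → (1# - q ^₂ suc d) * x ≋² 0# → x ≋² 0#
  regular₂ d d<n x eq = regular² d d<n x (≡.subst (λ y → (1# - y) * x ≋² 0#) (M².^-transfer q (suc d)) eq)

  q^₁n≋1 : q ^₁ suc n ≋ 1#
  q^₁n≋1 = ≡.subst (_≋ 1#) (≡.sym (M.^-transfer q (suc n))) q^n≋1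

  poch-regular₁ : ∀ k → k ≤ n → ∀ x → x * B₁.poch k ≋ 0# → x ≋ 0#
  poch-regular₁ k k≤n = S₁.Prod-regular k (λ j j<k → regular₁ j (ℕ.<-≤-trans j<k k≤n))

  poch-regular₂ : ∀ k → k < suc n → ∀ x → x * B₂.poch k ≋² 0# → x ≋² 0#
  poch-regular₂ k (s≤s k≤n) = S₂.Prod-regular k (λ j j<k → regular₂ j (ℕ.<-≤-trans j<k k≤n))

  -- Modulo m the inverse of q is q^n; the Newton step of `inverse-mod-square` improves it to an
  -- inverse modulo m^2.
  p : Carrier
  p = ((q ^ n) + (q ^ n)) - (q ^ n) * (q * (q ^ n))

  pq≋²1 : p * q ≋² 1#
  pq≋²1 = inverse-mod-square R m q^n≋1

  private
    module E₁ = Evaluation R₁ p q (weaken-congruence R m pq≋²1)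
    module E₂ = Evaluation R₂ p q pq≋²1
    module I₂ = InverseBases R₂ p q pq≋²1
    module A₁ = AlternatingSums R₁ p
    module A₂ = AlternatingSums R₂ p

  -- Modulo m the symbol (q;q)_(i+j) vanishes through its factor 1 - q^(n+1), whereas (q;q)_i and
  -- (q;q)_j are regular and can be cancelled in `binom-factorials`.
  binom≋0 : ∀ i j → i < suc n → j < suc n → suc n ≤ i ℕ.+ j → B₁.binom (i ℕ.+ j) i ≋ 0#
  binom≋0 i j (s≤s i≤n) (s≤s j≤n) n<i+j = poch-regular₁ j j≤n _ (poch-regular₁ i i≤n _ (begin
    (B₁.binom (i ℕ.+ j) i * B₁.poch j) * B₁.poch i
      ≈⟨ M.≈⇒≋ (solve 3 (λ b x y → (b :* y) :* x := (x :* y) :* b) R.refl (B₁.binom (i ℕ.+ j) i) (B₁.poch i)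
        (B₁.poch j)) ⟩
    (B₁.poch i * B₁.poch j) * B₁.binom (i ℕ.+ j) i
      ≈⟨ B₁.binom-factorials i j ⟩
    B₁.poch (i ℕ.+ j)
      ≈⟨ S₁.Prod-zero (i ℕ.+ j) n<i+j (R₁.trans (R₁.+-congˡ (R₁.-‿cong q^₁n≋1)) (R₁.-‿inverseʳ 1#)) ⟩
    0# ∎))
    where open import Relation.Binary.Reasoning.Setoid R₁.setoid

  binom²≋²0 : ∀ i j → i < suc n → j < suc n → suc n ≤ i ℕ.+ j → B₂.binom (i ℕ.+ j) i * B₂.binom (i ℕ.+ j) i ≋² 0#
  binom²≋²0 i j i<n j<n n≤i+j = ≡.subst (λ b → b * b ≋² 0#)
    (≡.trans (M.binom-transfer q (i ℕ.+ j) i) (≡.sym (M².binom-transfer q (i ℕ.+ j) i)))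
    (R₂.trans (M².≈⇒≋ (solve 1 (λ b → b :* b := (b :- con (+ 0)) :* (b :- con (+ 0))) R.refl _))
      (square-congruence R m (binom≋0 i j i<n j<n n≤i+j)))

  square-zero : (p ^₂ suc n - 1#) * (p ^₂ suc n - 1#) ≋² 0#
  square-zero = ≡.subst (λ y → (y - 1#) * (y - 1#) ≋² 0#)
    (≡.trans (M.^-transfer p (suc n)) (≡.sym (M².^-transfer p (suc n))))
    (square-congruence R m (E₁.p^n≈1 (suc n) q^₁n≋1))

  half-integral-square : ∀ a t s h → a ℕ.+ t ≡ s ℕ.+ s → h ℕ.+ h ≡ t ℕ.* suc n →
    (1# - A₂.sign a * p ^₂ h) * (1# - A₂.sign a * p ^₂ h) ≋² 0#
  half-integral-square a t s h a+t≡2s 2h≡tn = ≡.subst (λ z → (1# - z) * (1# - z) ≋² 0#)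
    (≡.cong₂ _*_ (≡.trans (M.^-transfer (- 1#) a) (≡.sym (M².^-transfer (- 1#) a)))
                 (≡.trans (M.^-transfer p h) (≡.sym (M².^-transfer p h))))
    (square-congruence R m (R₁.sym (E₁.half-integral-power (suc n) q^₁n≋1 half-regular a t s h a+t≡2s 2h≡tn)))
    where
    half-regular : ∀ r → r ℕ.+ r ≡ suc n → ∀ x → (1# - q ^₁ r) * x ≋ 0# → x ≋ 0#
    half-regular (suc d) 2r≡n = regular₁ d (ℕ.≤-trans (ℕ.m≤n+m (suc d) d) (ℕ.≤-reflexive (ℕ.suc-injective 2r≡n)))

  doubleSum : Carrier
  doubleSum = S.Sum (suc n) (λ i → S.Sum (suc n)
    (λ j → q ^ (j ℕ.* j ℕ.+ i ℕ.+ j) * (B.binom (i ℕ.+ j) i * B.binom (i ℕ.+ j) i)))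

  doubleSum≋²alternating : doubleSum ≋² (1# + 1#) * A₂.alternating n + - 1# * A₂.alternating (n ℕ.+ suc n)
  doubleSum≋²alternating = ≡.subst (_≋² ((1# + 1#) * A₂.alternating n + - 1# * A₂.alternating (n ℕ.+ suc n)))
    (M².Sum-transfer (suc n) (λ i → M².Sum-transfer (suc n) (λ j →
      ≡.cong₂ _*_ (M².^-transfer q (j ℕ.* j ℕ.+ i ℕ.+ j)) (≡.cong (λ b → b * b) (M².binom-transfer q (i ℕ.+ j) i)))))
    (R₂.trans (E₂.double-sum (suc n) binom²≋²0) (I₂.central-sum n square-zero poch-regular₂))

  doubleSum₀ : ∀ M → n ≡ 2 ℕ.+ M ℕ.* 3 → doubleSum ≋² 0#
  doubleSum₀ M ≡.refl = R₂.trans doubleSum≋²alternating (E₂.value₀ M)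

  doubleSum₁ : ∀ N → n ≡ N ℕ.* 3 → doubleSum ≋² q ^ exponent₁ N
  doubleSum₁ N ≡.refl = ≡.subst (doubleSum ≋²_) (M².^-transfer q (exponent₁ N)) (R₂.trans doubleSum≋²alternating
    -- Here t = 3N by `2*exponent₁`, and it has the parity of the sign index N: their sum is 4N.
    (E₂.value₁ N (half-integral-square N (N ℕ.* 3) (N ℕ.+ N) (exponent₁ N ℕ.+ pentagonal N) (arithmetic N)
      (2*exponent₁ N))))
    where
    arithmetic : ∀ N → N ℕ.+ N ℕ.* 3 ≡ N ℕ.+ N ℕ.+ (N ℕ.+ N)
    arithmetic = solve-∀

  doubleSum₂ : ∀ N → n ≡ 1 ℕ.+ N ℕ.* 3 → doubleSum ≋² - q ^ exponent₂ N
  doubleSum₂ N ≡.refl = ≡.subst (λ y → doubleSum ≋² - y) (M².^-transfer q (exponent₂ N))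
    (R₂.trans doubleSum≋²alternating
    (E₂.value₂ N (half-integral-square (suc N) (suc (N ℕ.* 3)) (suc (N ℕ.+ N)) (exponent₂ N ℕ.+ pentagonal′ N)
      (arithmetic N) (2*exponent₂ N))))
    where
    arithmetic : ∀ N → suc N ℕ.+ suc (N ℕ.* 3) ≡ suc (N ℕ.+ N) ℕ.+ suc (N ℕ.+ N)
    arithmetic = solve-∀

-- The ring ℤ[q]

coef : Poly → ℕ → ℤ
coef [] i = + 0
coef (a ∷ p) zero = a
coef (a ∷ p) (suc i) = coef p i

infix 4 _≈_

-- Comparing all coefficients identifies lists that differ by trailing zeros. Being a record, the
-- relation lets its two polynomials be inferred.
record _≈_ (p r : Poly) : Set where
  constructor equal
  field coefs : ∀ i → coef p i ≡ coef r i

open _≈_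

≈-refl : ∀ {p} → p ≈ p
≈-refl = equal λ i → ≡.refl

≈-sym : ∀ {p r} → p ≈ r → r ≈ p
≈-sym p≈r = equal λ i → ≡.sym (coefs p≈r i)

≈-trans : ∀ {p r s} → p ≈ r → r ≈ s → p ≈ s
≈-trans p≈r r≈s = equal λ i → ≡.trans (coefs p≈r i) (coefs r≈s i)

≈-isEquivalence : IsEquivalence _≈_
≈-isEquivalence = record { refl = ≈-refl ; sym = ≈-sym ; trans = ≈-trans }

∷-cong : ∀ {a b p r} → a ≡ b → p ≈ r → a ∷ p ≈ b ∷ r
∷-cong a≡b p≈r = equal λ { zero → a≡b ; (suc i) → coefs p≈r i }

coef-⊕ : ∀ p r i → coef (p ⊕ r) i ≡ coef p i ℤ.+ coef r i
coef-⊕ [] r i = ≡.sym (ℤ.+-identityˡ _)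
coef-⊕ (a ∷ p) [] i = ≡.sym (ℤ.+-identityʳ _)
coef-⊕ (a ∷ p) (b ∷ r) zero = ≡.refl
coef-⊕ (a ∷ p) (b ∷ r) (suc i) = coef-⊕ p r i

coef-scale : ∀ c p i → coef (scale c p) i ≡ c ℤ.* coef p i
coef-scale c [] i = ≡.sym (ℤ.*-zeroʳ c)
coef-scale c (a ∷ p) zero = ≡.refl
coef-scale c (a ∷ p) (suc i) = coef-scale c p i

coef-negP : ∀ p i → coef (negP p) i ≡ ℤ.- coef p i
coef-negP [] i = ≡.refl
coef-negP (a ∷ p) zero = ≡.refl
coef-negP (a ∷ p) (suc i) = coef-negP p i

coef-∷⊛ : ∀ a p r i → coef ((a ∷ p) ⊛ r) i ≡ a ℤ.* coef r i ℤ.+ coef (+ 0 ∷ p ⊛ r) i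
coef-∷⊛ a p r i = ≡.trans (coef-⊕ (scale a r) _ i) (≡.cong (ℤ._+ _) (coef-scale a r i))

⊕-cong : ∀ {p p′ r r′} → p ≈ p′ → r ≈ r′ → p ⊕ r ≈ p′ ⊕ r′
⊕-cong {p} {p′} {r} {r′} p≈ r≈ = equal λ i →
  ≡.trans (coef-⊕ p r i) (≡.trans (≡.cong₂ ℤ._+_ (coefs p≈ i) (coefs r≈ i)) (≡.sym (coef-⊕ p′ r′ i)))

⊕-congˡ : ∀ p {r r′} → r ≈ r′ → p ⊕ r ≈ p ⊕ r′
⊕-congˡ p r≈ = ⊕-cong (≈-refl {p}) r≈

⊕-congʳ : ∀ r {p p′} → p ≈ p′ → p ⊕ r ≈ p′ ⊕ r
⊕-congʳ r p≈ = ⊕-cong p≈ (≈-refl {r})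

scale-cong : ∀ c {p p′} → p ≈ p′ → scale c p ≈ scale c p′
scale-cong c {p} {p′} p≈ = equal λ i →
  ≡.trans (coef-scale c p i) (≡.trans (≡.cong (c ℤ.*_) (coefs p≈ i)) (≡.sym (coef-scale c p′ i)))

negP-cong : ∀ {p p′} → p ≈ p′ → negP p ≈ negP p′
negP-cong {p} {p′} p≈ = equal λ i →
  ≡.trans (coef-negP p i) (≡.trans (≡.cong ℤ.-_ (coefs p≈ i)) (≡.sym (coef-negP p′ i)))

⊛-congˡ : ∀ p {r r′} → r ≈ r′ → p ⊛ r ≈ p ⊛ r′
⊛-congˡ [] r≈ = ≈-refl
⊛-congˡ (a ∷ p) r≈ = ⊕-cong (scale-cong a r≈) (∷-cong ≡.refl (⊛-congˡ p r≈))

⊛-zeroʳ : ∀ p → p ⊛ [] ≈ []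
⊛-zeroʳ [] = ≈-refl
⊛-zeroʳ (a ∷ p) = equal λ { zero → ≡.refl ; (suc i) → coefs (⊛-zeroʳ p) i }

-- The mirror image of the defining recursion of `⊛`, now in the second factor; commutativity is
-- then a direct induction.
⊛-∷ : ∀ p b r → p ⊛ (b ∷ r) ≈ scale b p ⊕ (+ 0 ∷ p ⊛ r)
⊛-∷ [] b r = equal λ { zero → ≡.refl ; (suc i) → ≡.refl }
⊛-∷ (a ∷ p) b r = equal λ
  { zero → ≡.cong (ℤ._+ + 0) (ℤ.*-comm a b)
  ; (suc i) → begin
      coef (scale a r ⊕ p ⊛ (b ∷ r)) i
        ≡⟨ coef-⊕ (scale a r) _ i ⟩
      coef (scale a r) i ℤ.+ coef (p ⊛ (b ∷ r)) i
        ≡⟨ ≡.cong (ℤ._+_ (coef (scale a r) i)) (≡.trans (coefs (⊛-∷ p b r) i) (coef-⊕ (scale b p) _ i)) ⟩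
      coef (scale a r) i ℤ.+ (coef (scale b p) i ℤ.+ coef (+ 0 ∷ p ⊛ r) i)
        ≡⟨ arithmetic (coef (scale a r) i) (coef (scale b p) i) _ ⟩
      coef (scale b p) i ℤ.+ (coef (scale a r) i ℤ.+ coef (+ 0 ∷ p ⊛ r) i)
        ≡⟨ ≡.cong (ℤ._+_ (coef (scale b p) i)) (coef-⊕ (scale a r) _ i) ⟨
      coef (scale b p) i ℤ.+ coef ((a ∷ p) ⊛ r) i
        ≡⟨ coef-⊕ (scale b p) _ i ⟨
      coef (scale b p ⊕ (a ∷ p) ⊛ r) i ∎ }
  where
  open ≡.≡-Reasoning
  arithmetic : ∀ x y z → x ℤ.+ (y ℤ.+ z) ≡ y ℤ.+ (x ℤ.+ z)
  arithmetic = ℤ-Solver.solve-∀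

⊛-comm : ∀ p r → p ⊛ r ≈ r ⊛ p
⊛-comm [] r = ≈-sym (⊛-zeroʳ r)
⊛-comm (a ∷ p) r = ≈-trans (⊕-cong (≈-refl {scale a r}) (∷-cong ≡.refl (⊛-comm p r))) (≈-sym (⊛-∷ r a p))

⊛-cong : ∀ {p p′ r r′} → p ≈ p′ → r ≈ r′ → p ⊛ r ≈ p′ ⊛ r′
⊛-cong {p} {p′} {r} {r′} p≈ r≈ =
  ≈-trans (⊛-congˡ p r≈) (≈-trans (⊛-comm p r′) (≈-trans (⊛-congˡ r′ p≈) (⊛-comm r′ p′)))

⊛-congʳ : ∀ r {p p′} → p ≈ p′ → p ⊛ r ≈ p′ ⊛ r
⊛-congʳ r p≈ = ⊛-cong p≈ (≈-refl {r})

⊕-comm : ∀ p r → p ⊕ r ≈ r ⊕ p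
⊕-comm p r = equal λ i → ≡.trans (coef-⊕ p r i) (≡.trans (ℤ.+-comm (coef p i) _) (≡.sym (coef-⊕ r p i)))

⊕-assoc : ∀ p r s → (p ⊕ r) ⊕ s ≈ p ⊕ (r ⊕ s)
⊕-assoc p r s = equal λ i → begin
  coef ((p ⊕ r) ⊕ s) i                       
    ≡⟨ ≡.trans (coef-⊕ (p ⊕ r) s i) (≡.cong (ℤ._+ coef s i) (coef-⊕ p r i)) ⟩
  (coef p i ℤ.+ coef r i) ℤ.+ coef s i        ≡⟨ ℤ.+-assoc (coef p i) (coef r i) (coef s i) ⟩
  coef p i ℤ.+ (coef r i ℤ.+ coef s i)       
    ≡⟨ ≡.trans (coef-⊕ p (r ⊕ s) i) (≡.cong (ℤ._+_ (coef p i)) (coef-⊕ r s i)) ⟨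
  coef (p ⊕ (r ⊕ s)) i                        ∎
  where open ≡.≡-Reasoning

⊕-identityʳ : ∀ p → p ⊕ [] ≈ p
⊕-identityʳ p = ⊕-comm p []

⊕-inverseʳ : ∀ p → p ⊕ negP p ≈ []
⊕-inverseʳ p = equal λ i →
  ≡.trans (coef-⊕ p (negP p) i) (≡.trans (≡.cong (ℤ._+_ (coef p i)) (coef-negP p i)) (ℤ.+-inverseʳ (coef p i)))

⊕-swap : ∀ x y z w → (x ⊕ y) ⊕ (z ⊕ w) ≈ (x ⊕ z) ⊕ (y ⊕ w)
⊕-swap x y z w = equal λ i → begin
  coef ((x ⊕ y) ⊕ (z ⊕ w)) i     ≡⟨ expand x y z w i ⟩
  (coef x i ℤ.+ coef y i) ℤ.+ (coef z i ℤ.+ coef w i)  ≡⟨ arithmetic (coef x i) (coef y i) (coef z i) (coef w i) ⟩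
  (coef x i ℤ.+ coef z i) ℤ.+ (coef y i ℤ.+ coef w i)  ≡⟨ expand x z y w i ⟨
  coef ((x ⊕ z) ⊕ (y ⊕ w)) i     ∎
  where
  open ≡.≡-Reasoning
  expand : ∀ x y z w i → coef ((x ⊕ y) ⊕ (z ⊕ w)) i ≡ (coef x i ℤ.+ coef y i) ℤ.+ (coef z i ℤ.+ coef w i)
  expand x y z w i = ≡.trans (coef-⊕ (x ⊕ y) (z ⊕ w) i) (≡.cong₂ ℤ._+_ (coef-⊕ x y i) (coef-⊕ z w i))
  arithmetic : ∀ x y z w → (x ℤ.+ y) ℤ.+ (z ℤ.+ w) ≡ (x ℤ.+ z) ℤ.+ (y ℤ.+ w)
  arithmetic = ℤ-Solver.solve-∀

scale-⊕ : ∀ c p r → scale c (p ⊕ r) ≈ scale c p ⊕ scale c r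
scale-⊕ c p r = equal λ i → begin
  coef (scale c (p ⊕ r)) i                  ≡⟨ ≡.trans (coef-scale c (p ⊕ r) i) (≡.cong (c ℤ.*_) (coef-⊕ p r i)) ⟩
  c ℤ.* (coef p i ℤ.+ coef r i)             ≡⟨ ℤ.*-distribˡ-+ c (coef p i) (coef r i) ⟩
  c ℤ.* coef p i ℤ.+ c ℤ.* coef r i         ≡⟨ ≡.cong₂ ℤ._+_ (coef-scale c p i) (coef-scale c r i) ⟨
  coef (scale c p) i ℤ.+ coef (scale c r) i ≡⟨ coef-⊕ (scale c p) (scale c r) i ⟨
  coef (scale c p ⊕ scale c r) i            ∎
  where open ≡.≡-Reasoning

scale-scale : ∀ c d p → scale (c ℤ.* d) p ≈ scale c (scale d p)
scale-scale c d p = equal λ i → begin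
  coef (scale (c ℤ.* d) p) i      ≡⟨ ≡.trans (coef-scale (c ℤ.* d) p i) (ℤ.*-assoc c d _) ⟩
  c ℤ.* (d ℤ.* coef p i)          ≡⟨ ≡.trans (coef-scale c (scale d p) i) (≡.cong (c ℤ.*_) (coef-scale d p i)) ⟨
  coef (scale c (scale d p)) i    ∎
  where open ≡.≡-Reasoning

scale-zero : ∀ p → scale (+ 0) p ≈ []
scale-zero p = equal λ i → coef-scale (+ 0) p i

scale-one : ∀ p → scale (+ 1) p ≈ p
scale-one p = equal λ i → ≡.trans (coef-scale (+ 1) p i) (ℤ.*-identityˡ _)

∷-⊕ : ∀ p r → + 0 ∷ (p ⊕ r) ≈ (+ 0 ∷ p) ⊕ (+ 0 ∷ r)
∷-⊕ p r = equal λ { zero → ≡.refl ; (suc i) → ≡.refl }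

⊛-distribˡ : ∀ p r s → p ⊛ (r ⊕ s) ≈ p ⊛ r ⊕ p ⊛ s
⊛-distribˡ [] r s = ≈-refl
⊛-distribˡ (a ∷ p) r s =
  ≈-trans (⊕-cong (scale-⊕ a r s) (≈-trans (∷-cong ≡.refl (⊛-distribˡ p r s)) (∷-⊕ (p ⊛ r) (p ⊛ s))))
    (⊕-swap (scale a r) (scale a s) (+ 0 ∷ p ⊛ r) (+ 0 ∷ p ⊛ s))

⊛-distribʳ : ∀ s p r → (p ⊕ r) ⊛ s ≈ p ⊛ s ⊕ r ⊛ s
⊛-distribʳ s p r = ≈-trans (⊛-comm (p ⊕ r) s) (≈-trans (⊛-distribˡ s p r) (⊕-cong (⊛-comm s p) (⊛-comm s r)))

0∷-⊛ : ∀ p r → (+ 0 ∷ p) ⊛ r ≈ + 0 ∷ p ⊛ r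
0∷-⊛ p r = ⊕-cong (scale-zero r) ≈-refl

scale-⊛ : ∀ c p r → scale c p ⊛ r ≈ scale c (p ⊛ r)
scale-⊛ c [] r = ≈-refl
scale-⊛ c (a ∷ p) r = ≈-trans
  (⊕-cong (scale-scale c a r) (∷-cong (≡.sym (ℤ.*-zeroʳ c)) (scale-⊛ c p r)))
  (≈-sym (scale-⊕ c (scale a r) (+ 0 ∷ p ⊛ r)))

⊛-assoc : ∀ p r s → (p ⊛ r) ⊛ s ≈ p ⊛ (r ⊛ s)
⊛-assoc [] r s = ≈-refl
⊛-assoc (a ∷ p) r s = ≈-trans (⊛-distribʳ s (scale a r) (+ 0 ∷ p ⊛ r))
  (⊕-cong (scale-⊛ a r s) (≈-trans (0∷-⊛ (p ⊛ r) s) (∷-cong ≡.refl (⊛-assoc p r s))))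

⊛-identityˡ : ∀ p → oneP ⊛ p ≈ p
⊛-identityˡ p = ≈-trans (⊕-cong (scale-one p) (equal λ { zero → ≡.refl ; (suc i) → ≡.refl })) (⊕-identityʳ p)

⊕-⊛-isCommutativeRing : IsCommutativeRing _≈_ _⊕_ _⊛_ negP [] oneP
⊕-⊛-isCommutativeRing = record
  { isRing = record
    { +-isAbelianGroup = record
      { isGroup = record
        { isMonoid = record
          { isSemigroup = record
            { isMagma = record { isEquivalence = ≈-isEquivalence ; ∙-cong = ⊕-cong }
            ; assoc = ⊕-assoc }
          ; identity = (λ p → ≈-refl) , ⊕-identityʳ }
        ; inverse = (λ p → ≈-trans (⊕-comm (negP p) p) (⊕-inverseʳ p)) , ⊕-inverseʳ
        ; ⁻¹-cong = negP-cong }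
      ; comm = ⊕-comm }
    ; *-cong = ⊛-cong
    ; *-assoc = ⊛-assoc
    ; *-identity = ⊛-identityˡ , λ p → ≈-trans (⊛-comm p oneP) (⊛-identityˡ p)
    ; distrib = ⊛-distribˡ , ⊛-distribʳ }
  ; *-comm = ⊛-comm }

polyRing : CommutativeRing 0ℓ 0ℓ
polyRing = record { isCommutativeRing = ⊕-⊛-isCommutativeRing }

infix 4 _∣_

record _∣_ (m p : Poly) : Set where
  constructor divides
  field
    quotient : Poly
    equality : p ≈ m ⊛ quotient

≈⇒IsZero : ∀ {p} → p ≈ [] → IsZero p
≈⇒IsZero {[]} p≈ = []
≈⇒IsZero {a ∷ p} p≈ = coefs p≈ 0 ∷ ≈⇒IsZero (equal λ i → coefs p≈ (suc i))

-- Exact division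

module PR = CommutativeRing polyRing
module PS = IntegerSolver polyRing
open import Relation.Binary.Reasoning.Setoid PR.setoid
open PS using (solve; _:=_; _:+_; _:*_; _:-_; :-_; con)

-- The helpers of _÷_ and Φ are private to Defs; unification recovers them as solutions of the
-- metavariables below. Abstracting reverse (in normal form, a foldl) makes its argument visible to unification.
mutual
  longDiv : ℕ → ℤ → List ℤ → List ℤ → List ℤ
  longDiv = _

  ÷-unfold : ∀ p d {u ds} → reverse (trim d) ≡ u ∷ ds →
    p ÷ d ≡ reverse (longDiv (length (reverse (trim p))) u ds (reverse (trim p)))
  ÷-unfold p d eq = generalised p d _ eq ≡.refl ≡.refl
    where
    generalised : ∀ p d {u ds pr} k → reverse (trim d) ≡ u ∷ ds → reverse (trim p) ≡ pr → length pr ≡ k →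
      p ÷ d ≡ reverse (longDiv k u ds pr)
    generalised p d _ e₁ e₂ e₃ with reverse (trim d) | e₁
    ... | u ∷ ds | ≡.refl with reverse (trim p) | e₂
    ... | pr | ≡.refl with length pr | e₃
    ... | k | ≡.refl with foldl {A = List ℤ} {B = ℤ} (λ xs x → x ∷ xs) []
    ... | rev = ≡.refl

mutual
  subMul : List ℤ → ℤ → List ℤ → List ℤ
  subMul = _

  longDiv-suc : ∀ f u ds x r {c} → u ℤ.* x ≡ c →
    longDiv (suc f) u ds (x ∷ r) ≡ (if length r <ᵇ length ds then [] else c ∷ longDiv f u ds (subMul r c ds))
  longDiv-suc f u ds x r eq with u ℤ.* x | eq
  ... | c | ≡.refl = ≡.refl

κ : ℤ → Poly
κ c = c ∷ []

scale≈κ⊛ : ∀ c p → scale c p ≈ κ c ⊛ p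
scale≈κ⊛ c p = ≈-sym (≈-trans (⊕-cong (≈-refl {scale c p}) (equal λ { zero → ≡.refl ; (suc i) → ≡.refl }))
  (⊕-identityʳ _))

κ-* : ∀ c d → κ (c ℤ.* d) ≈ κ c ⊛ κ d
κ-* c d = scale≈κ⊛ c (κ d)

mono-suc : ∀ k → mono (suc k) ≈ mono 1 ⊛ mono k
mono-suc k = ≈-sym (≈-trans (0∷-⊛ oneP (mono k)) (∷-cong ≡.refl (⊛-identityˡ (mono k))))

mono-+ : ∀ a b → mono (a ℕ.+ b) ≈ mono a ⊛ mono b
mono-+ zero b = ≈-sym (⊛-identityˡ (mono b))
mono-+ (suc a) b = ≈-trans (∷-cong ≡.refl (mono-+ a b)) (≈-sym (0∷-⊛ (mono a) (mono b)))

snoc : ∀ xs v → xs ++ v ∷ [] ≈ xs ⊕ scale v (mono (length xs))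
snoc [] v = ∷-cong (≡.sym (ℤ.*-identityʳ v)) ≈-refl
snoc (a ∷ xs) v = ∷-cong (≡.sym (≡.trans (≡.cong (ℤ._+_ a) (ℤ.*-zeroʳ v)) (ℤ.+-identityʳ a))) (snoc xs v)

reverse-∷ : ∀ x r → reverse (x ∷ r) ≈ reverse r ⊕ κ x ⊛ mono (length r)
reverse-∷ x r = ≈-trans (PR.reflexive (unfold-reverse x r)) (≈-trans (snoc (reverse r) x)
  (⊕-congˡ (reverse r) (≈-trans (scale≈κ⊛ x _) (PR.reflexive (≡.cong (λ n → κ x ⊛ mono n) (length-reverse r))))))

length-subMul : ∀ r c ds → length (subMul r c ds) ≡ length r
length-subMul [] c [] = ≡.refl
length-subMul [] c (y ∷ ds) = ≡.refl
length-subMul (x ∷ r) c [] = ≡.refl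
length-subMul (x ∷ r) c (y ∷ ds) = ≡.cong suc (length-subMul r c ds)

subMul-nil : ∀ r c → subMul r c [] ≡ r
subMul-nil [] c = ≡.refl
subMul-nil (x ∷ r) c = ≡.refl

-- The lists have the highest degree first, so aligning their heads multiplies `ds` by q to the
-- difference of the lengths.
reverse-subMul : ∀ r c ds → length ds ≤ length r →
  reverse (subMul r c ds) ≈ reverse r ⊖ κ c ⊛ (reverse ds ⊛ mono (length r ∸ length ds))
reverse-subMul r c [] _ = ≈-trans (PR.reflexive (≡.cong reverse (subMul-nil r c)))
  (≈-sym (≈-trans (⊕-congˡ (reverse r) (negP-cong (⊛-zeroʳ (κ c)))) (⊕-identityʳ _)))
reverse-subMul (x ∷ r) c (y ∷ ds) (s≤s ds≤r) = begin
  reverse (x ℤ.- c ℤ.* y ∷ subMul r c ds)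
    ≈⟨ reverse-∷ _ (subMul r c ds) ⟩
  reverse (subMul r c ds) ⊕ κ (x ℤ.- c ℤ.* y) ⊛ mono (length (subMul r c ds))
    ≈⟨ ⊕-cong (reverse-subMul r c ds ds≤r) (⊛-cong (⊕-congˡ (κ x) (negP-cong (κ-* c y)))
         (PR.reflexive (≡.cong mono (≡.trans (length-subMul r c ds) (≡.sym (ℕ.m+[n∸m]≡n ds≤r)))))) ⟩
  (reverse r ⊖ κ c ⊛ (reverse ds ⊛ m)) ⊕ (κ x ⊖ κ c ⊛ κ y) ⊛ mono (length ds ℕ.+ (length r ∸ length ds))
    ≈⟨ ⊕-congˡ (reverse r ⊖ κ c ⊛ (reverse ds ⊛ m))
      (⊛-congˡ (κ x ⊖ κ c ⊛ κ y) (mono-+ (length ds) (length r ∸ length ds))) ⟩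
  (reverse r ⊖ κ c ⊛ (reverse ds ⊛ m)) ⊕ (κ x ⊖ κ c ⊛ κ y) ⊛ (mono (length ds) ⊛ m)
    ≈⟨ solve 7 (λ r c d m x y l → (r :- c :* (d :* m)) :+ (x :- c :* y) :* (l :* m)
         := (r :+ x :* (l :* m)) :- c :* ((d :+ y :* l) :* m)) ≈-refl (reverse r) (κ c) (reverse ds) m (κ x)
           (κ y) (mono (length ds)) ⟩
  (reverse r ⊕ κ x ⊛ (mono (length ds) ⊛ m)) ⊖ κ c ⊛ ((reverse ds ⊕ κ y ⊛ mono (length ds)) ⊛ m)
    ≈⟨ ⊕-cong (⊕-congˡ (reverse r) (⊛-congˡ (κ x)
      (≈-trans (≈-sym (mono-+ (length ds) (length r ∸ length ds))) (PR.reflexive (≡.cong mono (ℕ.m+[n∸m]≡n ds≤r))))))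
         (negP-cong (⊛-congˡ (κ c) (⊛-congʳ m (≈-sym (reverse-∷ y ds))))) ⟩
  (reverse r ⊕ κ x ⊛ mono (length r)) ⊖ κ c ⊛ (reverse (y ∷ ds) ⊛ m)
    ≈⟨ ⊕-congʳ (negP (κ c ⊛ (reverse (y ∷ ds) ⊛ m))) (≈-sym (reverse-∷ x r)) ⟩
  reverse (x ∷ r) ⊖ κ c ⊛ (reverse (y ∷ ds) ⊛ m) ∎
  where
  m : Poly
  m = mono (length r ∸ length ds)

-- The list `ds` omits the leading coefficient u, so its length is the degree of the divisor. The
-- length of Q belongs to the induction hypothesis because it fixes the degree at which the next
-- quotient digit stands.
record Division (u : ℤ) (ds P Q : List ℤ) : Set where
  field
    remainder : List ℤ
    remainder-short : length remainder ≤ length ds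
    quotient-length : length Q ≡ length P ∸ length ds
    division : reverse P ≈ reverse (u ∷ ds) ⊛ reverse Q ⊕ reverse remainder

-- The digit c = u x satisfies u c = x because u is its own inverse, so every step removes the
-- leading term exactly. The bound on the length says that the fuel f suffices.
longDiv-correct : ∀ u → u ℤ.* u ≡ + 1 → ∀ f ds P → length P ≤ f → Division u ds P (longDiv f u ds P)
longDiv-correct u u²≡1 zero ds [] _ = record
  { remainder = [] ; remainder-short = z≤n ; quotient-length = ≡.sym (ℕ.0∸n≡0 (length ds))
  ; division = ≈-sym (≈-trans (⊕-identityʳ _) (⊛-zeroʳ (reverse (u ∷ ds)))) }
longDiv-correct u u²≡1 (suc f) ds [] _ = record
  { remainder = [] ; remainder-short = z≤n ; quotient-length = ≡.sym (ℕ.0∸n≡0 (length ds))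
  ; division = ≈-sym (≈-trans (⊕-identityʳ _) (⊛-zeroʳ (reverse (u ∷ ds)))) }
longDiv-correct u u²≡1 (suc f) ds (x ∷ r) (s≤s r≤f) = ≡.subst (Division u ds (x ∷ r))
  (≡.sym (longDiv-suc f u ds x r ≡.refl)) cases
  where
  c : ℤ
  c = u ℤ.* x
  uc≡x : u ℤ.* c ≡ x
  uc≡x = ≡.trans (≡.sym (ℤ.*-assoc u u x)) (≡.trans (≡.cong (ℤ._* x) u²≡1) (ℤ.*-identityˡ x))
  cases : Division u ds (x ∷ r) (if length r <ᵇ length ds then [] else c ∷ longDiv f u ds (subMul r c ds))
  cases with length r <ᵇ length ds in eq
  ... | true = record
    { remainder = x ∷ r ; remainder-short = r<ds ; quotient-length = ≡.sym (ℕ.m≤n⇒m∸n≡0 r<ds)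
    ; division = ≈-sym (⊕-congʳ (reverse (x ∷ r)) (⊛-zeroʳ (reverse (u ∷ ds)))) }
    where
    r<ds : length r < length ds
    r<ds = ℕ.<ᵇ⇒< _ _ (≡.subst T (≡.sym eq) _)
  ... | false = record
    { remainder = R ; remainder-short = D.remainder-short
    ; quotient-length = ≡.trans (≡.cong suc |Q|) (≡.sym (ℕ.+-∸-assoc 1 ds≤r))
    ; division = begin
        reverse (x ∷ r)
          ≈⟨ reverse-∷ x r ⟩
        reverse r ⊕ κ x ⊛ mono (length r)
          ≈⟨ ⊕-cong (solve 2 (λ r s → r := (r :- s) :+ s) ≈-refl (reverse r) (κ c ⊛ (reverse ds ⊛ m)))
            (⊛-cong (≈-trans (PR.reflexive (≡.cong κ (≡.sym uc≡x))) (κ-* u c))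
               (≈-trans (PR.reflexive (≡.cong mono (≡.sym (ℕ.m+[n∸m]≡n ds≤r))))
                 (mono-+ (length ds) (length r ∸ length ds)))) ⟩
        ((reverse r ⊖ κ c ⊛ (reverse ds ⊛ m)) ⊕ κ c ⊛ (reverse ds ⊛ m)) ⊕ (κ u ⊛ κ c) ⊛ (mono (length ds) ⊛ m)
          ≈⟨ ⊕-congʳ ((κ u ⊛ κ c) ⊛ (mono (length ds) ⊛ m))
            (⊕-congʳ (κ c ⊛ (reverse ds ⊛ m)) (≈-trans (≈-sym (reverse-subMul r c ds ds≤r)) D.division)) ⟩
        ((reverse (u ∷ ds) ⊛ reverse Q ⊕ reverse R) ⊕ κ c ⊛ (reverse ds ⊛ m)) ⊕ (κ u ⊛ κ c) ⊛ (mono (length ds) ⊛ m)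
          ≈⟨ solve 8 (λ d q r c e m u l → ((d :* q :+ r) :+ c :* (e :* m)) :+ (u :* c) :* (l :* m)
               := (d :* q :+ (e :+ u :* l) :* (c :* m)) :+ r) ≈-refl (reverse (u ∷ ds)) (reverse Q) (reverse R)
                 (κ c) (reverse ds) m (κ u) (mono (length ds)) ⟩
        (reverse (u ∷ ds) ⊛ reverse Q ⊕ (reverse ds ⊕ κ u ⊛ mono (length ds)) ⊛ (κ c ⊛ m)) ⊕ reverse R
          ≈⟨ ⊕-congʳ (reverse R) (⊕-congˡ (reverse (u ∷ ds) ⊛ reverse Q)
            (⊛-congʳ (κ c ⊛ m) (≈-sym (reverse-∷ u ds)))) ⟩
        (reverse (u ∷ ds) ⊛ reverse Q ⊕ reverse (u ∷ ds) ⊛ (κ c ⊛ m)) ⊕ reverse R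
          ≈⟨ ⊕-congʳ (reverse R) (⊛-distribˡ (reverse (u ∷ ds)) (reverse Q) (κ c ⊛ m)) ⟨
        reverse (u ∷ ds) ⊛ (reverse Q ⊕ κ c ⊛ m) ⊕ reverse R
          ≈⟨ ⊕-congʳ (reverse R) (⊛-congˡ (reverse (u ∷ ds))
            (⊕-congˡ (reverse Q) (⊛-congˡ (κ c) (PR.reflexive (≡.cong mono (≡.sym |Q|)))))) ⟩
        reverse (u ∷ ds) ⊛ (reverse Q ⊕ κ c ⊛ mono (length Q)) ⊕ reverse R
          ≈⟨ ⊕-congʳ (reverse R) (⊛-congˡ (reverse (u ∷ ds)) (reverse-∷ c Q)) ⟨
        reverse (u ∷ ds) ⊛ reverse (c ∷ Q) ⊕ reverse R ∎ }
    where
    ds≤r : length ds ≤ length r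
    ds≤r = ℕ.≮⇒≥ λ r<ds → ≡.subst T eq (ℕ.<⇒<ᵇ r<ds)
    module D = Division (longDiv-correct u u²≡1 f ds (subMul r c ds)
      (≡.subst (_≤ f) (≡.sym (length-subMul r c ds)) r≤f))
    Q R : List ℤ
    Q = longDiv f u ds (subMul r c ds)
    R = D.remainder
    |Q| : length Q ≡ length r ∸ length ds
    |Q| = ≡.trans D.quotient-length (≡.cong (_∸ length ds) (length-subMul r c ds))
    m : Poly
    m = mono (length r ∸ length ds)

-- Leading coefficients and exact quotients

-- The value u may be zero, and then M merely bounds the degree; for this reason `Lead-unique` asks
-- for nonzero values.
record Lead (p : Poly) (M : ℕ) (u : ℤ) : Set where
  field
    top : coef p M ≡ u
    above : ∀ i → M < i → coef p i ≡ + 0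

open Lead

coef-above : ∀ p {i} → length p ≤ i → coef p i ≡ + 0
coef-above [] _ = ≡.refl
coef-above (a ∷ p) (s≤s p≤i) = coef-above p p≤i

coef-snoc : ∀ xs v → coef (xs ++ v ∷ []) (length xs) ≡ v
coef-snoc [] v = ≡.refl
coef-snoc (x ∷ xs) v = coef-snoc xs v

Lead-reverse : ∀ u ds → Lead (reverse (u ∷ ds)) (length ds) u
Lead-reverse u ds = record
  { top = ≡.trans (≡.cong₂ coef (unfold-reverse u ds) (≡.sym (length-reverse ds))) (coef-snoc (reverse ds) u)
  ; above = λ i ds<i → coef-above (reverse (u ∷ ds)) (≡.subst (_≤ i) (≡.sym (length-reverse (u ∷ ds))) ds<i) }

Lead-≈ : ∀ {p r M u} → p ≈ r → Lead p M u → Lead r M u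
Lead-≈ p≈r lead = record
  { top = ≡.trans (≡.sym (coefs p≈r _)) (top lead) ; above = λ i M<i → ≡.trans (≡.sym (coefs p≈r i))
    (above lead i M<i) }

Lead-unique : ∀ {p M N u v} → Lead p M u → Lead p N v → u ≢ + 0 → v ≢ + 0 → u ≡ v
Lead-unique {M = M} {N} lead lead′ u≢0 v≢0 with ℕ.<-cmp M N
... | tri< M<N _ _ = contradiction (≡.trans (≡.sym (top lead′)) (above lead _ M<N)) v≢0
... | tri≈ _ ≡.refl _ = ≡.trans (≡.sym (top lead)) (top lead′)
... | tri> _ _ N<M = contradiction (≡.trans (≡.sym (top lead)) (above lead′ _ N<M)) u≢0

Lead-⊛ : ∀ {p r M N u v} → Lead p M u → Lead r N v → Lead (p ⊛ r) (M ℕ.+ N) (u ℤ.* v)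
Lead-⊛ {[]} lead lead′ = record
  { top = ≡.cong (ℤ._* _) (top lead) ; above = λ i _ → ≡.refl }
Lead-⊛ {a ∷ p} {r} {zero} {N} {u} {v} lead lead′ = Lead-≈ {scale a r} (equal pr) record
  { top = ≡.trans (coef-scale a r N) (≡.cong₂ ℤ._*_ (top lead) (top lead′))
  ; above = λ i N<i → ≡.trans (coef-scale a r i) (≡.trans (≡.cong (a ℤ.*_) (above lead′ i N<i)) (ℤ.*-zeroʳ a)) }
  where
  p≈0 : p ≈ []
  p≈0 = equal λ i → above lead (suc i) (s≤s z≤n)
  pr : ∀ i → coef (scale a r) i ≡ coef ((a ∷ p) ⊛ r) i
  pr i = ≡.sym (≡.trans (coefs (⊕-congˡ (scale a r)
    (≈-trans (∷-cong ≡.refl (⊛-congʳ r p≈0)) (equal λ { zero → ≡.refl ; (suc i) → ≡.refl }))) i)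
    (coefs (⊕-identityʳ (scale a r)) i))
Lead-⊛ {a ∷ p} {r} {suc M} {N} lead lead′ = record
  { top = ≡.trans (coef-⊕ (scale a r) _ (suc M ℕ.+ N))
    (≡.trans (≡.cong₂ ℤ._+_ (low _ (s≤s (ℕ.m≤n+m N M))) (top rec)) (ℤ.+-identityˡ _))
  ; above = λ { (suc i) (s≤s M+N<i) → ≡.trans (coef-⊕ (scale a r) _ (suc i))
      (≡.cong₂ ℤ._+_ (low (suc i) (s≤s (ℕ.≤-trans (ℕ.m≤n+m N M) (ℕ.<⇒≤ M+N<i)))) (above rec i M+N<i)) } }
  where
  rec : Lead (p ⊛ r) (M ℕ.+ N) _
  rec = Lead-⊛ {p} {r} record { top = top lead ; above = λ i M<i → above lead (suc i) (s≤s M<i) } lead′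
  low : ∀ i → N < i → coef (scale a r) i ≡ + 0
  low i N<i = ≡.trans (coef-scale a r i) (≡.trans (≡.cong (a ℤ.*_) (above lead′ i N<i)) (ℤ.*-zeroʳ a))

unit≢0 : ∀ {u} → u ℤ.* u ≡ + 1 → u ≢ + 0
unit≢0 () ≡.refl

-- Division by a polynomial with unit leading coefficient has a unique remainder, so an exact quotient is recovered.
Lead-cancel : ∀ {d M u} → Lead d M u → u ≢ + 0 → ∀ h → (∀ i → M ≤ i → coef (d ⊛ h) i ≡ + 0) → h ≈ []
Lead-cancel lead u≢0 [] low = ≈-refl
Lead-cancel {d} {M} {u} lead u≢0 (b ∷ h) low = equal λ { zero → b≡0 ; (suc i) → coefs h≈0 i }
  where
  product : ∀ i → coef (d ⊛ (b ∷ h)) i ≡ b ℤ.* coef d i ℤ.+ coef (+ 0 ∷ d ⊛ h) i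
  product i = ≡.trans (coefs (⊛-∷ d b h) i) (≡.trans (coef-⊕ (scale b d) _ i) (≡.cong (ℤ._+ _) (coef-scale b d i)))
  -- The tail comes first: in degrees above M the head b contributes nothing. Once the tail is zero,
  -- the coefficient at M is b u.
  h≈0 : h ≈ []
  h≈0 = Lead-cancel lead u≢0 h λ i M≤i → ≡.trans
    (≡.sym (≡.trans (product (suc i)) (≡.trans
      (≡.cong (ℤ._+ _) (≡.trans (≡.cong (b ℤ.*_) (above lead (suc i) (s≤s M≤i))) (ℤ.*-zeroʳ b)))
      (ℤ.+-identityˡ _))))
    (low (suc i) (ℕ.m≤n⇒m≤1+n M≤i))
  rest≡0 : ∀ i → coef (+ 0 ∷ d ⊛ h) i ≡ + 0
  rest≡0 zero = ≡.refl
  rest≡0 (suc i) = coefs (≈-trans (⊛-congˡ d h≈0) (⊛-zeroʳ d)) i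
  b*u≡0 : b ℤ.* u ≡ + 0
  b*u≡0 = ≡.trans (≡.cong (b ℤ.*_) (≡.sym (top lead))) (≡.trans (≡.sym (ℤ.+-identityʳ _))
    (≡.trans (≡.cong (ℤ._+_ (b ℤ.* coef d M)) (≡.sym (rest≡0 M))) (≡.trans (≡.sym (product M)) (low M ℕ.≤-refl))))
  b≡0 : b ≡ + 0
  b≡0 with ℤ.i*j≡0⇒i≡0∨j≡0 b b*u≡0
  ... | inj₁ b≡0 = b≡0
  ... | inj₂ u≡0 = contradiction u≡0 u≢0

data Trimmed : Poly → Set where
  empty : Trimmed []
  nonzero-last : ∀ xs v → v ≢ + 0 → Trimmed (xs ++ v ∷ [])

trim-≈ : ∀ p → trim p ≈ p
trim-≈ [] = ≈-refl
trim-≈ (a ∷ p) with trim p | trim-≈ p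
trim-≈ (+ zero ∷ p) | [] | eq = equal λ { zero → ≡.refl ; (suc i) → coefs eq i }
trim-≈ (+ suc n ∷ p) | [] | eq = ∷-cong ≡.refl eq
trim-≈ (-[1+ n ] ∷ p) | [] | eq = ∷-cong ≡.refl eq
trim-≈ (+ zero ∷ p) | b ∷ r | eq = ∷-cong ≡.refl eq
trim-≈ (+ suc n ∷ p) | b ∷ r | eq = ∷-cong ≡.refl eq
trim-≈ (-[1+ n ] ∷ p) | b ∷ r | eq = ∷-cong ≡.refl eq

trimmed : ∀ p → Trimmed (trim p)
trimmed [] = empty
trimmed (a ∷ p) with trim p | trimmed p
trimmed (+ zero ∷ p) | .[] | empty = empty
trimmed (+ suc n ∷ p) | .[] | empty = nonzero-last [] (+ suc n) λ ()
trimmed (-[1+ n ] ∷ p) | .[] | empty = nonzero-last [] -[1+ n ] λ ()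
trimmed (+ zero ∷ p) | .([] ++ v ∷ []) | nonzero-last [] v v≢0 = nonzero-last (+ 0 ∷ []) v v≢0
trimmed (+ zero ∷ p) | .((x ∷ xs) ++ v ∷ []) | nonzero-last (x ∷ xs) v v≢0 = nonzero-last (+ 0 ∷ x ∷ xs) v v≢0
trimmed (+ suc n ∷ p) | .(xs ++ v ∷ []) | nonzero-last xs v v≢0 = nonzero-last (+ suc n ∷ xs) v v≢0
trimmed (-[1+ n ] ∷ p) | .(xs ++ v ∷ []) | nonzero-last xs v v≢0 = nonzero-last (-[1+ n ] ∷ xs) v v≢0

leading-form : ∀ p → p ≈ [] ⊎ (Σ ℤ λ v → Σ (List ℤ) λ ds → v ≢ + 0 × reverse (trim p) ≡ v ∷ ds × Lead p (length ds) v)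
leading-form p with trim p | trimmed p | trim-≈ p
... | .[] | empty | eq = inj₁ (≈-sym eq)
... | .(xs ++ v ∷ []) | nonzero-last xs v v≢0 | eq = inj₂
  (v , reverse xs , v≢0 , shape , Lead-≈ (≈-trans (PR.reflexive back) eq) (Lead-reverse v (reverse xs)))
  where
  shape : reverse (xs ++ v ∷ []) ≡ v ∷ reverse xs
  shape = reverse-++ xs (v ∷ [])
  back : reverse (v ∷ reverse xs) ≡ xs ++ v ∷ []
  back = ≡.trans (≡.cong reverse (≡.sym shape)) (reverse-involutive _)

record Monic± (p : Poly) : Set where
  field
    degree : ℕ
    unit : ℤ
    unit² : unit ℤ.* unit ≡ + 1
    lead : Lead p degree unit

÷-exact : ∀ {p d g} → Monic± d → p ≈ d ⊛ g → p ÷ d ≈ g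
÷-exact {p} {d} {g} monic p≈dg with leading-form d
... | inj₁ d≈0 = contradiction (≡.trans (≡.sym (top lead)) (coefs d≈0 degree)) (unit≢0 unit²)
  where open Monic± monic
... | inj₂ (u , ds , u≢0 , shape , lead-u) = ≈-sym
  (≈-trans (solve 2 (λ g Q → g := (g :- Q) :+ Q) ≈-refl g (p ÷ d)) (⊕-congʳ (p ÷ d) g-Q≈0))
  where
  open Monic± monic
  u≡unit : u ≡ unit
  u≡unit = Lead-unique lead-u lead u≢0 (unit≢0 unit²)
  pr : List ℤ
  pr = reverse (trim p)
  module D = Division (longDiv-correct u (≡.subst (λ u → u ℤ.* u ≡ + 1) (≡.sym u≡unit) unit²) (length pr) ds pr
    ℕ.≤-refl)
  d≈ : reverse (u ∷ ds) ≈ d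
  d≈ = ≈-trans (PR.reflexive (≡.trans (≡.cong reverse (≡.sym shape)) (reverse-involutive _))) (trim-≈ d)
  division : p ≈ d ⊛ (p ÷ d) ⊕ reverse D.remainder
  division = begin
    p                    ≈⟨ trim-≈ p ⟨
    trim p               ≡⟨ reverse-involutive (trim p) ⟨
    reverse pr           ≈⟨ D.division ⟩
    _                    ≈⟨ ⊕-congʳ (reverse D.remainder) (⊛-cong d≈ (PR.reflexive (≡.sym (÷-unfold p d shape)))) ⟩
    d ⊛ (p ÷ d) ⊕ reverse D.remainder ∎
  difference : d ⊛ (g ⊖ (p ÷ d)) ≈ reverse D.remainder
  difference = begin
    d ⊛ (g ⊖ (p ÷ d))             ≈⟨ solve 3 (λ d g Q → d :* (g :- Q) := d :* g :- d :* Q) ≈-refl d g (p ÷ d) ⟩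
    d ⊛ g ⊖ d ⊛ (p ÷ d)           ≈⟨ ⊕-congʳ (negP (d ⊛ (p ÷ d))) (≈-trans (≈-sym p≈dg) division) ⟩
    (d ⊛ (p ÷ d) ⊕ reverse D.remainder) ⊖ d ⊛ (p ÷ d)
      ≈⟨ solve 2 (λ x r → (x :+ r) :- x := r) ≈-refl (d ⊛ (p ÷ d)) (reverse D.remainder) ⟩
    reverse D.remainder ∎
  g-Q≈0 : g ⊖ (p ÷ d) ≈ []
  g-Q≈0 = Lead-cancel lead-u u≢0 _ λ i ds≤i → ≡.trans (coefs difference i)
    (coef-above (reverse D.remainder) (ℕ.≤-trans
      (≡.subst (_≤ length ds) (≡.sym (length-reverse D.remainder)) D.remainder-short) ds≤i))

Monic±-⊛ : ∀ {p r} → Monic± p → Monic± r → Monic± (p ⊛ r)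
Monic±-⊛ mp mr = record
  { degree = _ ; unit = _ ; unit² = ≡.trans (arithmetic (unit mp) (unit mr))
    (≡.cong₂ ℤ._*_ (unit² mp) (unit² mr)) ; lead = Lead-⊛ (lead mp) (lead mr) }
  where
  open Monic±
  arithmetic : ∀ x y → (x ℤ.* y) ℤ.* (x ℤ.* y) ≡ (x ℤ.* x) ℤ.* (y ℤ.* y)
  arithmetic = ℤ-Solver.solve-∀

Monic±-≈ : ∀ {p r} → p ≈ r → Monic± p → Monic± r
Monic±-≈ p≈r m = record { degree = degree ; unit = unit ; unit² = unit² ; lead = Lead-≈ p≈r lead }
  where open Monic± m

Monic±-factor : ∀ {d g} → Monic± d → Monic± (d ⊛ g) → Monic± g
Monic±-factor {d} {g} md mdg with leading-form g
... | inj₁ g≈0 = contradiction (≡.trans (≡.sym (top lead))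
  (coefs (≈-trans (⊛-congˡ d g≈0) (⊛-zeroʳ d)) degree)) (unit≢0 unit²)
  where open Monic± mdg
... | inj₂ (v , ds , v≢0 , _ , lead-v) = record { degree = length ds ; unit = v ; unit² = v²≡1 ; lead = lead-v }
  where
  open Monic±
  uv≢0 : unit md ℤ.* v ≢ + 0
  uv≢0 eq with ℤ.i*j≡0⇒i≡0∨j≡0 (unit md) eq
  ... | inj₁ u≡0 = unit≢0 (unit² md) u≡0
  ... | inj₂ v≡0 = v≢0 v≡0
  uv≡ : unit md ℤ.* v ≡ unit mdg
  uv≡ = Lead-unique (Lead-⊛ (lead md) lead-v) (lead mdg) uv≢0 (unit≢0 (unit² mdg))
  arithmetic : ∀ u v → (u ℤ.* v) ℤ.* (u ℤ.* v) ≡ (u ℤ.* u) ℤ.* (v ℤ.* v)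
  arithmetic = ℤ-Solver.solve-∀
  v²≡1 : v ℤ.* v ≡ + 1
  v²≡1 = ≡.trans (≡.sym (≡.trans (≡.cong (ℤ._* (v ℤ.* v)) (unit² md)) (ℤ.*-identityˡ _)))
    (≡.trans (≡.sym (arithmetic (unit md) v)) (≡.trans (≡.cong (λ x → x ℤ.* x) uv≡) (unit² mdg)))

-- Coprimality and cyclotomic polynomials

prodP-++ : ∀ ps rs → prodP (ps ++ rs) ≈ prodP ps ⊛ prodP rs
prodP-++ [] rs = ≈-sym (⊛-identityˡ (prodP rs))
prodP-++ (p ∷ ps) rs = ≈-trans (⊛-congˡ p (prodP-++ ps rs)) (≈-sym (⊛-assoc p (prodP ps) (prodP rs)))

∣-refl : ∀ {p} → p ∣ p
∣-refl {p} = divides oneP (≈-sym (PR.*-identityʳ p))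

∣-trans : ∀ {p r s} → p ∣ r → r ∣ s → p ∣ s
∣-trans {p} (divides g r≈pg) (divides h s≈rh) = divides (g ⊛ h)
  (≈-trans s≈rh (≈-trans (⊛-congʳ h r≈pg) (⊛-assoc p g h)))

∣-⊛ʳ : ∀ {p r} s → p ∣ r → p ∣ r ⊛ s
∣-⊛ʳ s p∣r = ∣-trans p∣r (divides s ≈-refl)

∣-⊕ : ∀ {m p r} → m ∣ p → m ∣ r → m ∣ p ⊕ r
∣-⊕ {m} (divides g p≈) (divides h r≈) = divides (g ⊕ h) (≈-trans (⊕-cong p≈ r≈) (≈-sym (⊛-distribˡ m g h)))

∣-⊛ˡ : ∀ {m p} s → m ∣ p → m ∣ s ⊛ p
∣-⊛ˡ {m} {p} s (divides g p≈) = divides (g ⊛ s) (≈-trans (⊛-congˡ s p≈) (≈-trans (⊛-comm s (m ⊛ g)) (⊛-assoc m g s)))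

∣-≈ : ∀ {m p r} → p ≈ r → m ∣ p → m ∣ r
∣-≈ p≈r (divides g p≈) = divides g (≈-trans (≈-sym p≈r) p≈)

-- The constant coefficient is 1 or -1. As lists begin with the constant term, this is the end at
-- which divisibility arguments can proceed by induction on the list.
UnitConstant : Poly → Set
UnitConstant p = coef p 0 ℤ.* coef p 0 ≡ + 1

coef₀-⊛ : ∀ p r → coef (p ⊛ r) 0 ≡ coef p 0 ℤ.* coef r 0
coef₀-⊛ [] r = ≡.refl
coef₀-⊛ (a ∷ p) r = ≡.trans (coef-∷⊛ a p r 0) (ℤ.+-identityʳ _)

UnitConstant-⊛ : ∀ p r → UnitConstant p → UnitConstant r → UnitConstant (p ⊛ r)
UnitConstant-⊛ p r up ur = ≡.trans (≡.cong (λ x → x ℤ.* x) (coef₀-⊛ p r))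
  (≡.trans (arithmetic (coef p 0) (coef r 0)) (≡.cong₂ ℤ._*_ up ur))
  where
  arithmetic : ∀ x y → (x ℤ.* y) ℤ.* (x ℤ.* y) ≡ (x ℤ.* x) ℤ.* (y ℤ.* y)
  arithmetic = ℤ-Solver.solve-∀

UnitConstant-factor : ∀ p r {s} → s ≈ p ⊛ r → UnitConstant p → UnitConstant s → UnitConstant r
UnitConstant-factor p r {s} s≈pr up us = let y = coef r 0 ; x = coef p 0 in
  ≡.trans (≡.sym (≡.trans (≡.cong (ℤ._* (y ℤ.* y)) up) (ℤ.*-identityˡ _)))
    (≡.trans (≡.sym (arithmetic x y)) (≡.trans
      (≡.cong (λ z → z ℤ.* z) (≡.sym (≡.trans (coefs s≈pr 0) (coef₀-⊛ p r)))) us))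
  where
  arithmetic : ∀ x y → (x ℤ.* y) ℤ.* (x ℤ.* y) ≡ (x ℤ.* x) ℤ.* (y ℤ.* y)
  arithmetic = ℤ-Solver.solve-∀

⊛-regular : ∀ d → UnitConstant d → ∀ g → d ⊛ g ≈ [] → g ≈ []
⊛-regular d ud [] dg≈0 = ≈-refl
⊛-regular d ud (b ∷ g) dg≈0 = equal λ { zero → b≡0 ; (suc i) → coefs g≈0 i }
  where
  b≡0 : b ≡ + 0
  b≡0 with ℤ.i*j≡0⇒i≡0∨j≡0 (coef d 0) (≡.trans (≡.sym (coef₀-⊛ d (b ∷ g))) (coefs dg≈0 0))
  ... | inj₁ d₀≡0 = contradiction d₀≡0 (unit≢0 ud)
  ... | inj₂ b≡0 = b≡0
  g≈0 : g ≈ []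
  g≈0 = ⊛-regular d ud g (equal λ i → coefs (≈-trans (≈-sym shifted) dg≈0) (suc i))
    where
    shifted : d ⊛ (b ∷ g) ≈ + 0 ∷ d ⊛ g
    shifted = ≈-trans (⊛-∷ d b g) (⊕-congʳ (+ 0 ∷ d ⊛ g)
      (≈-trans (equal λ i → ≡.trans (coef-scale b d i) (≡.cong (ℤ._* coef d i) b≡0)) (≈-refl {[]})))

⊛-cancelˡ : ∀ d → UnitConstant d → ∀ p r → d ⊛ p ≈ d ⊛ r → p ≈ r
⊛-cancelˡ d ud p r dp≈dr = begin
  p             ≈⟨ solve 2 (λ p r → p := (p :- r) :+ r) ≈-refl p r ⟩
  (p ⊖ r) ⊕ r   ≈⟨ ⊕-congʳ r (⊛-regular d ud (p ⊖ r) zero-product) ⟩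
  r             ∎
  where
  zero-product : d ⊛ (p ⊖ r) ≈ []
  zero-product = begin
    d ⊛ (p ⊖ r)       ≈⟨ solve 3 (λ d p r → d :* (p :- r) := d :* p :- d :* r) ≈-refl d p r ⟩
    d ⊛ p ⊖ d ⊛ r     ≈⟨ ⊕-congʳ (negP (d ⊛ r)) dp≈dr ⟩
    d ⊛ r ⊖ d ⊛ r     ≈⟨ ⊕-inverseʳ (d ⊛ r) ⟩
    []                ∎

tail : Poly → Poly
tail [] = []
tail (a ∷ p) = p

coef-tail : ∀ p i → coef (tail p) i ≡ coef p (suc i)
coef-tail [] i = ≡.refl
coef-tail (a ∷ p) i = ≡.refl

-- A substitute for the Gauss lemma: d is invertible as a power series over ℤ, so g = c (f/d) has
-- all coefficients divisible by c. They are read off from the constant term upward; `b′` is the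
-- first coefficient of f/d.
divide-content : ∀ d → UnitConstant d → ∀ c g f → d ⊛ g ≈ scale c f → Σ Poly λ g′ → g ≈ scale c g′
divide-content d ud c [] f _ = [] , ≈-refl
divide-content d ud c (b ∷ g) f eq = b′ ∷ proj₁ rec , ∷-cong b≡cb′ (proj₂ rec)
  where
  b′ : ℤ
  b′ = coef f 0 ℤ.* coef d 0
  coefficient : ∀ i → b ℤ.* coef d i ℤ.+ coef (+ 0 ∷ d ⊛ g) i ≡ c ℤ.* coef f i
  coefficient i = ≡.trans (≡.sym (≡.trans (coefs (⊛-∷ d b g) i)
    (≡.trans (coef-⊕ (scale b d) _ i) (≡.cong (ℤ._+ _) (coef-scale b d i)))))
    (≡.trans (coefs eq i) (coef-scale c f i))
  b≡cb′ : b ≡ c ℤ.* b′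
  b≡cb′ = ≡.trans (≡.sym (ℤ.*-identityʳ b)) (≡.trans (≡.cong (b ℤ.*_) (≡.sym ud))
    (≡.trans (arithmetic b (coef d 0)) (≡.trans (≡.cong (ℤ._* coef d 0) (coefficient 0))
      (ℤ.*-assoc c (coef f 0) (coef d 0)))))
    where
    arithmetic : ∀ b u → b ℤ.* (u ℤ.* u) ≡ (b ℤ.* u ℤ.+ + 0) ℤ.* u
    arithmetic = ℤ-Solver.solve-∀
  rec : Σ Poly λ g′ → g ≈ scale c g′
  rec = divide-content d ud c g (tail f ⊖ scale b′ (tail d)) (equal λ i → ≡.trans
    (isolate b (coef d (suc i)) (coef (d ⊛ g) i))
    (≡.trans (≡.cong₂ (λ x y → x ℤ.- y ℤ.* coef d (suc i)) (coefficient (suc i)) b≡cb′)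
    (≡.trans (collect c (coef f (suc i)) b′ (coef d (suc i))) (≡.sym (target i)))))
    where
    isolate : ∀ b x y → y ≡ (b ℤ.* x ℤ.+ y) ℤ.- b ℤ.* x
    isolate = ℤ-Solver.solve-∀
    collect : ∀ c x y z → c ℤ.* x ℤ.- c ℤ.* y ℤ.* z ≡ c ℤ.* (x ℤ.+ ℤ.- (y ℤ.* z))
    collect = ℤ-Solver.solve-∀
    target : ∀ i → coef (scale c (tail f ⊖ scale b′ (tail d))) i ≡ c ℤ.*
      (coef f (suc i) ℤ.+ ℤ.- (b′ ℤ.* coef d (suc i)))
    target i = ≡.trans (coef-scale c (tail f ⊖ scale b′ (tail d)) i)
      (≡.cong (c ℤ.*_) (≡.trans (coef-⊕ (tail f) (negP (scale b′ (tail d))) i)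
      (≡.cong₂ ℤ._+_ (coef-tail f i) (≡.trans (coef-negP (scale b′ (tail d)) i)
        (≡.cong ℤ.-_ (≡.trans (coef-scale b′ (tail d) i) (≡.cong (b′ ℤ.*_) (coef-tail d i))))))))

-- By `divide-content` the constant also divides the cofactor of d, and then it cancels
-- coefficientwise. Bézout identities with an integer on the left thus yield divisibility over ℤ.
∣-cancel-constant : ∀ d → UnitConstant d → ∀ c → c ≢ + 0 → ∀ f → d ∣ κ c ⊛ f → d ∣ f
∣-cancel-constant d ud c c≢0 f (divides g cf≈dg) = divides g′ (equal λ i →
  ℤ.*-cancelˡ-≡ c (coef f i) (coef (d ⊛ g′) i) {{ℤ.≢-nonZero c≢0}}
    (≡.trans (≡.sym (coef-scale c f i)) (≡.trans (coefs same i) (coef-scale c (d ⊛ g′) i))))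
  where
  content = divide-content d ud c g f (≈-trans (≈-sym cf≈dg) (≈-sym (scale≈κ⊛ c f)))
  g′ : Poly
  g′ = proj₁ content
  same : scale c f ≈ scale c (d ⊛ g′)
  same = begin
    scale c f          ≈⟨ scale≈κ⊛ c f ⟩
    κ c ⊛ f            ≈⟨ cf≈dg ⟩
    d ⊛ g              ≈⟨ ⊛-congˡ d (≈-trans (proj₂ content) (scale≈κ⊛ c g′)) ⟩
    d ⊛ (κ c ⊛ g′)     ≈⟨ solve 3 (λ d c g → d :* (c :* g) := c :* (d :* g)) ≈-refl d (κ c) g′ ⟩
    κ c ⊛ (d ⊛ g′)     ≈⟨ scale≈κ⊛ c (d ⊛ g′) ⟨
    scale c (d ⊛ g′)   ∎

-- Coprimality over ℚ, with denominators cleared.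
record Coprime (p r : Poly) : Set where
  field
    constant : ℤ
    constant≢0 : constant ≢ + 0
    coefficient₁ coefficient₂ : Poly
    bézout : κ constant ≈ coefficient₁ ⊛ p ⊕ coefficient₂ ⊛ r

Coprime-sym : ∀ {p r} → Coprime p r → Coprime r p
Coprime-sym {p} {r} cop = record
  { constant≢0 = constant≢0 ; coefficient₁ = coefficient₂ ; coefficient₂ = coefficient₁
  ; bézout = ≈-trans bézout (⊕-comm (coefficient₁ ⊛ p) (coefficient₂ ⊛ r)) }
  where open Coprime cop

Coprime-one : ∀ r → Coprime oneP r
Coprime-one r = record { constant = + 1 ; constant≢0 = λ () ; coefficient₁ = oneP ; coefficient₂ = [] ; bézout
  = ≈-sym (⊕-identityʳ _) }

Coprime-∣ : ∀ {p r s} → Coprime p r → s ∣ r → Coprime p s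
Coprime-∣ {p} {r} {s} cop (divides g r≈sg) = record
  { constant≢0 = constant≢0 ; coefficient₁ = coefficient₁ ; coefficient₂ = coefficient₂ ⊛ g
  ; bézout = ≈-trans bézout (⊕-congˡ (coefficient₁ ⊛ p) (≈-trans (⊛-congˡ coefficient₂ r≈sg)
      (solve 3 (λ b s g → b :* (s :* g) := (b :* g) :* s) ≈-refl coefficient₂ s g))) }
  where open Coprime cop

Coprime-⊛ : ∀ {p r s} → Coprime p s → Coprime r s → Coprime (p ⊛ r) s
Coprime-⊛ {p} {r} {s} cop₁ cop₂ = record
  { constant = c₁ ℤ.* c₂ ; constant≢0 = nonzero ; coefficient₁ = a₁ ⊛ a₂ ; coefficient₂ = (a₁ ⊛ p) ⊛ b₂ ⊕ b₁ ⊛ κ c₂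
  ; bézout = begin
      κ (c₁ ℤ.* c₂)                                   ≈⟨ κ-* c₁ c₂ ⟩
      κ c₁ ⊛ κ c₂                                     ≈⟨ ⊛-congʳ (κ c₂) C₁.bézout ⟩
      (a₁ ⊛ p ⊕ b₁ ⊛ s) ⊛ κ c₂                       
        ≈⟨ solve 5 (λ a p b s c → (a :* p :+ b :* s) :* c := (a :* p) :* c :+ (b :* c) :* s) ≈-refl a₁ p b₁ s (κ c₂) ⟩
      (a₁ ⊛ p) ⊛ κ c₂ ⊕ (b₁ ⊛ κ c₂) ⊛ s               ≈⟨ ⊕-congʳ ((b₁ ⊛ κ c₂) ⊛ s) (⊛-congˡ (a₁ ⊛ p) C₂.bézout) ⟩
      (a₁ ⊛ p) ⊛ (a₂ ⊛ r ⊕ b₂ ⊛ s) ⊕ (b₁ ⊛ κ c₂) ⊛ s 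
        ≈⟨ solve 8 (λ a p a′ r b′ s b c → (a :* p) :* (a′ :* r :+ b′ :* s) :+ (b :* c) :* s
                                                           := (a :* a′) :* (p :* r) :+ ((a :* p) :* b′ :+ b :*
                                                             c) :* s) ≈-refl a₁ p a₂ r b₂ s b₁ (κ c₂) ⟩
      (a₁ ⊛ a₂) ⊛ (p ⊛ r) ⊕ ((a₁ ⊛ p) ⊛ b₂ ⊕ b₁ ⊛ κ c₂) ⊛ s ∎ }
  where
  module C₁ = Coprime cop₁
  module C₂ = Coprime cop₂
  open C₁ renaming (constant to c₁; coefficient₁ to a₁; coefficient₂ to b₁) using ()
  open C₂ renaming (constant to c₂; coefficient₁ to a₂; coefficient₂ to b₂) using ()
  nonzero : c₁ ℤ.* c₂ ≢ + 0
  nonzero eq with ℤ.i*j≡0⇒i≡0∨j≡0 c₁ eq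
  ... | inj₁ c₁≡0 = C₁.constant≢0 c₁≡0
  ... | inj₂ c₂≡0 = C₂.constant≢0 c₂≡0

Coprime-product-∣ : ∀ {p r s} → UnitConstant p → UnitConstant r → Coprime p r → p ∣ s → r ∣ s → p ⊛ r ∣ s
Coprime-product-∣ {p} {r} {s} up ur cop (divides g s≈pg) (divides h s≈rh) =
  ∣-cancel-constant (p ⊛ r) (UnitConstant-⊛ p r up ur) constant constant≢0 s (divides (a ⊛ h ⊕ b ⊛ g) (begin
    κ constant ⊛ s                        ≈⟨ ⊛-congʳ s bézout ⟩
    (a ⊛ p ⊕ b ⊛ r) ⊛ s                   ≈⟨ ⊛-distribʳ s (a ⊛ p) (b ⊛ r) ⟩
    (a ⊛ p) ⊛ s ⊕ (b ⊛ r) ⊛ s             ≈⟨ ⊕-cong (⊛-congˡ (a ⊛ p) s≈rh) (⊛-congˡ (b ⊛ r) s≈pg) ⟩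
    (a ⊛ p) ⊛ (r ⊛ h) ⊕ (b ⊛ r) ⊛ (p ⊛ g) ≈⟨ solve 6
      (λ a p r h b g → (a :* p) :* (r :* h) :+ (b :* r) :* (p :* g) := (p :* r) :* (a :* h :+ b :* g)) ≈-refl a
      p r h b g ⟩
    (p ⊛ r) ⊛ (a ⊛ h ⊕ b ⊛ g)             ∎))
  where
  open Coprime cop
  a b : Poly
  a = coefficient₁
  b = coefficient₂

Coprime-cancel : ∀ {p r s} → UnitConstant p → Coprime p r → p ∣ r ⊛ s → p ∣ s
Coprime-cancel {p} {r} {s} up cop p∣rs = ∣-cancel-constant p up constant constant≢0 s
  (∣-≈ (≈-sym split) (∣-⊕ (divides (coefficient₁ ⊛ s) ≈-refl) (∣-⊛ˡ coefficient₂ p∣rs)))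
  where
  open Coprime cop
  split : κ constant ⊛ s ≈ p ⊛ (coefficient₁ ⊛ s) ⊕ coefficient₂ ⊛ (r ⊛ s)
  split = ≈-trans (⊛-congʳ s bézout) (solve 5
    (λ a p b r s → (a :* p :+ b :* r) :* s := p :* (a :* s) :+ b :* (r :* s)) ≈-refl coefficient₁ p coefficient₂ r s)

-- The polynomials q^k - 1

mono-1 : ℕ → Poly
mono-1 k = mono k ⊖ oneP

mono-1-+ : ∀ a b → mono-1 (a ℕ.+ b) ≈ mono-1 a ⊕ mono a ⊛ mono-1 b
mono-1-+ a b = ≈-trans (⊕-congʳ (negP oneP) (mono-+ a b))
  (solve 2 (λ x y → x :* y :- con (+ 1) := (x :- con (+ 1)) :+ x :* (y :- con (+ 1))) ≈-refl (mono a) (mono b))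

geometric : ℕ → ℕ → Poly
geometric d zero = []
geometric d (suc t) = oneP ⊕ mono d ⊛ geometric d t

mono-1-* : ∀ t d → mono-1 (t ℕ.* d) ≈ mono-1 d ⊛ geometric d t
mono-1-* zero d = ≈-trans (⊕-inverseʳ oneP) (≈-sym (⊛-zeroʳ (mono-1 d)))
mono-1-* (suc t) d = begin
  mono-1 (d ℕ.+ t ℕ.* d)                                 ≈⟨ mono-1-+ d (t ℕ.* d) ⟩
  mono-1 d ⊕ mono d ⊛ mono-1 (t ℕ.* d)                   ≈⟨ ⊕-congˡ (mono-1 d) (⊛-congˡ (mono d) (mono-1-* t d)) ⟩
  mono-1 d ⊕ mono d ⊛ (mono-1 d ⊛ geometric d t)        
    ≈⟨ solve 3 (λ d x g → d :+ x :* (d :* g) := d :* (con (+ 1) :+ x :* g)) ≈-refl (mono-1 d) (mono d)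
    (geometric d t) ⟩
  mono-1 d ⊛ geometric d (suc t)                         ∎

mono-1-∣ : ∀ {d m} → d ℕ.∣ m → mono-1 d ∣ mono-1 m
mono-1-∣ {d} (ℕ.divides t ≡.refl) = divides (geometric d t) (mono-1-* t d)

-- Modulo q^d - 1 each of the t summands is 1. The resulting integer t is the constant in
-- `Φ-coprime-mono-1`.
geometric-constant : ∀ d t → Σ Poly λ s → geometric d t ≈ κ (+ t) ⊕ mono-1 d ⊛ s
geometric-constant d zero = [] , ≈-sym (≈-trans (⊕-congˡ (κ (+ 0)) (⊛-zeroʳ (mono-1 d)))
  (equal λ { zero → ≡.refl ; (suc i) → ≡.refl }))
geometric-constant d (suc t) with geometric-constant d t
... | s , eq = s ⊕ geometric d t , (begin
  oneP ⊕ mono d ⊛ geometric d t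
    ≈⟨ solve 2 (λ x g → con (+ 1) :+ x :* g := (con (+ 1) :+ g) :+ (x :- con (+ 1)) :* g) ≈-refl (mono d)
      (geometric d t) ⟩
  (oneP ⊕ geometric d t) ⊕ mono-1 d ⊛ geometric d t
    ≈⟨ ⊕-congʳ (mono-1 d ⊛ geometric d t) (⊕-congˡ oneP eq) ⟩
  (oneP ⊕ (κ (+ t) ⊕ mono-1 d ⊛ s)) ⊕ mono-1 d ⊛ geometric d t
    ≈⟨ solve 5 (λ i k x s g → (i :+ (k :+ x :* s)) :+ x :* g := (i :+ k) :+ x :* (s :+ g)) ≈-refl oneP
      (κ (+ t)) (mono-1 d) s (geometric d t) ⟩
  κ (+ suc t) ⊕ mono-1 d ⊛ (s ⊕ geometric d t) ∎)

record Combination (s p r : Poly) : Set where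
  constructor combination
  field
    x y : Poly
    combined : s ≈ x ⊛ p ⊕ y ⊛ r

-- The Bézout identity of the exponents carries over: q^(xa) - 1 equals (q^g - 1) + q^g (q^(yb) -
-- 1), which is solved for q^g - 1.
mono-1-difference : ∀ g a b x y → g ℕ.+ y ℕ.* b ≡ x ℕ.* a →
  mono-1 g ≈ geometric a x ⊛ mono-1 a ⊕ negP (mono g ⊛ geometric b y) ⊛ mono-1 b
mono-1-difference g a b x y eq = rearrange (mono-1 g) (mono-1 a) (mono-1 b) (begin
  mono-1 g ⊕ mono g ⊛ (mono-1 b ⊛ geometric b y)   ≈⟨ ⊕-congˡ (mono-1 g) (⊛-congˡ (mono g) (mono-1-* y b)) ⟨
  mono-1 g ⊕ mono g ⊛ mono-1 (y ℕ.* b)             ≈⟨ mono-1-+ g (y ℕ.* b) ⟨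
  mono-1 (g ℕ.+ y ℕ.* b)                           ≡⟨ ≡.cong mono-1 eq ⟩
  mono-1 (x ℕ.* a)                                 ≈⟨ mono-1-* x a ⟩
  mono-1 a ⊛ geometric a x                         ∎)
  where
  rearrange : ∀ G A B → G ⊕ mono g ⊛ (B ⊛ geometric b y) ≈ A ⊛ geometric a x →
    G ≈ geometric a x ⊛ A ⊕ negP (mono g ⊛ geometric b y) ⊛ B
  rearrange G A B eq = begin
    G
      ≈⟨ solve 4 (λ d g b y → d := (d :+ g :* (b :* y)) :+ (:- (g :* y)) :* b) ≈-refl G (mono g) B (geometric b y) ⟩
    (G ⊕ mono g ⊛ (B ⊛ geometric b y)) ⊕ negP (mono g ⊛ geometric b y) ⊛ B
      ≈⟨ ⊕-congʳ (negP (mono g ⊛ geometric b y) ⊛ B) (≈-trans eq (⊛-comm A (geometric a x))) ⟩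
    geometric a x ⊛ A ⊕ negP (mono g ⊛ geometric b y) ⊛ B ∎

mono-1-bézout : ∀ {g a b} → Bézout.Identity g a b → Combination (mono-1 g) (mono-1 a) (mono-1 b)
mono-1-bézout {g} {a} {b} (Bézout.+- x y eq) =
  combination (geometric a x) (negP (mono g ⊛ geometric b y)) (mono-1-difference g a b x y eq)
mono-1-bézout {g} {a} {b} (Bézout.-+ x y eq) =
  combination (negP (mono g ⊛ geometric a x)) (geometric b y)
    (≈-trans (mono-1-difference g b a y x eq)
      (⊕-comm (geometric b y ⊛ mono-1 b) (negP (mono g ⊛ geometric a x) ⊛ mono-1 a)))

UnitConstant-mono-1 : ∀ k → UnitConstant (mono-1 (suc k))
UnitConstant-mono-1 k = ≡.refl

Monic±-mono-1 : ∀ k → Monic± (mono-1 (suc k))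
Monic±-mono-1 k = record { degree = suc k ; unit = + 1 ; unit² = ≡.refl ; lead = Lead-≈ (≈-sym same) record
  { top = coef-mono k ; above = λ { (suc i) (s≤s k<i) → above-mono k i k<i } } }
  where
  coef-mono : ∀ k → coef (mono k) k ≡ + 1
  coef-mono zero = ≡.refl
  coef-mono (suc k) = coef-mono k
  above-mono : ∀ k i → k < i → coef (mono k) i ≡ + 0
  above-mono zero (suc i) _ = ≡.refl
  above-mono (suc k) (suc i) (s≤s k<i) = above-mono k i k<i
  same : mono-1 (suc k) ≈ -[1+ 0 ] ∷ mono k
  same = ∷-cong ≡.refl (⊕-identityʳ (mono k))

-- Products of cyclotomic polynomials over divisors

mutual
  phiList : ℕ → List (ℕ × Poly)
  phiList = _

  -- The product of Φ_d over the divisors d ≤ N of m. Keeping N apart from m allows the product to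
  -- be built one index at a time.
  divisorProduct : ℕ → ℕ → Poly
  divisorProduct m N = prodP (map proj₂ (filter (λ dp → proj₁ dp ℕ.∣? m) (phiList N)))

  Φ-suc : ∀ n → Φ (suc n) ≡ mono-1 (suc n) ÷ divisorProduct (suc n) n
  Φ-suc n with foldl {A = List ℤ} {B = ℤ} (λ xs x → x ∷ xs) []
  ... | rev with filter {A = ℕ × Poly} (λ dp → proj₁ dp ℕ.∣? suc n)
  ... | fil = ≡.refl

divisorProduct-++ : ∀ m N → divisorProduct m (suc N) ≈ divisorProduct m N ⊛ prodP
  (map proj₂ (filter (λ dp → proj₁ dp ℕ.∣? m) ((suc N , Φ (suc N)) ∷ [])))
divisorProduct-++ m N = ≈-trans
  (PR.reflexive (≡.cong prodP (≡.trans (≡.cong (map proj₂) (filter-++ (λ dp → proj₁ dp ℕ.∣? m) (phiList N) _))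
    (map-++ proj₂ (filter _ (phiList N)) _))))
  (prodP-++ (map proj₂ (filter _ (phiList N))) _)

divisorProduct-∣ : ∀ {m N} → suc N ℕ.∣ m → divisorProduct m (suc N) ≈ divisorProduct m N ⊛ Φ (suc N)
divisorProduct-∣ {m} {N} N∣m = ≈-trans (divisorProduct-++ m N) (⊛-congˡ (divisorProduct m N) (≈-trans
  (PR.reflexive (≡.cong (λ l → prodP (map proj₂ l))
    (filter-accept (λ dp → proj₁ dp ℕ.∣? m) {(suc N , Φ (suc N))} {[]} N∣m)))
  (PR.*-identityʳ (Φ (suc N)))))

divisorProduct-∤ : ∀ {m N} → ¬ suc N ℕ.∣ m → divisorProduct m (suc N) ≈ divisorProduct m N
divisorProduct-∤ {m} {N} N∤m = ≈-trans (divisorProduct-++ m N) (≈-trans (⊛-congˡ (divisorProduct m N)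
  (PR.reflexive (≡.cong (λ l → prodP (map proj₂ l))
    (filter-reject (λ dp → proj₁ dp ℕ.∣? m) {(suc N , Φ (suc N))} {[]} N∤m))))
  (PR.*-identityʳ (divisorProduct m N)))

∣-≈ˡ : ∀ {p r s} → p ≈ r → r ∣ s → p ∣ s
∣-≈ˡ p≈r (divides g s≈) = divides g (≈-trans s≈ (⊛-congʳ g (≈-sym p≈r)))

⊛-mono-∣ : ∀ {p p′ r} → p ∣ p′ → p ⊛ r ∣ p′ ⊛ r
⊛-mono-∣ {p} {p′} {r} (divides g p′≈) = divides g (≈-trans (⊛-congʳ r p′≈)
  (solve 3 (λ p g r → (p :* g) :* r := (p :* r) :* g) ≈-refl p g r))

divisorProduct-mono : ∀ {g m} → g ℕ.∣ m → ∀ N → divisorProduct g N ∣ divisorProduct m N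
divisorProduct-mono g∣m zero = ∣-refl
divisorProduct-mono {g} {m} g∣m (suc N) with suc N ℕ.∣? g | suc N ℕ.∣? m
... | yes N∣g | no N∤m = contradiction (ℕ.∣-trans N∣g g∣m) N∤m
... | yes N∣g | yes N∣m = ∣-≈ˡ (divisorProduct-∣ N∣g)
  (∣-≈ (≈-sym (divisorProduct-∣ N∣m)) (⊛-mono-∣ (divisorProduct-mono g∣m N)))
... | no N∤g | yes N∣m = ∣-≈ˡ (divisorProduct-∤ N∤g)
  (∣-≈ (≈-sym (divisorProduct-∣ N∣m)) (∣-⊛ʳ (Φ (suc N)) (divisorProduct-mono g∣m N)))
... | no N∤g | no N∤m = ∣-≈ˡ (divisorProduct-∤ N∤g) (∣-≈ (≈-sym (divisorProduct-∤ N∤m)) (divisorProduct-mono g∣m N))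

divisorProduct-grow : ∀ m {N N′} → N ℕ.≤′ N′ → divisorProduct m N ∣ divisorProduct m N′
divisorProduct-grow m ℕ.≤′-refl = ∣-refl
divisorProduct-grow m (ℕ.≤′-step {N′} N≤N′) with suc N′ ℕ.∣? m
... | yes N∣m = ∣-≈ (≈-sym (divisorProduct-∣ N∣m)) (∣-⊛ʳ (Φ (suc N′)) (divisorProduct-grow m N≤N′))
... | no N∤m = ∣-≈ (≈-sym (divisorProduct-∤ N∤m)) (divisorProduct-grow m N≤N′)

-- What the strong induction carries about the polynomial of index k + 1. Exactness of its defining
-- division depends on all earlier ones; `monic` makes later quotients unique, and `unitConstant`
-- makes factors cancellable.
record Cyclotomic (k : ℕ) : Set where
  field
    factorisation : mono-1 (suc k) ≈ divisorProduct (suc k) k ⊛ Φ (suc k)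
    unitConstant : UnitConstant (Φ (suc k))
    monic : Monic± (Φ (suc k))

  Φ∣mono-1 : Φ (suc k) ∣ mono-1 (suc k)
  Φ∣mono-1 = divides (divisorProduct (suc k) k)
    (≈-trans factorisation (⊛-comm (divisorProduct (suc k) k) (Φ (suc k))))

  divisorProduct-self : divisorProduct (suc k) (suc k) ≈ mono-1 (suc k)
  divisorProduct-self = ≈-trans (divisorProduct-∣ {suc k} {k} ℕ.∣-refl) (≈-sym factorisation)

open Cyclotomic

-- Let G be the gcd of e + 1 and d + 1, and e + 1 = t G. By Bézout, q^G - 1 is a combination of
-- q^(e+1) - 1, a multiple of Φ_(e+1), and q^(d+1) - 1. The quotient (q^(e+1) - 1)/(q^G - 1) is a
-- multiple of Φ_(e+1) and congruent to t modulo q^G - 1. So the nonzero integer t is a combination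
-- of Φ_(e+1) and q^(d+1) - 1.
Φ-coprime-mono-1 : ∀ e d → d < e → (∀ k → k ≤ e → Cyclotomic k) → Coprime (Φ (suc e)) (mono-1 (suc d))
Φ-coprime-mono-1 e d d<e cyclotomic with gcd (suc e) (suc d) in eq | gcd[m,n]∣m (suc e) (suc d) | gcd[m,n]∣n
  (suc e) (suc d) | Bézout.identity (gcd-GCD (suc e) (suc d))
... | zero | g∣e | _ | _ = contradiction (ℕ.0∣⇒≡0 g∣e) λ ()
... | suc g | g∣e@(ℕ.divides t e≡tg) | g∣d | identity = record
  { constant = + t ; constant≢0 = t≢0 ; coefficient₁ = K ⊖ (s ⊛ x) ⊛ W ; coefficient₂ = negP (s ⊛ y)
  ; bézout = begin
      κ (+ t)
        ≈⟨ solve 2 (λ k g → k := (k :+ g) :- g) ≈-refl (κ (+ t)) (mono-1 (suc g) ⊛ s) ⟩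
      (κ (+ t) ⊕ mono-1 (suc g) ⊛ s) ⊖ mono-1 (suc g) ⊛ s
        ≈⟨ ⊕-cong (≈-sym (≈-trans quotient-geometric geometric≈)) (negP-cong (⊛-congʳ s (≈-trans combined
             (⊕-congʳ (y ⊛ mono-1 (suc d)) (⊛-congˡ x (factorisation (cyclotomic e ℕ.≤-refl))))))) ⟩
      K ⊛ Φ (suc e) ⊖ (x ⊛ (W ⊛ Φ (suc e)) ⊕ y ⊛ mono-1 (suc d)) ⊛ s
        ≈⟨ solve 7 (λ K P x W y d s → K :* P :- (x :* (W :* P) :+ y :* d) :* s := (K :- (s :* x) :* W) :* P :+
          (:- (s :* y)) :* d)
             ≈-refl K (Φ (suc e)) x W y (mono-1 (suc d)) s ⟩
      (K ⊖ (s ⊛ x) ⊛ W) ⊛ Φ (suc e) ⊕ negP (s ⊛ y) ⊛ mono-1 (suc d) ∎ }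
  where
  open Combination (mono-1-bézout identity)
  W : Poly
  W = divisorProduct (suc e) e
  g<e : suc g ≤ e
  g<e = ℕ.≤-trans (ℕ.∣⇒≤ g∣d) d<e
  t≢0 : + t ≢ + 0
  t≢0 ≡.refl = contradiction e≡tg λ ()
  -- The polynomial q^G - 1 is the product of Φ_j over the divisors j of G, all of which are proper
  -- divisors of e + 1 because G ≤ d + 1 < e + 1.
  divisor : mono-1 (suc g) ∣ W
  divisor = ∣-≈ˡ (≈-sym (divisorProduct-self (cyclotomic g (ℕ.<⇒≤ g<e))))
    (∣-trans (divisorProduct-mono g∣e (suc g)) (divisorProduct-grow (suc e) (ℕ.≤⇒≤′ g<e)))
  K s : Poly
  K = _∣_.quotient divisor
  s = proj₁ (geometric-constant (suc g) t)
  geometric≈ : geometric (suc g) t ≈ κ (+ t) ⊕ mono-1 (suc g) ⊛ s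
  geometric≈ = proj₂ (geometric-constant (suc g) t)
  quotient-geometric : K ⊛ Φ (suc e) ≈ geometric (suc g) t
  quotient-geometric = ⊛-cancelˡ (mono-1 (suc g)) (UnitConstant-mono-1 g) (K ⊛ Φ (suc e)) (geometric (suc g) t) (begin
    mono-1 (suc g) ⊛ (K ⊛ Φ (suc e))    ≈⟨ ⊛-assoc (mono-1 (suc g)) K (Φ (suc e)) ⟨
    (mono-1 (suc g) ⊛ K) ⊛ Φ (suc e)    ≈⟨ ⊛-congʳ (Φ (suc e)) (_∣_.equality divisor) ⟨
    W ⊛ Φ (suc e)                       ≈⟨ factorisation (cyclotomic e ℕ.≤-refl) ⟨
    mono-1 (suc e)                      ≡⟨ ≡.cong mono-1 e≡tg ⟩
    mono-1 (t ℕ.* suc g)                ≈⟨ mono-1-* t (suc g) ⟩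
    mono-1 (suc g) ⊛ geometric (suc g) t ∎)

divisorProduct-unitConstant : ∀ m N → (∀ k → k < N → Cyclotomic k) → UnitConstant (divisorProduct m N)
divisorProduct-unitConstant m zero cyclotomic = ≡.refl
divisorProduct-unitConstant m (suc N) cyclotomic with suc N ℕ.∣? m | divisorProduct-unitConstant m N
  (λ k k<N → cyclotomic k (ℕ.m<n⇒m<1+n k<N))
... | no N∤m | rec = ≡.trans (≡.cong (λ x → x ℤ.* x) (coefs (divisorProduct-∤ N∤m) 0)) rec
... | yes N∣m | rec = ≡.trans (≡.cong (λ x → x ℤ.* x) (coefs (divisorProduct-∣ N∣m) 0))
  (UnitConstant-⊛ (divisorProduct m N) (Φ (suc N)) rec (unitConstant (cyclotomic N ℕ.≤-refl)))

divisorProduct-monic : ∀ m N → (∀ k → k < N → Cyclotomic k) → Monic± (divisorProduct m N)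
divisorProduct-monic m zero cyclotomic = record
  { degree = 0 ; unit = + 1 ; unit² = ≡.refl ; lead = record { top = ≡.refl ; above = λ { (suc i) _ → ≡.refl } } }
divisorProduct-monic m (suc N) cyclotomic with suc N ℕ.∣? m | divisorProduct-monic m N
  (λ k k<N → cyclotomic k (ℕ.m<n⇒m<1+n k<N))
... | no N∤m | rec = Monic±-≈ (≈-sym (divisorProduct-∤ N∤m)) rec
... | yes N∣m | rec = Monic±-≈ (≈-sym (divisorProduct-∣ N∣m)) (Monic±-⊛ rec (monic (cyclotomic N ℕ.≤-refl)))

-- Each factor Φ_j with j ≤ N divides q^j - 1, which is coprime to Φ_(N+1) by `Φ-coprime-mono-1`.
divisorProduct-coprime : ∀ m N j → j ≤ N → (∀ k → k ≤ N → Cyclotomic k) → Coprime (divisorProduct m j) (Φ (suc N))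
divisorProduct-coprime m N zero _ cyclotomic = Coprime-one (Φ (suc N))
divisorProduct-coprime m N (suc j) j<N cyclotomic with suc j ℕ.∣? m | divisorProduct-coprime m N j (ℕ.<⇒≤ j<N)
  cyclotomic
... | no j∤m | rec = Coprime-sym (Coprime-∣ (Coprime-sym rec) (∣-≈ (divisorProduct-∤ j∤m) ∣-refl))
... | yes j∣m | rec = Coprime-sym (Coprime-∣ (Coprime-sym (Coprime-⊛ rec (Coprime-sym
    (Coprime-∣ (Φ-coprime-mono-1 N j j<N cyclotomic) (Φ∣mono-1 (cyclotomic j (ℕ.<⇒≤ j<N)))))))
    (∣-≈ (divisorProduct-∣ j∣m) ∣-refl))

-- Each factor Φ_d divides q^d - 1 and hence q^m - 1; as every new factor is coprime to the product
-- so far, the whole product divides q^m - 1.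
divisorProduct∣mono-1 : ∀ m N → (∀ k → k < N → Cyclotomic k) → divisorProduct m N ∣ mono-1 m
divisorProduct∣mono-1 m zero cyclotomic = divides (mono-1 m) (≈-sym (⊛-identityˡ (mono-1 m)))
divisorProduct∣mono-1 m (suc N) cyclotomic with suc N ℕ.∣? m | divisorProduct∣mono-1 m N
  (λ k k<N → cyclotomic k (ℕ.m<n⇒m<1+n k<N))
... | no N∤m | rec = ∣-≈ˡ (divisorProduct-∤ N∤m) rec
... | yes N∣m | rec = ∣-≈ˡ (divisorProduct-∣ N∣m) (Coprime-product-∣
  (divisorProduct-unitConstant m N (λ k k<N → cyclotomic k (ℕ.m<n⇒m<1+n k<N)))
  (unitConstant (cyclotomic N ℕ.≤-refl))
  (divisorProduct-coprime m N N ℕ.≤-refl (λ k k≤N → cyclotomic k (s≤s k≤N)))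
  rec
  (∣-trans (Φ∣mono-1 (cyclotomic N ℕ.≤-refl)) (mono-1-∣ N∣m)))

cyclotomic-step : ∀ n → (∀ k → k < n → Cyclotomic k) → Cyclotomic n
cyclotomic-step n cyclotomic = record
  { factorisation = factor
  ; unitConstant = UnitConstant-factor W (Φ (suc n)) factor (divisorProduct-unitConstant (suc n) n cyclotomic)
    (UnitConstant-mono-1 n)
  ; monic = Monic±-factor {W} {Φ (suc n)} monic-W (Monic±-≈ factor (Monic±-mono-1 n)) }
  where
  W : Poly
  W = divisorProduct (suc n) n
  monic-W : Monic± W
  monic-W = divisorProduct-monic (suc n) n cyclotomic
  exact : W ∣ mono-1 (suc n)
  exact = divisorProduct∣mono-1 (suc n) n cyclotomic
  factor : mono-1 (suc n) ≈ W ⊛ Φ (suc n)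
  factor = ≈-trans (_∣_.equality exact) (⊛-congˡ W
    (≈-sym (≈-trans (PR.reflexive (Φ-suc n)) (÷-exact monic-W (_∣_.equality exact)))))

cyclotomic-below : ∀ n k → k < n → Cyclotomic k
cyclotomic-below (suc n) k (s≤s k≤n) with ℕ.m≤n⇒m<n∨m≡n k≤n
... | inj₁ k<n = cyclotomic-below n k k<n
... | inj₂ ≡.refl = cyclotomic-step k (cyclotomic-below k)

cyclotomic : ∀ k → Cyclotomic k
cyclotomic k = cyclotomic-below (suc k) k (ℕ.n<1+n k)

-- Regularity is used twice: it gives x = P y, and after cancelling one P the element a y is a
-- multiple of P, so y is one too.
regular-square : ∀ {P a} → UnitConstant P → (∀ x → P ∣ a ⊛ x → P ∣ x) → ∀ x → P ⊛ P ∣ a ⊛ x → P ⊛ P ∣ x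
regular-square {P} {a} uP regular x (divides h ax≈PPh) =
  divides z (≈-trans (_∣_.equality P∣x) (≈-trans (⊛-congˡ P (_∣_.equality P∣y)) (≈-sym (⊛-assoc P P z))))
  where
  P∣x : P ∣ x
  P∣x = regular x (divides (P ⊛ h) (≈-trans ax≈PPh (⊛-assoc P P h)))
  y z : Poly
  y = _∣_.quotient P∣x
  P∣y : P ∣ y
  P∣y = regular y (divides h (⊛-cancelˡ P uP (a ⊛ y) (P ⊛ h) (begin
    P ⊛ (a ⊛ y)  ≈⟨ solve 3 (λ P a y → P :* (a :* y) := a :* (P :* y)) ≈-refl P a y ⟩
    a ⊛ (P ⊛ y)  ≈⟨ ⊛-congˡ a (_∣_.equality P∣x) ⟨
    a ⊛ x        ≈⟨ ax≈PPh ⟩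
    (P ⊛ P) ⊛ h  ≈⟨ ⊛-assoc P P h ⟩
    P ⊛ (P ⊛ h)  ∎)))
  z = _∣_.quotient P∣y

∣-negP : ∀ {m p} → m ∣ p → m ∣ negP p
∣-negP {m} (divides g p≈) = divides (negP g)
  (≈-trans (negP-cong p≈) (solve 2 (λ m g → :- (m :* g) := m :* (:- g)) ≈-refl m g))

∣-negate-factor : ∀ {m} a b x → m ∣ (a ⊖ b) ⊛ x → m ∣ (b ⊖ a) ⊛ x
∣-negate-factor a b x m∣ = ∣-≈ (solve 3 (λ a b x → :- ((a :- b) :* x) := (b :- a) :* x) ≈-refl a b x) (∣-negP m∣)

Φ-cancel : ∀ n d → d < n → ∀ x → Φ (suc n) ∣ (oneP ⊖ mono (suc d)) ⊛ x → Φ (suc n) ∣ x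
Φ-cancel n d d<n x Φ∣ = Coprime-cancel {Φ (suc n)} {mono-1 (suc d)} (unitConstant (cyclotomic n))
  (Φ-coprime-mono-1 n d d<n (λ k _ → cyclotomic k))
  (∣-negate-factor oneP (mono (suc d)) x Φ∣)

Φ²-cancel : ∀ n d → d < n → ∀ x → Φ (suc n) ⊛ Φ (suc n) ∣ (oneP ⊖ mono (suc d)) ⊛ x → Φ (suc n) ⊛ Φ (suc n) ∣ x
Φ²-cancel n d d<n = regular-square {Φ (suc n)} {oneP ⊖ mono (suc d)} (unitConstant (cyclotomic n)) (Φ-cancel n d d<n)

-- The congruence in ℤ[q]

open import Algebra.Properties.Semiring.Exp PR.semiring using (_^_)
open FiniteSums polyRing using (Sum; Sum-cong)

q : Poly
q = mono 1

module PB = QBinomials polyRing q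

mono≈^ : ∀ k → mono k ≈ q ^ k
mono≈^ zero = ≈-refl
mono≈^ (suc k) = ≈-trans (mono-suc k) (⊛-congˡ q (mono≈^ k))

1-mono≈ : ∀ k → oneP ⊖ mono k ≈ oneP ⊖ q ^ k
1-mono≈ k = ⊕-congˡ oneP (negP-cong (mono≈^ k))

qpoch-suc : ∀ m → qpoch (suc m) ≈ qpoch m ⊛ (oneP ⊖ mono (suc m))
qpoch-suc m = ≈-trans
  (PR.reflexive (≡.cong prodP (≡.trans (≡.cong (map factor) (≡.sym (upTo-∷ʳ m))) (map-++ factor (upTo m) (m ∷ [])))))
  (≈-trans (prodP-++ (map factor (upTo m)) (factor m ∷ [])) (⊛-congˡ (qpoch m) (PR.*-identityʳ (factor m))))
  where
  factor : ℕ → Poly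
  factor k = oneP ⊖ mono (suc k)

qpoch≈poch : ∀ m → qpoch m ≈ PB.poch m
qpoch≈poch zero = ≈-refl
qpoch≈poch (suc m) = ≈-trans (qpoch-suc m) (⊛-cong (qpoch≈poch m) (1-mono≈ (suc m)))

Monic±-negP : ∀ {p} → Monic± p → Monic± (negP p)
Monic±-negP {p} monic = record
  { degree = degree ; unit = ℤ.- unit
  ; unit² = ≡.trans (≡.sym (ℤ.neg-distribˡ-* unit (ℤ.- unit)))
    (≡.trans (≡.cong ℤ.-_ (≡.sym (ℤ.neg-distribʳ-* unit unit)))
      (≡.trans (ℤ.neg-involutive _) unit²))
  ; lead = record
    { top = ≡.trans (coef-negP p degree) (≡.cong ℤ.-_ (Lead.top lead))
    ; above = λ i d<i → ≡.trans (coef-negP p i) (≡.cong ℤ.-_ (Lead.above lead i d<i)) } }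
  where open Monic± monic

Monic±-qpoch : ∀ m → Monic± (qpoch m)
Monic±-qpoch zero = record
  { degree = 0 ; unit = + 1 ; unit² = ≡.refl ; lead = record { top = ≡.refl ; above = λ { (suc i) _ → ≡.refl } } }
Monic±-qpoch (suc m) = Monic±-≈ (≈-sym (qpoch-suc m)) (Monic±-⊛ {qpoch m} {oneP ⊖ mono (suc m)} (Monic±-qpoch m)
  (Monic±-≈ (swap (mono (suc m)) oneP) (Monic±-negP (Monic±-mono-1 m))))
  where
  open PS
  swap : ∀ a b → negP (a ⊖ b) ≈ b ⊖ a
  swap a b = solve 2 (λ a b → :- (a :- b) := b :- a) ≈-refl a b

-- The identity `binom-factorials` exhibits the division in `qbinom` as exact, with the recursively
-- defined coefficient as cofactor.
qbinom≈binom : ∀ i j → qbinom (i ℕ.+ j) i ≈ PB.binom (i ℕ.+ j) i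
qbinom≈binom i j with i ≤ᵇ i ℕ.+ j | ℕ.≤⇒≤ᵇ (ℕ.m≤m+n i j)
... | true | _ = ÷-exact (Monic±-⊛ {qpoch i} (Monic±-qpoch i) (Monic±-qpoch (i ℕ.+ j ∸ i))) (begin
  qpoch (i ℕ.+ j)                              ≈⟨ qpoch≈poch (i ℕ.+ j) ⟩
  PB.poch (i ℕ.+ j)                            ≈⟨ PB.binom-factorials i j ⟨
  (PB.poch i ⊛ PB.poch j) ⊛ PB.binom (i ℕ.+ j) i  ≈⟨ ⊛-congʳ (PB.binom (i ℕ.+ j) i) (⊛-cong (qpoch≈poch i)
                                                     (≈-trans (PR.reflexive (≡.cong qpoch (ℕ.m+n∸m≡n i j)))
                                                       (qpoch≈poch j))) ⟨
  (qpoch i ⊛ qpoch (i ℕ.+ j ∸ i)) ⊛ PB.binom (i ℕ.+ j) i ∎)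

sumP-++ : ∀ ps rs → sumP (ps ++ rs) ≈ sumP ps ⊕ sumP rs
sumP-++ [] rs = ≈-refl
sumP-++ (p ∷ ps) rs = ≈-trans (⊕-congˡ p (sumP-++ ps rs)) (≈-sym (⊕-assoc p (sumP ps) (sumP rs)))

-- A general generator g is needed because the recursion behind `upTo` shifts it.
sumP-map : ∀ (f : ℕ → Poly) g n → sumP (map f (applyUpTo g n)) ≈ Sum n (λ k → f (g k))
sumP-map f g zero = ≈-refl
sumP-map f g (suc n) = ⊕-congˡ (f (g 0)) (sumP-map f (λ k → g (suc k)) n)

sumP-concatMap : ∀ (F : ℕ → List Poly) g n → sumP (concatMap F (applyUpTo g n)) ≈ Sum n (λ k → sumP (F (g k)))
sumP-concatMap F g zero = ≈-refl
sumP-concatMap F g (suc n) = ≈-trans (sumP-++ (F (g 0)) _)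
  (⊕-congˡ (sumP (F (g 0))) (sumP-concatMap F (λ k → g (suc k)) n))

lhsSum≈Sum : ∀ n → lhsSum n ≈ Sum n (λ i → Sum n (λ j →
  q ^ (j ℕ.* j ℕ.+ i ℕ.+ j) ⊛ (PB.binom (i ℕ.+ j) i ⊛ PB.binom (i ℕ.+ j) i)))
lhsSum≈Sum n = ≈-trans (sumP-concatMap _ (λ k → k) n)
  (Sum-cong n (λ i _ → ≈-trans (sumP-map _ (λ k → k) n) (Sum-cong n (λ j _ →
  ⊛-cong (mono≈^ (j ℕ.* j ℕ.+ i ℕ.+ j)) (⊛-cong (qbinom≈binom i j) (qbinom≈binom i j))))))

module _ (m : Poly) where
  open Quotient polyRing m

  ∣⇒≋0 : ∀ {x} → m ∣ x → x ≋ []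
  ∣⇒≋0 {x} (divides g x≈mg) = congruent g (≈-trans (⊕-identityʳ x) x≈mg)

  ≋0⇒∣ : ∀ {x} → x ≋ [] → m ∣ x
  ≋0⇒∣ {x} (congruent g eq) = divides g (≈-trans (≈-sym (⊕-identityʳ x)) eq)

  regular-power : ∀ k → (∀ x → m ∣ (oneP ⊖ mono k) ⊛ x → m ∣ x) → ∀ x → (oneP ⊖ q ^ k) ⊛ x ≋ [] → x ≋ []
  regular-power k regular x eq = ∣⇒≋0 (regular x (∣-≈ (⊛-congʳ x (≈-sym (1-mono≈ k))) (≋0⇒∣ {(oneP ⊖ q ^ k) ⊛ x} eq)))

  ≋⇒modP : ∀ {x y p r} → p ≈ x → x ≋ y → r ≈ y → p ≡ r [modP m ]
  ≋⇒modP {x} {y} {p} {r} p≈x (congruent g eq) r≈y = g , ≈⇒IsZero (≈-trans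
    (⊕-congʳ (negP (m ⊛ g)) (≈-trans (⊕-cong p≈x (negP-cong r≈y)) eq)) (⊕-inverseʳ (m ⊛ g)))

q^n≋1 : ∀ n → Quotient._≋_ polyRing (Φ (suc n)) (q ^ suc n) oneP
q^n≋1 n = Quotient.congruent _∣Φ.quotient (≈-trans (⊕-congʳ (negP oneP) (≈-sym (mono≈^ (suc n)))) _∣Φ.equality)
  where module _∣Φ = _∣_ (Cyclotomic.Φ∣mono-1 (cyclotomic n))

module Φ-Congruence (n : ℕ) = Congruence polyRing (Φ (suc n)) q n (q^n≋1 n)
  (λ d d<n → regular-power (Φ (suc n)) (suc d) (Φ-cancel n d d<n))
  (λ d d<n → regular-power (Φ (suc n) ⊛ Φ (suc n)) (suc d) (Φ²-cancel n d d<n))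

-- The right-hand side by residue classes modulo 3

legendre3-1 : ∀ {n} → n % 3 ≡ 1 → legendre3 n ≡ + 1
legendre3-1 {n} eq with n % 3 | eq
... | _ | ≡.refl = ≡.refl

legendre3-2 : ∀ {n} → n % 3 ≡ 2 → legendre3 n ≡ -[1+ 0 ]
legendre3-2 {n} eq with n % 3 | eq
... | _ | ≡.refl = ≡.refl

legendre3-0 : ∀ {n} → n % 3 ≡ 0 → legendre3 n ≡ + 0
legendre3-0 {n} eq with n % 3 | eq
... | _ | ≡.refl = ≡.refl

rhsTerm≈ : ∀ n e {s} → legendre3 n ≡ s → n ℕ.* n ∸ 1 ≡ e ℕ.* 3 → rhsTerm n ≈ scale s (q ^ e)
rhsTerm≈ n e {s} legendre eq = ≈-trans
  (PR.reflexive (≡.cong₂ (λ s e → scale s (mono e)) legendre (≡.trans (≡.cong (_/ 3) eq) (m*n/n≡m e 3))))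
  (scale-cong s (mono≈^ e))

scale--1 : ∀ p → scale -[1+ 0 ] p ≈ negP p
scale--1 p = equal λ i → ≡.trans (coef-scale -[1+ 0 ] p i) (≡.trans (ℤ.-1*i≡-i (coef p i)) (≡.sym (coef-negP p i)))

data Residue : ℕ → Set where
  residue : ∀ r k → r < 3 → Residue (r ℕ.+ k ℕ.* 3)

residue? : ∀ n → Residue n
residue? zero = residue 0 0 (s≤s z≤n)
residue? (suc n) with residue? n
... | residue 0 k _ = residue 1 k (s≤s (s≤s z≤n))
... | residue 1 k _ = residue 2 k (s≤s (s≤s (s≤s z≤n)))
... | residue 2 k _ = residue 0 (suc k) (s≤s z≤n)
... | residue (suc (suc (suc _))) k (s≤s (s≤s (s≤s ())))

-- When 3 divides n the exponent is rounded down by the integer division, but its monomial is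
-- multiplied by 0.
rhsTerm₀ : ∀ k → rhsTerm (suc (2 ℕ.+ k ℕ.* 3)) ≈ []
rhsTerm₀ k = ≈-trans (PR.reflexive (≡.cong (λ s → scale s (mono ((n ℕ.* n ∸ 1) / 3)))
  (legendre3-0 {n} ([m+kn]%n≡m%n 0 (suc k) 3))))
  (scale-zero (mono ((n ℕ.* n ∸ 1) / 3)))
  where
  n = suc (2 ℕ.+ k ℕ.* 3)

rhsTerm₁ : ∀ k → rhsTerm (suc (k ℕ.* 3)) ≈ q ^ exponent₁ k
rhsTerm₁ k = ≈-trans (rhsTerm≈ (suc (k ℕ.* 3)) (exponent₁ k) (legendre3-1 {suc (k ℕ.* 3)} ([m+kn]%n≡m%n 1 k 3))
  (arithmetic k)) (scale-one (q ^ exponent₁ k))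
  where
  -- The left-hand side is what `n * n ∸ 1` computes to when n is the successor of 3k.
  arithmetic : ∀ k → k ℕ.* 3 ℕ.+ k ℕ.* 3 ℕ.* suc (k ℕ.* 3) ≡ k ℕ.* (k ℕ.* 3 ℕ.+ 2) ℕ.* 3
  arithmetic = solve-∀

rhsTerm₂ : ∀ k → rhsTerm (suc (1 ℕ.+ k ℕ.* 3)) ≈ negP (q ^ exponent₂ k)
rhsTerm₂ k = ≈-trans (rhsTerm≈ (suc (1 ℕ.+ k ℕ.* 3)) (exponent₂ k)
  (legendre3-2 {suc (1 ℕ.+ k ℕ.* 3)} ([m+kn]%n≡m%n 2 k 3)) (arithmetic k)) (scale--1 (q ^ exponent₂ k))
  where
  arithmetic : ∀ k → suc (k ℕ.* 3) ℕ.+ suc (k ℕ.* 3) ℕ.* suc (suc (k ℕ.* 3)) ≡ suc (k ℕ.* 3) ℕ.* suc k ℕ.* 3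
  arithmetic = solve-∀

lhsSum-congruence : ∀ n {y} → Quotient._≋_ polyRing (Φ (suc n) ⊛ Φ (suc n)) (Φ-Congruence.doubleSum n) y →
  rhsTerm (suc n) ≈ y → lhsSum (suc n) ≡ rhsTerm (suc n) [modP Φ (suc n) ⊛ Φ (suc n) ]
lhsSum-congruence n = ≋⇒modP (Φ (suc n) ⊛ Φ (suc n)) (lhsSum≈Sum (suc n))

theorem1p3 : (n : ℕ) → 1 ≤ n → lhsSum n ≡ rhsTerm n [modP Φ n ⊛ Φ n ]
-- The matched `n` is one less than the order, so the residues 0, 1 and 2 belong to the symbol
-- values 1, -1 and 0.
theorem1p3 (suc n) _ with residue? n
... | residue 0 k _ = lhsSum-congruence n (Φ-Congruence.doubleSum₁ n k ≡.refl) (rhsTerm₁ k)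
... | residue 1 k _ = lhsSum-congruence n (Φ-Congruence.doubleSum₂ n k ≡.refl) (rhsTerm₂ k)
... | residue 2 k _ = lhsSum-congruence n (Φ-Congruence.doubleSum₀ n k ≡.refl) (rhsTerm₀ k)
... | residue (suc (suc (suc _))) k (s≤s (s≤s (s≤s ())))
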